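{- For a fixed $k \geq 0$, let $\mathcal{L}_n^k$ be the collection of all planar $n$-point configurations in which $n-k$ of the points (including the point off the line) form a projected polygon configuration, with line $\ell$, and the remaining $k$ points are placed arbitrarily on the line $\ell$. Then $$\max_{\mathcal{P} \in \mathcal{L}_n^k} A(\mathcal{P}) = \Theta(nk).$$
   Context: For a finite set $\mathcal P \subset \mathbb{R}^2$, $A(\mathcal P)$ denotes the number of distinct angles in the open interval $(0,\pi)$ determined by triples of distinct points of $\mathcal P$ (angles of $0$ and $\pi$ are not counted). Projected polygon configuration on $m$ points: take the vertices of a regular $m$-gon and fix a vertex $p$. If $m$ is even, let $q$ be the vertex opposite $p$ and let $\ell$ be a line perpendicular to $\overline{pq}$ not passing through $p$ (all such choices give similar configurations). If $m$ is odd, let $\ell$ be the line through the two vertices at minimal distance from $p$. Project each vertex $r \ne p$ to the intersection point of the line $pr$ with $\ell$. The configuration consists of $p$ (the point off the line) together with the $m-1$ projected points on $\ell$. $f = O(g)$ means there is a constant $C$ with $f(n) \le C g(n)$ for all sufficiently large $n$; $f=\Omega(g)$ means $g = O(f)$; $f=\Theta(g)$ means both $f=O(g)$ and $f=\Omega(g)$.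
   Formalization: At k = 0 the bound Θ(nk) would read Θ(0), which is false since the maximum is then of order n; nk is replaced by n·max(k,1), equal to nk for every k ≥ 1. As k is fixed, the constants in Θ may depend on k. -}

module Defs where

open import Level using (0ℓ)
open import Algebra.Bundles using (CommutativeRing)
open import Data.Nat.Base as ℕ using (ℕ; zero; suc)
open import Data.Fin.Base using (Fin)
open import Data.Product.Base using (Σ; ∃; ∃-syntax; _×_; _,_; proj₁; proj₂)
open import Data.Sum.Base using (_⊎_)
open import Relation.Nullary.Negation.Core using (¬_)
open import Relation.Binary.Core using (Rel)
open import Relation.Binary.Structures using (IsStrictTotalOrder)
open import Relation.Binary.PropositionalEquality.Core using (_≡_; _≢_)
import Relation.Binary.Construct.StrictToNonStrict as StrictToNonStrict

------------------------------------------------------------------------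
-- Asymptotic notation for functions ℕ → ℕ.  A real constant can always be
-- rounded up, so a natural-number constant loses nothing.

infix 4 _=O_ _=Ω_ _=Θ_

_=O_ : (ℕ → ℕ) → (ℕ → ℕ) → Set
f =O g = ∃[ C ] ∃[ N ] (∀ n → N ℕ.≤ n → f n ℕ.≤ C ℕ.* g n)

_=Ω_ : (ℕ → ℕ) → (ℕ → ℕ) → Set
f =Ω g = g =O f

_=Θ_ : (ℕ → ℕ) → (ℕ → ℕ) → Set
f =Θ g = (f =O g) × (f =Ω g)

IsMaximum : (ℕ → Set) → ℕ → Set
IsMaximum S a = S a × (∀ b → S b → b ℕ.≤ a)

------------------------------------------------------------------------
-- The real numbers, axiomatised (uniquely up to isomorphism) as a
-- Dedekind-complete ordered field.

record RealNumbers : Set₁ where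
  field
    commutativeRing : CommutativeRing 0ℓ 0ℓ

  open CommutativeRing commutativeRing public

  infix 4 _<_
  field
    _<_                : Rel Carrier 0ℓ
    isStrictTotalOrder : IsStrictTotalOrder _≈_ _<_
    0≉1                : ¬ (0# ≈ 1#)
    inverse            : ∀ x → ¬ (x ≈ 0#) → ∃[ y ] (x * y ≈ 1#)
    +-monoʳ-<          : ∀ x {y z} → y < z → x + y < x + z
    *-pos              : ∀ {x y} → 0# < x → 0# < y → 0# < x * y

  open StrictToNonStrict _≈_ _<_ public using (_≤_)

  IsUpperBound : (Carrier → Set) → Carrier → Set
  IsUpperBound S b = ∀ x → S x → x ≤ b

  IsSupremum : (Carrier → Set) → Carrier → Set
  IsSupremum S s = IsUpperBound S s × (∀ b → IsUpperBound S b → s ≤ b)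

  field
    complete : (S : Carrier → Set) → ∃ S → ∃ (IsUpperBound S) → ∃ (IsSupremum S)

module Plane (ℝ : RealNumbers) where
  open RealNumbers ℝ

  HasCardinality : (Carrier → Set) → ℕ → Set
  HasCardinality S a =
    Σ (Fin a → Carrier) λ e →
      (∀ i → S (e i)) ×
      (∀ i j → e i ≈ e j → i ≡ j) ×
      (∀ x → S x → ∃[ i ] (x ≈ e i))

  ----------------------------------------------------------------------
  -- Points and vectors of ℝ²

  Point : Set
  Point = Carrier × Carrier

  infix  4 _≐_
  infixl 6 _⊖_

  _≐_ : Point → Point → Set
  (x , y) ≐ (x′ , y′) = x ≈ x′ × y ≈ y′

  _⊖_ : Point → Point → Point
  (x , y) ⊖ (x′ , y′) = (x - x′ , y - y′)

  dot cross : Point → Point → Carrier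
  dot   (x , y) (x′ , y′) = x * x′ + y * y′
  cross (x , y) (x′ , y′) = x * y′ - y * x′

  -- Twice the signed area of abc: positive iff a, b, c turn counterclockwise.
  orient : Point → Point → Point → Carrier
  orient a b c = cross (b ⊖ a) (c ⊖ a)

  IsDistance : Point → Point → Carrier → Set
  IsDistance a b d = 0# ≤ d × d * d ≈ dot (b ⊖ a) (b ⊖ a)

  ----------------------------------------------------------------------
  -- Angle measure in radians.  arccos x is the length of the arc of the
  -- upper unit semicircle from (1 , 0) to the point with abscissa x, i.e.
  -- the supremum of the lengths of the polygonal paths inscribed in it.

  OnUpperSemicircle : Point → Set
  OnUpperSemicircle (x , y) = x * x + y * y ≈ 1# × 0# ≤ y

  IsChord : Point → Point → Carrier → Set
  IsChord a b d =
    OnUpperSemicircle a × OnUpperSemicircle b × proj₁ b ≤ proj₁ a × IsDistance a b d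

  -- InscribedPath a b l: a path of length l from a to b along chords whose
  -- endpoints follow the semicircle counterclockwise.
  data InscribedPath : Point → Point → Carrier → Set where
    [_] : ∀ {a b d} → IsChord a b d → InscribedPath a b d
    _∷_ : ∀ {a b c d l} → IsChord a b d → InscribedPath b c l → InscribedPath a c (d + l)

  IsArccos : Carrier → Carrier → Set
  IsArccos x = IsSupremum (λ l → ∃[ y ] InscribedPath (1# , 0#) (x , y) l)

  Isπ : Carrier → Set
  Isπ = IsArccos (- 1#)

  -- θ = ∠abc (vertex b) = arccos (⟨a - b , c - b⟩ / (|ba| |bc|)).
  -- Only meaningful for a, c distinct from b.
  IsAngle : Point → Point → Point → Carrier → Set
  IsAngle a b c θ =
    ∃[ x ] ∃[ r ] ∃[ s ]
      (IsDistance b a r × IsDistance b c s ×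
       x * (r * s) ≈ dot (a ⊖ b) (c ⊖ b) × IsArccos x θ)

  ----------------------------------------------------------------------
  -- Configurations of n points, and A(P)

  Distinct : ∀ {n} → (Fin n → Point) → Set
  Distinct P = ∀ i j → P i ≐ P j → i ≡ j

  DeterminedAngle : ∀ {n} → (Fin n → Point) → Carrier → Set
  DeterminedAngle P θ =
    (∃[ i ] ∃[ j ] ∃[ l ]
      (i ≢ j × j ≢ l × i ≢ l × IsAngle (P i) (P j) (P l) θ)) ×
    0# < θ × (∃[ π ] (Isπ π × θ < π))

  A[_]=_ : ∀ {n} → (Fin n → Point) → ℕ → Set
  A[ P ]= a = HasCardinality (DeterminedAngle P) a

  ----------------------------------------------------------------------
  -- Lines

  record Line : Set where
    field
      base      : Point
      direction : Point
      nonzero   : ¬ (direction ≐ (0# , 0#))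

  _∈ₗ_ : Point → Line → Set
  a ∈ₗ ℓ = cross (Line.direction ℓ) (a ⊖ Line.base ℓ) ≈ 0#

  -- x lies on the line through the distinct points a and b.
  OnLineThrough : Point → Point → Point → Set
  OnLineThrough a b x = ¬ (a ≐ b) × orient a b x ≈ 0#

  -- ℓ is perpendicular to the line through a and b.
  Perpendicular : Line → Point → Point → Set
  Perpendicular ℓ a b = dot (Line.direction ℓ) (b ⊖ a) ≈ 0#

  ----------------------------------------------------------------------
  -- Regular polygons: equilateral, equiangular, convex.  The vertices are
  -- listed counterclockwise by a sequence of period m; `convex` says that
  -- every other vertex is strictly to the left of each directed side.

  record IsRegularPolygon (m : ℕ) (v : ℕ → Point) : Set where
    field
      3≤m         : 3 ℕ.≤ m
      periodic    : ∀ i → v (i ℕ.+ m) ≐ v i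
      equilateral : ∃[ d ] (∀ i → IsDistance (v i) (v (1 ℕ.+ i)) d)
      equiangular : ∃[ α ] (∀ i → IsAngle (v i) (v (1 ℕ.+ i)) (v (2 ℕ.+ i)) α)
      convex      : ∀ i t → 2 ℕ.+ t ℕ.< m →
                    0# < orient (v i) (v (1 ℕ.+ i)) (v (2 ℕ.+ t ℕ.+ i))

  -- v i is a vertex other than v 0 with no vertex other than v 0 nearer to v 0.
  NearestToStart : ℕ → (ℕ → Point) → ℕ → Set
  NearestToStart m v i =
    0 ℕ.< i × i ℕ.< m ×
    (∀ j → 0 ℕ.< j → j ℕ.< m →
      dot (v i ⊖ v 0) (v i ⊖ v 0) ≤ dot (v j ⊖ v 0) (v j ⊖ v 0))

  ----------------------------------------------------------------------
  -- Projected polygons.  The vertices are numbered from the fixed vertex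
  -- p = v 0, so for m = 2h the opposite vertex is v h.

  data IsProjectionLine (m : ℕ) (v : ℕ → Point) (ℓ : Line) : Set where
    even : ∀ h → m ≡ 2 ℕ.* h →
           Perpendicular ℓ (v 0) (v h) → ¬ (v 0 ∈ₗ ℓ) →
           IsProjectionLine m v ℓ
    odd  : ∀ h → m ≡ 1 ℕ.+ 2 ℕ.* h →
           ∀ i j → i ≢ j → NearestToStart m v i → NearestToStart m v j →
           v i ∈ₗ ℓ → v j ∈ₗ ℓ →
           IsProjectionLine m v ℓ

  record ProjectedPolygon (m : ℕ) : Set where
    field
      v        : ℕ → Point
      regular  : IsRegularPolygon m v
      ℓ        : Line
      ℓ-choice : IsProjectionLine m v ℓ
      image    : ℕ → Point
      image-∈  : ∀ i → 0 ℕ.< i → i ℕ.< m →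
                 OnLineThrough (v 0) (v i) (image i) × image i ∈ₗ ℓ

  -- Only the values image 1, …, image (m - 1) belong to the configuration.
  _∈ₚ_ : ∀ {m} → Point → ProjectedPolygon m → Set
  _∈ₚ_ {m} x C = (x ≐ v 0) ⊎ (∃[ i ] (0 ℕ.< i × i ℕ.< m × x ≐ image i))
    where open ProjectedPolygon C

  ----------------------------------------------------------------------
  -- 𝓛 k n P: P is n distinct points, containing a projected polygon on
  -- m = n - k points, all of whose other (hence k) points lie on its line.

  𝓛 : ℕ → (n : ℕ) → (Fin n → Point) → Set
  𝓛 k n P =
    Distinct P ×
    (∃[ m ] (m ℕ.+ k ≡ n × Σ (ProjectedPolygon m) λ C →
      (∀ x → x ∈ₚ C → ∃[ j ] (P j ≐ x)) ×
      (∀ j → (P j ∈ₚ C) ⊎ (P j ∈ₗ ProjectedPolygon.ℓ C))))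

  -- The values taken by A on the collection 𝓛 k n.
  AngleCounts : ℕ → ℕ → ℕ → Set
  AngleCounts k n a = ∃[ P ] (𝓛 k n P × A[ P ]= a)

-- Write m = n - k. A regular m-gon is, up to similarity, the polygon with vertices Im ζⁱ · ζⁱ for the unit ζ = exp (iπ/m), so
-- the projected vertex number i lies on the line through p with direction ζⁱ and two projected vertices subtend at p an angle
-- whose cosine is ± Re ζʲ⁻ⁱ: at most 2m angles. A vertex on ℓ contributes at most two angles with p and ℓ, and an angle at p
-- with a leg through one of the k additional points is determined by that point and the other leg. This gives O(nk) angles,
-- with k read as max(k, 1). Conversely, sliding a point along ℓ towards its last point r strictly changes the angle it makes
-- with p and r, so every configuration with p off ℓ has at least n - 2 angles, which suffices because k is fixed. Since
-- angles are compared through the strictly decreasing arc cosine, only cosines need to be computed. The number ζ itself is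
-- obtained from completeness: its real part is the largest zero of a Chebyshev polynomial of the second kind.

module Submission where

open import Level using (0ℓ)
open import Axiom.ExcludedMiddle using (ExcludedMiddle)
open import Data.Product using (Σ; _×_)
open import Defs

import Algebra.Properties.AbelianGroup as AbelianGroupProperties
import Algebra.Properties.Ring as RingProperties
import Algebra.Properties.Semiring.Mult.TCOptimised as Mult
import Algebra.Solver.Ring as RingSolver
import Algebra.Solver.Ring.AlmostCommutativeRing as ACR
open import Data.Bool.Base using (Bool; true; false)
open import Data.Empty using (⊥; ⊥-elim)
open import Data.Fin.Base as Fin using (Fin; zero; suc)
import Data.Fin.Properties as Fin
open import Data.Integer.Base as ℤ using (ℤ; +_; -[1+_])
import Data.Integer.Properties as ℤ
open import Data.Maybe.Base using (Maybe; just; nothing)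
open import Data.Nat.Base as ℕ using (ℕ; zero; suc)
import Data.Nat.Properties as ℕ
open import Data.Nat.Solver using (module +-*-Solver)
open import Data.Product.Base using (∃; ∃-syntax; _,_; proj₁; proj₂)
open import Data.Product.Function.NonDependent.Propositional using (_×-↔_)
import Data.Sign.Base as Sign
open import Data.Sum.Base using (_⊎_; inj₁; inj₂; [_,_]′)
open import Data.Sum.Function.Propositional using (_⊎-↔_)
open import Function.Bundles using (_↔_; Inverse)
open import Function.Properties.Inverse using (↔-refl; ↔-trans)
import Relation.Binary.Construct.StrictToNonStrict as StrictToNonStrict
open import Relation.Binary.Definitions using (tri<; tri≈; tri>)
import Relation.Binary.PropositionalEquality as ≡
open ≡ using (_≡_; _≢_)
import Relation.Binary.Reasoning.Setoid as SetoidReasoning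
open import Relation.Binary.Structures using (IsStrictTotalOrder; IsTotalOrder)
open import Relation.Nullary using (¬_; Dec; yes; no)

-- The two bounds meet regular polygons from opposite sides. The upper bound is given an arbitrary
-- one, known only through equal sides, equal angles and convexity; consecutive sides differ by a
-- common rotation, and ζ is a square root of that rotation. The lower bound must produce a polygon
-- for every m of either parity, and there the signs of Im ζʲ for 0 < j < m carry everything:
-- convexity, the nearest vertices, and the order of the projected points along ℓ. Asking for the
-- largest zero rather than for some zero is what makes these signs available. The axioms for the
-- reals come with neither absolute values nor trigonometry, so continuity is stated for squared
-- increments, square roots are found by the same completeness argument as ζ, and an angle exists
-- only once the lengths of inscribed paths have been bounded. Finite cardinalities are obtained
-- classically from a coding: a code may denote a cosine that no triple realises, so coincidences
-- between angles never have to be worked out.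

module Development (em : ExcludedMiddle 0ℓ) (ℝ : RealNumbers) where
  open RealNumbers ℝ hiding (zero)
  open Plane ℝ
  open IsStrictTotalOrder isStrictTotalOrder using (compare; <-respˡ-≈; <-respʳ-≈)
    renaming (trans to <-trans; irrefl to <-irrefl)

  -- Integer coefficients for the ring solver

  module IntegerCoefficients where
    open Mult semiring using (×-homo-+; ×1-homo-*) renaming (_×_ to _⊗_)
    open RingProperties ring
    open AbelianGroupProperties +-abelianGroup using (⁻¹-∙-comm)
    open SetoidReasoning setoid

    -- With this form of multiples, `con (+ 1)` and `con (+ 2)` are literally `1#` and `1# + 1#`,
    -- the forms in which constants occur below.
    fromℤ : ℤ → Carrier
    fromℤ (+ n)    = n ⊗ 1#
    fromℤ -[1+ n ] = - (suc n ⊗ 1#)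

    fromℤ-neg : ∀ i → fromℤ (ℤ.- i) ≈ - fromℤ i
    fromℤ-neg (+ zero)    = sym -0#≈0#
    fromℤ-neg (+ (suc n)) = refl
    fromℤ-neg -[1+ n ]    = sym (-‿involutive _)

    1+⊗ : ∀ n → suc n ⊗ 1# ≈ 1# + n ⊗ 1#
    1+⊗ n = ×-homo-+ 1# 1 n

    fromℤ-⊖ : ∀ m n → fromℤ (m ℤ.⊖ n) ≈ m ⊗ 1# - n ⊗ 1#
    fromℤ-⊖ zero    zero    = sym (-‿inverseʳ 0#)
    fromℤ-⊖ zero    (suc n) = sym (+-identityˡ _)
    fromℤ-⊖ (suc m) zero    = sym (trans (+-congˡ -0#≈0#) (+-identityʳ _))
    fromℤ-⊖ (suc m) (suc n) = begin
      fromℤ (suc m ℤ.⊖ suc n)                        ≡⟨ ≡.cong fromℤ (ℤ.[1+m]⊖[1+n]≡m⊖n m n) ⟩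
      fromℤ (m ℤ.⊖ n)                                ≈⟨ fromℤ-⊖ m n ⟩
      m ⊗ 1# - n ⊗ 1#                                ≈⟨ +-congʳ (+-identityˡ _) ⟨
      (0# + m ⊗ 1#) - n ⊗ 1#                         ≈⟨ +-congʳ (+-congʳ (-‿inverseʳ 1#)) ⟨
      ((1# - 1#) + m ⊗ 1#) - n ⊗ 1#                  ≈⟨ +-congʳ (+-assoc _ _ _) ⟩
      (1# + (- 1# + m ⊗ 1#)) - n ⊗ 1#                ≈⟨ +-congʳ (+-congˡ (+-comm _ _)) ⟩
      (1# + (m ⊗ 1# - 1#)) - n ⊗ 1#                  ≈⟨ +-congʳ (+-assoc _ _ _) ⟨
      ((1# + m ⊗ 1#) - 1#) - n ⊗ 1#                  ≈⟨ +-assoc _ _ _ ⟩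
      (1# + m ⊗ 1#) + (- 1# - n ⊗ 1#)                ≈⟨ +-cong (sym (1+⊗ m)) (⁻¹-∙-comm _ _) ⟩
      suc m ⊗ 1# - (1# + n ⊗ 1#)                     ≈⟨ +-congˡ (-‿cong (1+⊗ n)) ⟨
      suc m ⊗ 1# - suc n ⊗ 1#                        ∎

    fromℤ-+ : ∀ i j → fromℤ (i ℤ.+ j) ≈ fromℤ i + fromℤ j
    fromℤ-+ (+ m)    (+ n)    = ×-homo-+ 1# m n
    fromℤ-+ (+ m)    -[1+ n ] = fromℤ-⊖ m (suc n)
    fromℤ-+ -[1+ m ] (+ n)    = trans (fromℤ-⊖ n (suc m)) (+-comm _ _)
    fromℤ-+ -[1+ m ] -[1+ n ] = begin
      - (suc (suc (m ℕ.+ n)) ⊗ 1#)      ≡⟨ ≡.cong (λ k → - (suc k ⊗ 1#)) (ℕ.+-suc m n) ⟨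
      - ((suc m ℕ.+ suc n) ⊗ 1#)        ≈⟨ -‿cong (×-homo-+ 1# (suc m) (suc n)) ⟩
      - (suc m ⊗ 1# + suc n ⊗ 1#)       ≈⟨ ⁻¹-∙-comm _ _ ⟨
      - (suc m ⊗ 1#) - suc n ⊗ 1#       ∎

    fromℤ-* : ∀ i j → fromℤ (i ℤ.* j) ≈ fromℤ i * fromℤ j
    fromℤ-* (+ m) (+ n) = trans (reflexive (≡.cong fromℤ (ℤ.+◃n≡+n (m ℕ.* n)))) (×1-homo-* m n)
    fromℤ-* (+ m) -[1+ n ] = begin
      fromℤ (Sign.- ℤ.◃ (m ℕ.* suc n))  ≡⟨ ≡.cong fromℤ (ℤ.-◃n≡-n (m ℕ.* suc n)) ⟩
      fromℤ (ℤ.- (+ (m ℕ.* suc n)))     ≈⟨ fromℤ-neg (+ (m ℕ.* suc n)) ⟩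
      - ((m ℕ.* suc n) ⊗ 1#)            ≈⟨ -‿cong (×1-homo-* m (suc n)) ⟩
      - ((m ⊗ 1#) * (suc n ⊗ 1#))       ≈⟨ -‿distribʳ-* _ _ ⟩
      m ⊗ 1# * - (suc n ⊗ 1#)           ∎
    fromℤ-* -[1+ m ] (+ n) = begin
      fromℤ (Sign.- ℤ.◃ (suc m ℕ.* n))  ≡⟨ ≡.cong fromℤ (ℤ.-◃n≡-n (suc m ℕ.* n)) ⟩
      fromℤ (ℤ.- (+ (suc m ℕ.* n)))     ≈⟨ fromℤ-neg (+ (suc m ℕ.* n)) ⟩
      - ((suc m ℕ.* n) ⊗ 1#)            ≈⟨ -‿cong (×1-homo-* (suc m) n) ⟩
      - ((suc m ⊗ 1#) * (n ⊗ 1#))       ≈⟨ -‿distribˡ-* _ _ ⟩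
      - (suc m ⊗ 1#) * (n ⊗ 1#)         ∎
    fromℤ-* -[1+ m ] -[1+ n ] = begin
      (suc m ℕ.* suc n) ⊗ 1#               ≈⟨ ×1-homo-* (suc m) (suc n) ⟩
      (suc m ⊗ 1#) * (suc n ⊗ 1#)          ≈⟨ -‿involutive _ ⟨
      - (- ((suc m ⊗ 1#) * (suc n ⊗ 1#)))  ≈⟨ -‿cong (-‿distribˡ-* _ _) ⟩
      - (- (suc m ⊗ 1#) * (suc n ⊗ 1#))    ≈⟨ -‿distribʳ-* _ _ ⟩
      - (suc m ⊗ 1#) * - (suc n ⊗ 1#)      ∎

    morphism : ℤ.+-*-rawRing ACR.-Raw-AlmostCommutative⟶ ACR.fromCommutativeRing commutativeRing
    morphism = record
      { ⟦_⟧    = fromℤ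
      ; +-homo = fromℤ-+
      ; *-homo = fromℤ-*
      ; -‿homo = fromℤ-neg
      ; 0-homo = refl
      ; 1-homo = refl
      }

    equal? : ∀ i j → Maybe (fromℤ i ≈ fromℤ j)
    equal? i j with i ℤ.≟ j
    ... | yes i≡j = just (reflexive (≡.cong fromℤ i≡j))
    ... | no  _   = nothing

  open RingSolver ℤ.+-*-rawRing (ACR.fromCommutativeRing commutativeRing)
    IntegerCoefficients.morphism IntegerCoefficients.equal?
    using (Polynomial; solve; con; _:+_; _:*_; _:-_; :-_; _:=_)

  -- Ordered field arithmetic

  open IsTotalOrder (StrictToNonStrict.isTotalOrder _≈_ _<_ isStrictTotalOrder)
    using (≤-respˡ-≈; ≤-respʳ-≈)
    renaming (total to ≤-total; trans to ≤-trans; antisym to ≤-antisym)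

  opaque
    ≤-refl : ∀ {x} → x ≤ x
    ≤-refl = inj₂ refl

    <-≤-trans : ∀ {x y z} → x < y → y ≤ z → x < z
    <-≤-trans x<y (inj₁ y<z) = <-trans x<y y<z
    <-≤-trans x<y (inj₂ y≈z) = <-respʳ-≈ y≈z x<y

    ≤-<-trans : ∀ {x y z} → x ≤ y → y < z → x < z
    ≤-<-trans (inj₁ x<y) y<z = <-trans x<y y<z
    ≤-<-trans (inj₂ x≈y) y<z = <-respˡ-≈ (sym x≈y) y<z

    ≤⇒≯ : ∀ {x y} → x ≤ y → ¬ (y < x)
    ≤⇒≯ x≤y y<x = <-irrefl refl (≤-<-trans x≤y y<x)

    ≮⇒≥ : ∀ {x y} → ¬ (x < y) → y ≤ x
    ≮⇒≥ {x} {y} x≮y with compare x y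
    ... | tri< x<y _ _ = ⊥-elim (x≮y x<y)
    ... | tri≈ _ x≈y _ = inj₂ (sym x≈y)
    ... | tri> _ _ y<x = inj₁ y<x

    <⇒≉ : ∀ {x y} → x < y → ¬ (x ≈ y)
    <⇒≉ x<y x≈y = <-irrefl x≈y x<y

    >⇒≉ : ∀ {x y} → y < x → ¬ (x ≈ y)
    >⇒≉ y<x x≈y = <-irrefl (sym x≈y) y<x

    x<y⇒0<y-x : ∀ {x y} → x < y → 0# < y - x
    x<y⇒0<y-x {x} {y} x<y = <-respˡ-≈ (-‿inverseˡ x) (<-respʳ-≈ (+-comm _ _) (+-monoʳ-< (- x) x<y))

    x≤y⇒0≤y-x : ∀ {x y} → x ≤ y → 0# ≤ y - x
    x≤y⇒0≤y-x     (inj₁ x<y) = inj₁ (x<y⇒0<y-x x<y)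
    x≤y⇒0≤y-x {x} (inj₂ x≈y) = inj₂ (trans (sym (-‿inverseʳ x)) (+-congʳ x≈y))

    -- The pattern of most inequalities below: write the difference as an expression of known sign
    -- and leave a ring identity to the solver.
    <-by : ∀ {x y d} → 0# < d → y - x ≈ d → x < y
    <-by {x} {y} {d} 0<d y-x≈d =
      <-respˡ-≈ (+-identityʳ x) (<-respʳ-≈ (trans (+-congˡ (sym y-x≈d)) x+[y-x]≈y) (+-monoʳ-< x 0<d))
      where
      x+[y-x]≈y : x + (y - x) ≈ y
      x+[y-x]≈y = solve 2 (λ x y → x :+ (y :- x) := y) refl _ _

    ≈-by : ∀ {x y} → x - y ≈ 0# → x ≈ y
    ≈-by {x} {y} x-y≈0 = trans (solve 2 (λ x y → x := (x :- y) :+ y) refl x y) (trans (+-congʳ x-y≈0) (+-identityˡ y))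

    x≈y⇒x-y≈0 : ∀ {x y} → x ≈ y → x - y ≈ 0#
    x≈y⇒x-y≈0 {x} {y} x≈y = trans (+-congʳ x≈y) (-‿inverseʳ y)

    -- Reduces a goal modulo a known equation a = b, with cofactor k. Nested uses reduce modulo
    -- several equations, and the last argument is a pure ring identity.
    ≈-combine : ∀ {x y a b} k → a ≈ b → x - y ≈ k * (a - b) → x ≈ y
    ≈-combine k a≈b x-y≈k[a-b] = ≈-by (trans x-y≈k[a-b] (trans (*-congˡ (x≈y⇒x-y≈0 a≈b)) (zeroʳ k)))

    ≤-by : ∀ {x y d} → 0# ≤ d → y - x ≈ d → x ≤ y
    ≤-by (inj₁ 0<d) e = inj₁ (<-by 0<d e)
    ≤-by (inj₂ 0≈d) e = inj₂ (sym (≈-by (trans e (sym 0≈d))))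

    +-pos-nonneg : ∀ {x y} → 0# < x → 0# ≤ y → 0# < x + y
    +-pos-nonneg {x} {y} 0<x 0≤y = ≤-<-trans 0≤y (<-by 0<x (solve 2 (λ x y → (x :+ y) :- y := x) refl _ _))

    +-pos : ∀ {x y} → 0# < x → 0# < y → 0# < x + y
    +-pos 0<x 0<y = +-pos-nonneg 0<x (inj₁ 0<y)

    +-nonneg : ∀ {x y} → 0# ≤ x → 0# ≤ y → 0# ≤ x + y
    +-nonneg (inj₁ 0<x) 0≤y = inj₁ (+-pos-nonneg 0<x 0≤y)
    +-nonneg (inj₂ 0≈x) 0≤y = ≤-respʳ-≈ (trans (sym (+-identityˡ _)) (+-congʳ 0≈x)) 0≤y

    *-nonneg : ∀ {x y} → 0# ≤ x → 0# ≤ y → 0# ≤ x * y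
    *-nonneg (inj₁ 0<x) (inj₁ 0<y) = inj₁ (*-pos 0<x 0<y)
    *-nonneg (inj₁ 0<x) (inj₂ 0≈y) = inj₂ (trans (sym (zeroʳ _)) (*-congˡ 0≈y))
    *-nonneg (inj₂ 0≈x) _          = inj₂ (trans (sym (zeroˡ _)) (*-congʳ 0≈x))

    neg-pos : ∀ {x} → x < 0# → 0# < - x
    neg-pos x<0 = <-respʳ-≈ (+-identityˡ _) (x<y⇒0<y-x x<0)

    neg-nonneg : ∀ {x} → x ≤ 0# → 0# ≤ - x
    neg-nonneg x≤0 = ≤-respʳ-≈ (+-identityˡ _) (x≤y⇒0≤y-x x≤0)

    *-neg-pos : ∀ {x y} → x < 0# → 0# < y → x * y < 0#
    *-neg-pos x<0 0<y = <-by (*-pos (neg-pos x<0) 0<y) (solve 2 (λ x y → con (+ 0) :- x :* y := (:- x) :* y) refl _ _)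

    sq-pos : ∀ {x} → ¬ (x ≈ 0#) → 0# < x * x
    sq-pos {x} x≉0 with compare x 0#
    ... | tri< x<0 _ _ = <-respʳ-≈ (solve 1 (λ x → (:- x) :* (:- x) := x :* x) refl x) (*-pos (neg-pos x<0) (neg-pos x<0))
    ... | tri≈ _ x≈0 _ = ⊥-elim (x≉0 x≈0)
    ... | tri> _ _ 0<x = *-pos 0<x 0<x

    sq-nonneg : ∀ x → 0# ≤ x * x
    sq-nonneg x with compare x 0#
    ... | tri< _ x≉0 _ = inj₁ (sq-pos x≉0)
    ... | tri≈ _ x≈0 _ = inj₂ (sym (trans (*-congʳ x≈0) (zeroˡ x)))
    ... | tri> _ x≉0 _ = inj₁ (sq-pos x≉0)

    0<1 : 0# < 1#
    0<1 = <-respʳ-≈ (*-identityˡ 1#) (sq-pos (λ 1≈0 → 0≉1 (sym 1≈0)))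

    0<2 : 0# < 1# + 1#
    0<2 = +-pos 0<1 0<1

    *-cancel-pos : ∀ {x y} → 0# < x → 0# < x * y → 0# < y
    *-cancel-pos {x} {y} 0<x 0<xy with compare y 0#
    ... | tri< y<0 _ _ = ⊥-elim (≤⇒≯ (inj₁ 0<xy) (<-respˡ-≈ (*-comm y x) (*-neg-pos y<0 0<x)))
    ... | tri≈ _ y≈0 _ = ⊥-elim (>⇒≉ 0<xy (trans (*-congˡ y≈0) (zeroʳ x)))
    ... | tri> _ _ 0<y = 0<y

    *-cancel-≈0 : ∀ {x y} → ¬ (x ≈ 0#) → x * y ≈ 0# → y ≈ 0#
    *-cancel-≈0 {x} {y} x≉0 xy≈0 with inverse x x≉0
    ... | x⁻¹ , xx⁻¹≈1 = ≈-combine {y = 0#} (x⁻¹) xy≈0 (≈-combine (- y) xx⁻¹≈1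
          (solve 3 (λ x y z → (y :- con (+ 0)) :- z :* (x :* y :- con (+ 0)) := (:- y) :* (x :* z :- con (+ 1))) refl x y x⁻¹))

    *-≉0 : ∀ {x y} → ¬ (x ≈ 0#) → ¬ (y ≈ 0#) → ¬ (x * y ≈ 0#)
    *-≉0 x≉0 y≉0 xy≈0 = y≉0 (*-cancel-≈0 x≉0 xy≈0)

    *-cancelˡ-≈ : ∀ {x y z} → ¬ (x ≈ 0#) → x * y ≈ x * z → y ≈ z
    *-cancelˡ-≈ {x} {y} {z} x≉0 xy≈xz = ≈-by (*-cancel-≈0 x≉0
      (trans (solve 3 (λ x y z → x :* (y :- z) := x :* y :- x :* z) refl x y z) (x≈y⇒x-y≈0 xy≈xz)))

    pos-inverse : ∀ {x} → 0# < x → ∃[ y ] (0# < y × x * y ≈ 1#)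
    pos-inverse {x} 0<x with inverse x (>⇒≉ 0<x)
    ... | y , xy≈1 = y , *-cancel-pos 0<x (<-respʳ-≈ (sym xy≈1) 0<1) , xy≈1

    half : Carrier
    half = proj₁ (pos-inverse 0<2)

    0<half : 0# < half
    0<half = proj₁ (proj₂ (pos-inverse 0<2))

    2*half≈1 : (1# + 1#) * half ≈ 1#
    2*half≈1 = proj₂ (proj₂ (pos-inverse 0<2))

    sq-mono-< : ∀ {x y} → 0# ≤ x → x < y → x * x < y * y
    sq-mono-< {x} {y} 0≤x x<y = <-by (*-pos (x<y⇒0<y-x x<y) (+-pos-nonneg (≤-<-trans 0≤x x<y) 0≤x))
      (solve 2 (λ x y → y :* y :- x :* x := (y :- x) :* (y :+ x)) refl x y)

    sq-cancel-≤ : ∀ {x y} → 0# ≤ y → x * x ≤ y * y → x ≤ y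
    sq-cancel-≤ 0≤y xx≤yy = ≮⇒≥ (λ y<x → ≤⇒≯ xx≤yy (sq-mono-< 0≤y y<x))

    sq-cancel-< : ∀ {x y} → 0# ≤ y → x * x < y * y → x < y
    sq-cancel-< {x} {y} 0≤y xx<yy with sq-cancel-≤ 0≤y (inj₁ xx<yy)
    ... | inj₁ x<y = x<y
    ... | inj₂ x≈y = ⊥-elim (<⇒≉ xx<yy (*-cong x≈y x≈y))

    sq-cancel-≈ : ∀ {x y} → 0# ≤ x → 0# ≤ y → x * x ≈ y * y → x ≈ y
    sq-cancel-≈ 0≤x 0≤y xx≈yy = ≤-antisym (sq-cancel-≤ 0≤y (inj₂ xx≈yy)) (sq-cancel-≤ 0≤x (inj₂ (sym xx≈yy)))

    ≉0⇒pos⊎neg : ∀ {x} → ¬ (x ≈ 0#) → 0# < x ⊎ x < 0#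
    ≉0⇒pos⊎neg {x} x≉0 with compare x 0#
    ... | tri< x<0 _ _ = inj₂ x<0
    ... | tri≈ _ x≈0 _ = ⊥-elim (x≉0 x≈0)
    ... | tri> _ _ 0<x = inj₁ 0<x

    sq+sq-pos : ∀ {x y} → ¬ (x ≈ 0# × y ≈ 0#) → 0# < x * x + y * y
    sq+sq-pos {x} {y} xy≉0 with compare x 0#
    ... | tri< _ x≉0 _ = +-pos-nonneg (sq-pos x≉0) (sq-nonneg y)
    ... | tri> _ x≉0 _ = +-pos-nonneg (sq-pos x≉0) (sq-nonneg y)
    ... | tri≈ _ x≈0 _ = <-respʳ-≈ (+-comm _ _) (+-pos-nonneg (sq-pos (λ y≈0 → xy≉0 (x≈0 , y≈0))) (sq-nonneg x))

    +-mono-≤ : ∀ {w x y z} → w ≤ x → y ≤ z → w + y ≤ x + z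
    +-mono-≤ w≤x y≤z = ≤-by (+-nonneg (x≤y⇒0≤y-x w≤x) (x≤y⇒0≤y-x y≤z))
      (solve 4 (λ w x y z → (x :+ z) :- (w :+ y) := (x :- w) :+ (z :- y)) refl _ _ _ _)

    *-mono-≤-nonneg : ∀ {w x y z} → 0# ≤ w → w ≤ x → 0# ≤ y → y ≤ z → w * y ≤ x * z
    *-mono-≤-nonneg 0≤w w≤x 0≤y y≤z = ≤-by
      (+-nonneg (*-nonneg (x≤y⇒0≤y-x w≤x) (≤-trans 0≤y y≤z)) (*-nonneg 0≤w (x≤y⇒0≤y-x y≤z)))
      (solve 4 (λ w x y z → x :* z :- w :* y := (x :- w) :* z :+ w :* (z :- y)) refl _ _ _ _)

  -- Roots of unity by completeness

  -- Local Lipschitz continuity, with absolute values avoided by squaring.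
  LipschitzAt : (Carrier → Carrier) → Carrier → Set
  LipschitzAt f c = ∃[ L ] (0# ≤ L × ∀ x → (x - c) * (x - c) ≤ 1# →
                      (f x - f c) * (f x - f c) ≤ L * ((x - c) * (x - c)))

  lipschitz-const : ∀ a c → LipschitzAt (λ _ → a) c
  lipschitz-const a c = 0# , ≤-refl , λ x _ → inj₂
    (solve 2 (λ a h → (a :- a) :* (a :- a) := con (+ 0) :* h) refl a _)

  lipschitz-id : ∀ c → LipschitzAt (λ x → x) c
  lipschitz-id c = 1# , inj₁ 0<1 , λ x _ → inj₂ (sym (*-identityˡ _))

  -- Rests on (u + v)² ≤ 2u² + 2v², whose defect is (u - v)²; hence the constant 2 (L + M).
  lipschitz-+ : ∀ {f g} c → LipschitzAt f c → LipschitzAt g c → LipschitzAt (λ x → f x + g x) c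
  lipschitz-+ {f} {g} c (L , 0≤L , f-lip) (M , 0≤M , g-lip) =
    (1# + 1#) * (L + M) , *-nonneg (inj₁ 0<2) (+-nonneg 0≤L 0≤M) , λ x h≤1 →
    ≤-trans (≤-by (sq-nonneg ((f x - f c) - (g x - g c)))
              (solve 4 (λ a b c d →
                con (+ 2) :* ((a :- b) :* (a :- b) :+ (c :- d) :* (c :- d)) :- ((a :+ c) :- (b :+ d)) :* ((a :+ c) :- (b :+ d)) :=
                ((a :- b) :- (c :- d)) :* ((a :- b) :- (c :- d)))
                refl (f x) (f c) (g x) (g c)))
      (≤-respʳ-≈ (solve 3 (λ L M h → con (+ 2) :* (L :* h :+ M :* h) := con (+ 2) :* (L :+ M) :* h) refl L M _)
        (*-mono-≤-nonneg (inj₁ 0<2) ≤-refl (+-nonneg (sq-nonneg _) (sq-nonneg _)) (+-mono-≤ (f-lip x h≤1) (g-lip x h≤1))))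

  lipschitz-neg : ∀ {f} c → LipschitzAt f c → LipschitzAt (λ x → - f x) c
  lipschitz-neg {f} c (L , 0≤L , f-lip) = L , 0≤L , λ x h → ≤-respˡ-≈
    (solve 2 (λ a b → (a :- b) :* (a :- b) := (:- a :- :- b) :* (:- a :- :- b)) refl (f x) (f c)) (f-lip x h)

  -- The increment of the product is u g(c) + u v + f(c) v for the increments u, v of the factors,
  -- and (x + y + z)² ≤ 3 (x² + y² + z²). The restriction to (x - c)² ≤ 1 tames the quadratic term u
  -- v.
  lipschitz-* : ∀ {f g} c → LipschitzAt f c → LipschitzAt g c → LipschitzAt (λ x → f x * g x) c
  lipschitz-* {f} {g} c (L , 0≤L , f-lip) (M , 0≤M , g-lip) =
    three * (L * G + L * M + F * M) ,
    *-nonneg 0≤3 (+-nonneg (+-nonneg (*-nonneg 0≤L (sq-nonneg _)) (*-nonneg 0≤L 0≤M)) (*-nonneg (sq-nonneg _) 0≤M)) ,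
    bound
    where
    three = 1# + 1# + 1#
    0≤3 = inj₁ (+-pos 0<2 0<1)
    F = f c * f c
    G = g c * g c
    three-squares : ∀ a b c → (a + b + c) * (a + b + c) ≤ three * (a * a + b * b + c * c)
    three-squares a b c = ≤-by (+-nonneg (+-nonneg (sq-nonneg (a - b)) (sq-nonneg (b - c))) (sq-nonneg (a - c)))
      (solve 3 (λ a b c → con (+ 3) :* (a :* a :+ b :* b :+ c :* c) :- (a :+ b :+ c) :* (a :+ b :+ c) :=
                           (a :- b) :* (a :- b) :+ (b :- c) :* (b :- c) :+ (a :- c) :* (a :- c)) refl a b c)
    sq-* : ∀ a b → (a * a) * (b * b) ≈ (a * b) * (a * b)
    sq-* = solve 2 (λ a b → (a :* a) :* (b :* b) := (a :* b) :* (a :* b)) refl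
    bound : ∀ x → (x - c) * (x - c) ≤ 1# → _
    bound x h≤1 =
      ≤-respˡ-≈ (*-cong increment increment) (≤-trans (three-squares _ _ _)
      (≤-respʳ-≈ regroup (*-mono-≤-nonneg 0≤3 ≤-refl
        (+-nonneg (+-nonneg (sq-nonneg _) (sq-nonneg _)) (sq-nonneg _)) (+-mono-≤ (+-mono-≤ A B) C))))
      where
      h = (x - c) * (x - c)
      u = f x - f c
      v = g x - g c
      increment : u * g c + u * v + f c * v ≈ f x * g x - f c * g c
      increment = solve 4 (λ a b c d → (a :- b) :* d :+ (a :- b) :* (c :- d) :+ b :* (c :- d) := a :* c :- b :* d)
                    refl (f x) (f c) (g x) (g c)
      A : (u * g c) * (u * g c) ≤ (L * h) * G
      A = ≤-respˡ-≈ (sq-* u (g c)) (*-mono-≤-nonneg (sq-nonneg _) (f-lip x h≤1) (sq-nonneg _) ≤-refl)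
      B : (u * v) * (u * v) ≤ (L * h) * M
      B = ≤-respˡ-≈ (sq-* u v) (*-mono-≤-nonneg (sq-nonneg _) (f-lip x h≤1) (sq-nonneg _)
            (≤-trans (g-lip x h≤1) (≤-respʳ-≈ (*-identityʳ M) (*-mono-≤-nonneg 0≤M ≤-refl (sq-nonneg _) h≤1))))
      C : (f c * v) * (f c * v) ≤ F * (M * h)
      C = ≤-respˡ-≈ (sq-* (f c) v) (*-mono-≤-nonneg (sq-nonneg _) ≤-refl (sq-nonneg _) (g-lip x h≤1))
      regroup : three * ((L * h) * G + (L * h) * M + F * (M * h)) ≈ three * (L * G + L * M + F * M) * h
      regroup = trans (*-congˡ (solve 5 (λ L M h F G → (L :* h) :* G :+ (L :* h) :* M :+ F :* (M :* h) :=
                                                        (L :* G :+ L :* M :+ F :* M) :* h) refl L M h F G))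
                      (sym (*-assoc _ _ _))

  Near : (Carrier → Set) → Carrier → Set
  Near Q c = ∃[ ε ] (0# < ε × ∀ x → c - ε < x → x < c + ε → Q x)

  small-step : ∀ {L w} → 0# ≤ L → 0# < w → ∃[ ε ] (0# < ε × ε ≤ 1# × L * ε < w)
  small-step {L} {w} 0≤L 0<w with pos-inverse (+-pos-nonneg (+-pos-nonneg 0<w 0≤L) (inj₁ 0<1))
  ... | k , 0<k , [w+L+1]k≈1 =
    -- The witness is ε = w / (w + L + 1).
    w * k , *-pos 0<w 0<k ,
    inj₁ (<-by (*-pos (+-pos-nonneg 0<1 0≤L) 0<k) (≈-combine (- 1#) [w+L+1]k≈1
      (solve 3 (λ w L k → (con (+ 1) :- w :* k) :- (con (+ 1) :+ L) :* k :=
                           con (ℤ.- (+ 1)) :* ((w :+ L :+ con (+ 1)) :* k :- con (+ 1))) refl w L k))) ,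
    <-by (*-pos (*-pos 0<w 0<k) (+-pos 0<w 0<1)) (≈-combine (- w) [w+L+1]k≈1
      (solve 3 (λ w L k → (w :- L :* (w :* k)) :- w :* k :* (w :+ con (+ 1)) :=
                           (:- w) :* ((w :+ L :+ con (+ 1)) :* k :- con (+ 1))) refl w L k))

  -- If f(x) ≤ 0 < f(c), then (f(x) - f(c))² is at least f(c)², whereas near c it is at most L ε² ≤
  -- L ε < f(c)². The bound ε ≤ 1 gives ε² ≤ ε and keeps x where the Lipschitz estimate applies.
  lipschitz-pos-near : ∀ {f} c → LipschitzAt f c → 0# < f c → Near (λ x → 0# < f x) c
  lipschitz-pos-near {f} c (L , 0≤L , f-lip) 0<fc = near (small-step 0≤L (*-pos 0<fc 0<fc))
    where
    close : ∀ {ε} → 0# < ε × ε ≤ 1# × L * ε < f c * f c → ∀ x → c - ε < x → x < c + ε → 0# < f x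
    close {ε} (0<ε , ε≤1 , Lε<w) x c-ε<x x<c+ε with em {0# < f x}
    ... | yes 0<fx = 0<fx
    ... | no  0≮fx = ⊥-elim (≤⇒≯ far (≤-<-trans (f-lip x (≤-trans h≤ε ε≤1)) (≤-<-trans (*-mono-≤-nonneg 0≤L ≤-refl (sq-nonneg _) h≤ε) Lε<w)))
      where
      0≤-fx = neg-nonneg (≮⇒≥ 0≮fx)
      far : f c * f c ≤ (f x - f c) * (f x - f c)
      far = ≤-by (*-nonneg 0≤-fx (+-nonneg (+-nonneg (inj₁ 0<fc) (inj₁ 0<fc)) 0≤-fx))
        (solve 2 (λ y z → (y :- z) :* (y :- z) :- z :* z := (:- y) :* (z :+ z :+ :- y)) refl (f x) (f c))
      h≤ε : (x - c) * (x - c) ≤ ε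
      h≤ε = ≤-trans
        (≤-by (*-nonneg (x≤y⇒0≤y-x (inj₁ c-ε<x)) (x≤y⇒0≤y-x (inj₁ x<c+ε)))
          (solve 3 (λ x c e → e :* e :- (x :- c) :* (x :- c) := (x :- (c :- e)) :* (c :+ e :- x)) refl x c ε))
        (≤-respʳ-≈ (*-identityˡ ε) (*-mono-≤-nonneg (inj₁ 0<ε) ε≤1 (inj₁ 0<ε) ≤-refl))
    near : ∃[ ε ] (0# < ε × ε ≤ 1# × L * ε < f c * f c) → Near (λ x → 0# < f x) c
    near (ε , bounds@(0<ε , _)) = ε , 0<ε , close bounds

  -- Takes the place of the intermediate value theorem: s is the supremum of the points up to b
  -- where Q fails. If Q held at s, openness would give a smaller upper bound; openness at b keeps s
  -- away from b.
  last-exit : (Q : Carrier → Set) → (∀ c → Q c → Near Q c) → ∀ {a b} → a ≤ b → ¬ Q a → Q b →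
              ∃[ s ] (a ≤ s × s < b × ¬ Q s × ∀ x → s < x → x ≤ b → Q x)
  last-exit Q open-Q {a} {b} a≤b ¬Qa Qb = s , proj₁ s-sup a (a≤b , ¬Qa) , s<b , ¬Qs , after
    where
    S : Carrier → Set
    S x = x ≤ b × ¬ Q x
    b-bound : IsUpperBound S b
    b-bound x (x≤b , _) = x≤b
    sup = complete S (a , a≤b , ¬Qa) (b , b-bound)
    s = proj₁ sup
    s-sup = proj₂ sup
    x-ε<x : ∀ {x ε} → 0# < ε → x - ε < x
    x-ε<x 0<ε = <-by 0<ε (solve 2 (λ x e → x :- (x :- e) := e) refl _ _)
    x<x+ε : ∀ {x ε} → 0# < ε → x < x + ε
    x<x+ε 0<ε = <-by 0<ε (solve 2 (λ x e → (x :+ e) :- x := e) refl _ _)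
    ¬Qs : ¬ Q s
    ¬Qs Qs with open-Q s Qs
    ... | ε , 0<ε , near = ≤⇒≯ (proj₂ s-sup (s - ε) bound) (x-ε<x 0<ε)
      where
      bound : IsUpperBound S (s - ε)
      bound x Sx@(_ , ¬Qx) = ≮⇒≥ λ s-ε<x → ¬Qx (near x s-ε<x (≤-<-trans (proj₁ s-sup x Sx) (x<x+ε 0<ε)))
    s<b : s < b
    s<b with proj₂ s-sup b b-bound
    ... | inj₁ s<b = s<b
    ... | inj₂ s≈b with open-Q b Qb
    ...   | ε , 0<ε , near = ⊥-elim (¬Qs (near s (<-respʳ-≈ (sym s≈b) (x-ε<x 0<ε)) (<-respˡ-≈ (sym s≈b) (x<x+ε 0<ε))))
    after : ∀ x → s < x → x ≤ b → Q x
    after x s<x x≤b with em {Q x}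
    ... | yes Qx = Qx
    ... | no ¬Qx = ⊥-elim (≤⇒≯ (proj₁ s-sup x (x≤b , ¬Qx)) s<x)

  right-limit-nonneg : ∀ {f s b} → LipschitzAt f s → s < b → (∀ x → s < x → x ≤ b → 0# ≤ f x) → 0# ≤ f s
  right-limit-nonneg {f} {s} {b} f-lip s<b f-nonneg = ≮⇒≥ λ fs<0 → contra (lipschitz-pos-near s (lipschitz-neg s f-lip) (neg-pos fs<0))
    where
    contra : Near (λ x → 0# < - f x) s → ⊥
    -- The smaller of b and s + ε / 2 lies both in (s, b] and in the neighbourhood where f is
    -- negative.
    contra (ε , 0<ε , near) = [ (λ b≤m → absurd b s<b ≤-refl (≤-<-trans b≤m m<s+ε)) ,
                                (λ m≤b → absurd m s<m m≤b m<s+ε) ]′ (≤-total b m)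
      where
      m = s + half * ε
      s<m : s < m
      s<m = <-by (*-pos 0<half 0<ε) (solve 2 (λ s d → s :+ d :- s := d) refl _ _)
      m<s+ε : m < s + ε
      m<s+ε = <-by (*-pos 0<half 0<ε) (≈-combine (- ε) 2*half≈1
        (solve 3 (λ s h e → (s :+ e) :- (s :+ h :* e) :- h :* e := (:- e) :* (con (+ 2) :* h :- con (+ 1))) refl s half ε))
      absurd : ∀ x → s < x → x ≤ b → x < s + ε → ⊥
      absurd x s<x x≤b x<s+ε = ≤⇒≯ (f-nonneg x s<x x≤b)
        (<-by (near x (<-trans (<-by 0<ε (solve 2 (λ x e → x :- (x :- e) := e) refl _ _)) s<x) x<s+ε) (+-identityˡ _))

  opaque
    -- The root is the last point of [0, 1 + a] at which x² > a fails; the right end satisfies it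
    -- because (1 + a)² - a = 1 + a + a².
    sqrt : ∀ {a} → 0# ≤ a → ∃[ r ] (0# ≤ r × r * r ≈ a)
    sqrt {a} 0≤a = root (last-exit Q (λ c → lipschitz-pos-near c (f-lip c)) 0≤1+a ¬Q0 Q[1+a])
      where
      Q : Carrier → Set
      Q x = 0# < x * x - a
      f-lip : ∀ c → LipschitzAt (λ x → x * x - a) c
      f-lip c = lipschitz-+ c (lipschitz-* c (lipschitz-id c) (lipschitz-id c)) (lipschitz-const (- a) c)
      0≤1+a : 0# ≤ 1# + a
      0≤1+a = inj₁ (+-pos-nonneg 0<1 0≤a)
      ¬Q0 : ¬ Q 0#
      ¬Q0 0<0-a = ≤⇒≯ 0≤a (<-by 0<0-a (solve 1 (λ a → con (+ 0) :- a := con (+ 0) :* con (+ 0) :- a) refl a))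
      Q[1+a] : Q (1# + a)
      Q[1+a] = <-respʳ-≈ (solve 1 (λ a → con (+ 1) :+ (a :+ a :* a) := (con (+ 1) :+ a) :* (con (+ 1) :+ a) :- a) refl a)
                 (+-pos-nonneg 0<1 (+-nonneg 0≤a (sq-nonneg a)))
      root : ∃[ s ] (0# ≤ s × s < 1# + a × ¬ Q s × ∀ x → s < x → x ≤ 1# + a → Q x) → ∃[ r ] (0# ≤ r × r * r ≈ a)
      root (s , 0≤s , s<1+a , ¬Qs , after) = s , 0≤s , ≤-antisym
        (≮⇒≥ λ a<ss → ¬Qs (x<y⇒0<y-x a<ss))
        (≤-by (right-limit-nonneg (f-lip s) s<1+a (λ x s<x x≤b → inj₁ (after x s<x x≤b))) refl)

  -- Powers of a complex number and Chebyshev polynomials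

  module Powers (c s : Carrier) where
    mutual
      Re Im : ℕ → Carrier
      Re zero    = 1#
      Re (suc i) = c * Re i - s * Im i
      Im zero    = 0#
      Im (suc i) = s * Re i + c * Im i

    Re-+ : ∀ i j → Re (i ℕ.+ j) ≈ Re i * Re j - Im i * Im j
    Im-+ : ∀ i j → Im (i ℕ.+ j) ≈ Im i * Re j + Re i * Im j
    Re-+ zero    j = solve 2 (λ x y → x := con (+ 1) :* x :- con (+ 0) :* y) refl (Re j) (Im j)
    Re-+ (suc i) j = trans (+-cong (*-congˡ (Re-+ i j)) (-‿cong (*-congˡ (Im-+ i j))))
      (solve 6 (λ c s x y z w → c :* (x :* z :- y :* w) :- s :* (y :* z :+ x :* w) :=
                                (c :* x :- s :* y) :* z :- (s :* x :+ c :* y) :* w) refl c s (Re i) (Im i) (Re j) (Im j))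
    Im-+ zero    j = solve 2 (λ x y → y := con (+ 0) :* x :+ con (+ 1) :* y) refl (Re j) (Im j)
    Im-+ (suc i) j = trans (+-cong (*-congˡ (Re-+ i j)) (*-congˡ (Im-+ i j)))
      (solve 6 (λ c s x y z w → s :* (x :* z :- y :* w) :+ c :* (y :* z :+ x :* w) :=
                                (s :* x :+ c :* y) :* z :+ (c :* x :- s :* y) :* w) refl c s (Re i) (Im i) (Re j) (Im j))

    Re-1 : Re 1 ≈ c
    Re-1 = solve 2 (λ c s → c :* con (+ 1) :- s :* con (+ 0) := c) refl c s

    Im-1 : Im 1 ≈ s
    Im-1 = solve 2 (λ c s → s :* con (+ 1) :+ c :* con (+ 0) := s) refl c s

    module Unit (unit : c * c + s * s ≈ 1#) where
      norm : ∀ i → Re i * Re i + Im i * Im i ≈ 1#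
      norm zero    = solve 0 (con (+ 1) :* con (+ 1) :+ con (+ 0) :* con (+ 0) := con (+ 1)) refl
      norm (suc i) = trans
        (solve 4 (λ c s x y → (c :* x :- s :* y) :* (c :* x :- s :* y) :+ (s :* x :+ c :* y) :* (s :* x :+ c :* y) :=
                              (c :* c :+ s :* s) :* (x :* x :+ y :* y)) refl c s (Re i) (Im i))
        (trans (*-cong unit (norm i)) (*-identityˡ 1#))

  -- T n and V n are the Chebyshev polynomials with T n (cos φ) = cos nφ and sin φ · V n (cos φ) = sin nφ.
  T V : ℕ → Carrier → Carrier
  T zero    x = 1#
  T (suc n) x = x * T n x - (1# - x * x) * V n x
  V zero    x = 0#
  V (suc n) x = T n x + x * V n x

  T-lipschitz : ∀ n c → LipschitzAt (T n) c
  V-lipschitz : ∀ n c → LipschitzAt (V n) c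
  T-lipschitz zero    c = lipschitz-const 1# c
  T-lipschitz (suc n) c = lipschitz-+ c (lipschitz-* c (lipschitz-id c) (T-lipschitz n c))
    (lipschitz-neg c (lipschitz-* c
      (lipschitz-+ c (lipschitz-const 1# c) (lipschitz-neg c (lipschitz-* c (lipschitz-id c) (lipschitz-id c))))
      (V-lipschitz n c)))
  V-lipschitz zero    c = lipschitz-const 0# c
  V-lipschitz (suc n) c = lipschitz-+ c (T-lipschitz n c) (lipschitz-* c (lipschitz-id c) (V-lipschitz n c))

  T-at-1 : ∀ n → T n 1# ≈ 1#
  T-at-1 zero    = refl
  T-at-1 (suc n) = trans (solve 2 (λ t v → con (+ 1) :* t :- (con (+ 1) :- con (+ 1) :* con (+ 1)) :* v := t) refl (T n 1#) (V n 1#)) (T-at-1 n)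

  V-at-1-nonneg : ∀ n → 0# ≤ V n 1#
  V-at-1-pos : ∀ n → 0# < V (suc n) 1#
  V-at-1-nonneg zero    = ≤-refl
  V-at-1-nonneg (suc n) = inj₁ (V-at-1-pos n)
  V-at-1-pos n = +-pos-nonneg (<-respʳ-≈ (sym (T-at-1 n)) 0<1) (*-nonneg (inj₁ 0<1) (V-at-1-nonneg n))

  -- This is sin (n + 2)φ + sin nφ = 2 cos φ · sin (n + 1)φ divided by sin φ.
  V-recurrence : ∀ n x → V (2 ℕ.+ n) x + V n x ≈ (x + x) * V (suc n) x
  V-recurrence n x = solve 3 (λ x t v →
    ((x :* t :- (con (+ 1) :- x :* x) :* v) :+ x :* (t :+ x :* v)) :+ v := (x :+ x) :* (t :+ x :* v)) refl x (T n x) (V n x)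

  -- All of `V 1`, ..., `V m` jointly: the left boundary of this region below 1 yields not only a
  -- zero of the last polynomial but also the signs of the earlier ones.
  V-positive : ℕ → Carrier → Set
  V-positive m x = ∀ j → j ℕ.< m → 0# < V (suc j) x

  V-positive-open : ∀ m x → V-positive m x → Near (V-positive m) x
  V-positive-open zero    x _   = 1# , 0<1 , λ _ _ _ _ ()
  V-positive-open (suc m) x pos = combine (V-positive-open m x λ j j<m → pos j (ℕ.m<n⇒m<1+n j<m))
    (lipschitz-pos-near x (V-lipschitz (suc m) x) (pos m ℕ.≤-refl))
    where
    at : ∀ {y} → V-positive m y → 0# < V (suc m) y → V-positive (suc m) y
    at below top j j<1+m with ℕ.m<1+n⇒m<n∨m≡n j<1+m
    ... | inj₁ j<m    = below j j<m
    ... | inj₂ ≡.refl = top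
    shrink : ∀ {y δ ε} → δ ≤ ε → x - δ < y → y < x + δ → x - ε < y × y < x + ε
    shrink {y} {δ} {ε} δ≤ε lo hi =
      ≤-<-trans (≤-by (x≤y⇒0≤y-x δ≤ε) (solve 3 (λ x d e → x :- d :- (x :- e) := e :- d) refl x δ ε)) lo ,
      <-≤-trans hi (+-mono-≤ ≤-refl δ≤ε)
    combine : Near (V-positive m) x → Near (λ y → 0# < V (suc m) y) x → Near (V-positive (suc m)) x
    combine (δ , 0<δ , below) (ε , 0<ε , top) with ≤-total δ ε
    ... | inj₁ δ≤ε = δ , 0<δ , λ y lo hi → at (below y lo hi) (let lo′ , hi′ = shrink δ≤ε lo hi in top y lo′ hi′)
    ... | inj₂ ε≤δ = ε , 0<ε , λ y lo hi → at (let lo′ , hi′ = shrink ε≤δ lo hi in below y lo′ hi′) (top y lo hi)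

  -- The zero found is cos (π / m).
  V-largest-zero : ∀ m → 2 ℕ.≤ m →
    ∃[ x ] (0# ≤ x × x < 1# × V m x ≈ 0# × (∀ j → suc j ℕ.< m → 0# < V (suc j) x))
  V-largest-zero (suc (suc m)) (ℕ.s≤s (ℕ.s≤s _)) =
    -- The search runs over [0, 1]. At 0 the polynomial `V 2`, present because m ≥ 2, vanishes; at 1
    -- all are positive.
    extract (last-exit (V-positive (2 ℕ.+ m)) (V-positive-open (2 ℕ.+ m)) (inj₁ 0<1)
              (λ pos → >⇒≉ (pos 1 (ℕ.s≤s (ℕ.s≤s ℕ.z≤n))) V₂0≈0) (λ j _ → V-at-1-pos j))
    where
    V₂0≈0 : V 2 0# ≈ 0#
    V₂0≈0 = solve 0 (let x = con (+ 0); t₀ = con (+ 1); v₀ = con (+ 0) in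
      (x :* t₀ :- (con (+ 1) :- x :* x) :* v₀) :+ x :* (t₀ :+ x :* v₀) := con (+ 0)) refl
    extract : ∃[ x ] (0# ≤ x × x < 1# × ¬ V-positive (2 ℕ.+ m) x × ∀ y → x < y → y ≤ 1# → V-positive (2 ℕ.+ m) y) → _
    extract (x , 0≤x , x<1 , ¬pos , after) = x , 0≤x , x<1 , top≈0 (nonneg (suc m) ℕ.≤-refl) , λ j j<m → positive j (ℕ.s<s⁻¹ j<m)
      where
      nonneg : ∀ j → j ℕ.< 2 ℕ.+ m → 0# ≤ V (suc j) x
      nonneg j j<m = right-limit-nonneg (V-lipschitz (suc j) x) x<1 (λ y x<y y≤1 → inj₁ (after y x<y y≤1 j j<m))
      -- If V (1 + j) x vanished, the recurrence would make the neighbours V j x and V (2 + j) x opposite.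
      positive : ∀ j → j ℕ.< suc m → 0# < V (suc j) x
      positive zero    _     = <-respʳ-≈ (solve 1 (λ x → con (+ 1) := con (+ 1) :+ x :* con (+ 0)) refl x) 0<1
      positive (suc j) 1+j<1+m = pos (nonneg (suc j) (ℕ.m<n⇒m<1+n 1+j<1+m))
        where
        pos : 0# ≤ V (2 ℕ.+ j) x → 0# < V (2 ℕ.+ j) x
        pos (inj₁ 0<v) = 0<v
        pos (inj₂ 0≈v) = ⊥-elim (<⇒≉ (<-respʳ-≈ (+-comm _ _) (+-pos-nonneg (positive j (ℕ.<-trans ℕ.≤-refl 1+j<1+m))
                            (nonneg (2 ℕ.+ j) (ℕ.s≤s 1+j<1+m))))
                           (sym (trans (V-recurrence (suc j) x) (trans (*-congˡ (sym 0≈v)) (zeroʳ _)))))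
      top≈0 : 0# ≤ V (2 ℕ.+ m) x → V (2 ℕ.+ m) x ≈ 0#
      top≈0 (inj₂ 0≈v) = sym 0≈v
      top≈0 (inj₁ 0<v) = ⊥-elim (¬pos all-positive)
        where
        all-positive : V-positive (2 ℕ.+ m) x
        all-positive j j<2+m with ℕ.m<1+n⇒m<n∨m≡n j<2+m
        ... | inj₁ j<1+m  = positive j j<1+m
        ... | inj₂ ≡.refl = 0<v

  -- These properties single out c + i s = exp (i π / m).
  record IsHalfTurnRoot (m : ℕ) (c s : Carrier) : Set where
    open Powers c s
    field
      unit   : c * c + s * s ≈ 1#
      Im-m≈0 : Im m ≈ 0#
      Im-pos : ∀ j → suc j ℕ.< m → 0# < Im (suc j)

  opaque
    half-turn-root : ∀ m → 2 ℕ.≤ m → ∃[ c ] ∃[ s ] IsHalfTurnRoot m c s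
    half-turn-root m 2≤m = root (V-largest-zero m 2≤m)
      where
      root : ∃[ c ] (0# ≤ c × c < 1# × V m c ≈ 0# × (∀ j → suc j ℕ.< m → 0# < V (suc j) c)) →
             ∃[ c ] ∃[ s ] IsHalfTurnRoot m c s
      root (c , 0≤c , c<1 , Vm≈0 , V>0) = sine (sqrt (inj₁ 0<1-cc))
        where
        0<1-cc : 0# < 1# - c * c
        0<1-cc = <-respʳ-≈ (+-congʳ (*-identityˡ 1#)) (x<y⇒0<y-x (sq-mono-< 0≤c c<1))
        sine : ∃[ s ] (0# ≤ s × s * s ≈ 1# - c * c) → ∃[ c ] ∃[ s ] IsHalfTurnRoot m c s
        sine (s , 0≤s , ss≈1-cc) = c , s , record
          { unit   = trans (+-congˡ ss≈1-cc) (solve 1 (λ c → c :* c :+ (con (+ 1) :- c :* c) := con (+ 1)) refl c)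
          ; Im-m≈0 = trans (Im≈sV m) (trans (*-congˡ Vm≈0) (zeroʳ s))
          ; Im-pos = λ j j<m → <-respʳ-≈ (sym (Im≈sV (suc j))) (*-pos 0<s (V>0 j j<m))
          }
          where
          open Powers c s
          0<s : 0# < s
          0<s = sq-cancel-< 0≤s (<-respˡ-≈ (sym (zeroˡ 0#)) (<-respʳ-≈ (sym ss≈1-cc) 0<1-cc))
          Re≈T : ∀ n → Re n ≈ T n c
          Im≈sV : ∀ n → Im n ≈ s * V n c
          Re≈T zero    = refl
          Re≈T (suc n) = trans (+-cong (*-congˡ (Re≈T n)) (-‿cong (*-congˡ (Im≈sV n))))
            (≈-combine (- V n c) ss≈1-cc (solve 4 (λ c s t v → (c :* t :- s :* (s :* v)) :- (c :* t :- (con (+ 1) :- c :* c) :* v) :=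
              (:- v) :* (s :* s :- (con (+ 1) :- c :* c))) refl c s (T n c) (V n c)))
          Im≈sV zero    = sym (zeroʳ s)
          Im≈sV (suc n) = trans (+-cong (*-congˡ (Re≈T n)) (*-congˡ (Im≈sV n)))
            (solve 4 (λ c s t v → s :* t :+ c :* (s :* v) := s :* (t :+ c :* v)) refl c s (T n c) (V n c))

  -- The arc cosine

  opaque
    upper-y-mono : ∀ {a b} → OnUpperSemicircle a → OnUpperSemicircle b → proj₁ b * proj₁ b ≤ proj₁ a * proj₁ a → proj₂ a ≤ proj₂ b
    upper-y-mono {a , y} {b , z} (aa+yy≈1 , _) (bb+zz≈1 , 0≤z) bb≤aa =
      sq-cancel-≤ 0≤z (≤-by (x≤y⇒0≤y-x bb≤aa) (≈-combine 1# (trans bb+zz≈1 (sym aa+yy≈1))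
        (solve 4 (λ a y b z → (z :* z :- y :* y) :- (a :* a :- b :* b) :=
                               con (+ 1) :* ((b :* b :+ z :* z) :- (a :* a :+ y :* y))) refl a y b z)))

    upper-y-unique : ∀ {x x′ y y′} → x ≈ x′ → OnUpperSemicircle (x , y) → OnUpperSemicircle (x′ , y′) → y ≈ y′
    upper-y-unique x≈x′ on on′ = ≤-antisym (upper-y-mono on on′ (inj₂ (sym (*-cong x≈x′ x≈x′)))) (upper-y-mono on′ on (inj₂ (*-cong x≈x′ x≈x′)))

    upper-y≤1 : ∀ {a} → OnUpperSemicircle a → proj₂ a ≤ 1#
    upper-y≤1 {x , y} (xx+yy≈1 , _) = sq-cancel-≤ (inj₁ 0<1) (≤-by (sq-nonneg x) (≈-combine (- 1#) xx+yy≈1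
      (solve 2 (λ x y → (con (+ 1) :* con (+ 1) :- y :* y) :- x :* x := con (ℤ.- (+ 1)) :* (x :* x :+ y :* y :- con (+ 1))) refl x y)))

    upper-resp-≐ : ∀ {a b} → a ≐ b → OnUpperSemicircle a → OnUpperSemicircle b
    upper-resp-≐ (x≈ , y≈) (on , 0≤y) = trans (+-cong (*-cong (sym x≈) (sym x≈)) (*-cong (sym y≈) (sym y≈))) on , ≤-respʳ-≈ y≈ 0≤y

    chord-resp-≐ : ∀ {a b b′ d} → b ≐ b′ → IsChord a b d → IsChord a b′ d
    chord-resp-≐ b≐b′@(x≈ , y≈) (on-a , on-b , b≤a , 0≤d , dd≈) =
      on-a , upper-resp-≐ b≐b′ on-b , ≤-respˡ-≈ x≈ b≤a , 0≤d ,
      trans dd≈ (+-cong (*-cong (+-congʳ x≈) (+-congʳ x≈)) (*-cong (+-congʳ y≈) (+-congʳ y≈)))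

    path-resp-≐ : ∀ {a b b′ l} → b ≐ b′ → InscribedPath a b l → InscribedPath a b′ l
    path-resp-≐ b≐b′ [ chord ]      = [ chord-resp-≐ b≐b′ chord ]
    path-resp-≐ b≐b′ (chord ∷ path) = chord ∷ path-resp-≐ b≐b′ path

    path-end : ∀ {a b l} → InscribedPath a b l → OnUpperSemicircle b
    path-end [ _ , on-b , _ ] = on-b
    path-end (_ ∷ path)       = path-end path

    -- The new length is existential because it equals l + d only up to associativity.
    path-snoc : ∀ {a b c l d} → InscribedPath a b l → IsChord b c d → ∃[ l′ ] (l′ ≈ l + d × InscribedPath a c l′)
    path-snoc [ chord ]      last = _ , refl , (chord ∷ [ last ])
    path-snoc (chord ∷ path) last with path-snoc path last
    ... | _ , l′≈l+d , path′ = _ , trans (+-congˡ l′≈l+d) (sym (+-assoc _ _ _)) , (chord ∷ path′)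

    distance : ∀ a b → ∃ (IsDistance a b)
    distance a b = sqrt (+-nonneg (sq-nonneg _) (sq-nonneg _))

  -- Boundedness of inscribed paths; existence and monotonicity of the arc cosine

  height-by : ∀ {x} → Dec (x < 0#) → Carrier → Carrier
  height-by (yes _) y = 1# + 1# - y
  height-by (no _)  y = y

  -- The ordinate, unfolded so as to increase along the whole semicircle.
  height : Point → Carrier
  height (x , y) = height-by (em {x < 0#}) y

  opaque
    height≤2 : ∀ {a} → OnUpperSemicircle a → height a ≤ 1# + 1#
    height≤2 {x , y} on@(_ , 0≤y) with em {x < 0#}
    ... | yes _ = ≤-by 0≤y (solve 1 (λ y → con (+ 2) :- (con (+ 2) :- y) := y) refl y)
    ... | no  _ = ≤-trans (upper-y≤1 on) (≤-by (inj₁ 0<1) (solve 0 (con (+ 2) :- con (+ 1) := con (+ 1)) refl))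

    -- Within one quadrant the height changes exactly as much as the ordinate does. Across the top
    -- it grows by (1 - z) + (1 - y), which dominates |z - y| because ordinates are at most 1.
    height-step : ∀ {a b} → OnUpperSemicircle a → OnUpperSemicircle b → proj₁ b ≤ proj₁ a →
                  0# ≤ height b - height a ×
                  (proj₂ b - proj₂ a) * (proj₂ b - proj₂ a) ≤ (height b - height a) * (height b - height a)
    height-step {a , y} {b , z} on-a@(_ , 0≤y) on-b@(_ , 0≤z) b≤a with em {a < 0#} | em {b < 0#}
    ... | no  a≮0 | no b≮0 = x≤y⇒0≤y-x (upper-y-mono on-a on-b (*-mono-≤-nonneg 0≤b b≤a 0≤b b≤a)) , ≤-refl
      where
      0≤b : 0# ≤ b
      0≤b = ≮⇒≥ b≮0
    ... | yes a<0 | no b≮0 = ⊥-elim (b≮0 (≤-<-trans b≤a a<0))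
    ... | yes a<0 | yes b<0 =
      ≤-respʳ-≈ (solve 2 (λ y z → y :- z := con (+ 2) :- z :- (con (+ 2) :- y)) refl y z)
        (x≤y⇒0≤y-x (upper-y-mono on-b on-a (≤-by
          (*-nonneg (x≤y⇒0≤y-x b≤a) (+-nonneg (inj₁ (neg-pos a<0)) (inj₁ (neg-pos b<0))))
          (solve 2 (λ a b → b :* b :- a :* a := (a :- b) :* (:- a :+ :- b)) refl a b)))) ,
      inj₂ (solve 2 (λ y z → (z :- y) :* (z :- y) :=
             (con (+ 2) :- z :- (con (+ 2) :- y)) :* (con (+ 2) :- z :- (con (+ 2) :- y))) refl y z)
    ... | no  a≮0 | yes b<0 =
      ≤-respʳ-≈ (solve 2 (λ y z → (con (+ 1) :- z) :+ (con (+ 1) :- y) := con (+ 2) :- z :- y) refl y z) (+-nonneg 0≤1-z 0≤1-y) ,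
      ≤-by (*-nonneg (+-nonneg 0≤1-z 0≤1-z) (+-nonneg 0≤1-y 0≤1-y))
        (solve 2 (λ y z → (con (+ 2) :- z :- y) :* (con (+ 2) :- z :- y) :- (z :- y) :* (z :- y) :=
          ((con (+ 1) :- z) :+ (con (+ 1) :- z)) :* ((con (+ 1) :- y) :+ (con (+ 1) :- y))) refl y z)
      where
      0≤1-z : 0# ≤ 1# - z
      0≤1-z = x≤y⇒0≤y-x (upper-y≤1 on-b)
      0≤1-y : 0# ≤ 1# - y
      0≤1-y = x≤y⇒0≤y-x (upper-y≤1 on-a)

    hypotenuse-bound : ∀ {x y h k d v} → y ≤ x → 0# ≤ k - h → v * v ≤ (k - h) * (k - h) →
                       d * d ≈ (y - x) * (y - x) + v * v → d ≤ (k - y) - (h - x)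
    hypotenuse-bound {x} {y} {h} {k} y≤x 0≤k-h vv≤ dd≈ = ≤-respʳ-≈
      (solve 4 (λ x y h k → (x :- y) :+ (k :- h) := (k :- y) :- (h :- x)) refl x y h k)
      (sq-cancel-≤ (+-nonneg (x≤y⇒0≤y-x y≤x) 0≤k-h) (≤-respˡ-≈ (sym dd≈) (≤-trans (+-mono-≤ ≤-refl vv≤)
        (≤-by (+-nonneg xy≥0 xy≥0)
          (solve 3 (λ x y w → ((x :- y) :+ w) :* ((x :- y) :+ w) :- ((y :- x) :* (y :- x) :+ w :* w) :=
                              (x :- y) :* w :+ (x :- y) :* w) refl x y (k - h))))))
      where
      xy≥0 : 0# ≤ (x - y) * (k - h)
      xy≥0 = *-nonneg (x≤y⇒0≤y-x y≤x) 0≤k-h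

  -- Horizontal plus vertical distance travelled, up to a constant. A chord is no longer than the
  -- sum of its legs, hence than the gain in potential, and gains telescope along a path; over the
  -- whole semicircle they total 4.
  potential : Point → Carrier
  potential a = height a - proj₁ a

  opaque
    chord-bound : ∀ {a b d} → IsChord a b d → d ≤ potential b - potential a
    chord-bound (on-a , on-b , b≤a , 0≤d , dd≈) =
      let 0≤w , vv≤ww = height-step on-a on-b b≤a in hypotenuse-bound b≤a 0≤w vv≤ww dd≈

    path-bound : ∀ {a b l} → InscribedPath a b l → l ≤ potential b - potential a
    path-bound [ chord ] = chord-bound chord
    path-bound (chord ∷ path) = ≤-respʳ-≈ (solve 3 (λ a b c → (b :- a) :+ (c :- b) := c :- a) refl _ _ _)
      (+-mono-≤ (chord-bound chord) (path-bound path))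

    start-on-upper : OnUpperSemicircle (1# , 0#)
    start-on-upper = solve 0 (con (+ 1) :* con (+ 1) :+ con (+ 0) :* con (+ 0) := con (+ 1)) refl , ≤-refl

    upper-ordinate : ∀ {x} → x * x ≤ 1# → ∃[ y ] OnUpperSemicircle (x , y)
    upper-ordinate {x} xx≤1 = on (sqrt (x≤y⇒0≤y-x xx≤1))
      where
      on : ∃[ y ] (0# ≤ y × y * y ≈ 1# - x * x) → ∃[ y ] OnUpperSemicircle (x , y)
      on (y , 0≤y , yy≈1-xx) = y , trans (+-congˡ yy≈1-xx) (solve 1 (λ z → z :+ (con (+ 1) :- z) := con (+ 1)) refl _) , 0≤y

    upper-x≤1 : ∀ {x y} → OnUpperSemicircle (x , y) → x ≤ 1#
    upper-x≤1 {x} {y} (xx+yy≈1 , _) = sq-cancel-≤ (inj₁ 0<1) (≤-by (sq-nonneg y) (≈-combine (- 1#) xx+yy≈1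
      (solve 2 (λ x y → (con (+ 1) :* con (+ 1) :- x :* x) :- y :* y := con (ℤ.- (+ 1)) :* (x :* x :+ y :* y :- con (+ 1))) refl x y)))

    arccos-exists : ∀ {x} → x * x ≤ 1# → ∃ (IsArccos x)
    arccos-exists {x} xx≤1 = complete _ (nonempty (upper-ordinate xx≤1)) (bound , is-bound)
      where
      nonempty : ∃[ y ] OnUpperSemicircle (x , y) → ∃[ l ] ∃[ y ] InscribedPath (1# , 0#) (x , y) l
      nonempty (y , on) = let d , isd = distance (1# , 0#) (x , y) in
        d , y , [ start-on-upper , on , upper-x≤1 on , isd ]
      bound : Carrier
      bound = (1# + 1#) - x - potential (1# , 0#)
      is-bound : IsUpperBound (λ l → ∃[ y ] InscribedPath (1# , 0#) (x , y) l) bound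
      is-bound l (y , path) = ≤-trans (path-bound path) (+-mono-≤ (+-mono-≤ (height≤2 (path-end path)) ≤-refl) ≤-refl)

    sup-unique : ∀ {S s s′} → IsSupremum S s → IsSupremum S s′ → s ≈ s′
    sup-unique (ub , least) (ub′ , least′) = ≤-antisym (least _ ub′) (least′ _ ub)

    arccos-resp-≈ : ∀ {x x′ θ} → x ≈ x′ → IsArccos x θ → IsArccos x′ θ
    arccos-resp-≈ x≈x′ (ub , least) =
      (λ { l (y , path) → ub l (y , path-resp-≐ (sym x≈x′ , refl) path) }) ,
      (λ b b-ub → least b λ { l (y , path) → b-ub l (y , path-resp-≐ (x≈x′ , refl) path) })

    arccos-unique : ∀ {x x′ θ θ′} → x ≈ x′ → IsArccos x θ → IsArccos x′ θ′ → θ ≈ θ′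
    arccos-unique x≈x′ is is′ = sup-unique (arccos-resp-≈ x≈x′ is) is′

    -- Without a point of abscissa x there are no paths at all, so every number bounds their lengths
    -- and θ - 1 contradicts the leastness of θ.
    arccos-domain : ∀ {x θ} → IsArccos x θ → ∃[ y ] OnUpperSemicircle (x , y)
    arccos-domain {x} {θ} (ub , least) with em {∃[ y ] OnUpperSemicircle (x , y)}
    ... | yes on = on
    ... | no ¬on = ⊥-elim (≤⇒≯ (least (θ - 1#) λ { l (y , path) → ⊥-elim (¬on (y , path-end path)) })
                     (<-by 0<1 (solve 1 (λ t → t :- (t :- con (+ 1)) := con (+ 1)) refl θ)))

    -- Every path to abscissa x extends by one chord of length d > 0 to abscissa x′; hence θ + d ≤
    -- θ′.
    arccos-anti-mono : ∀ {x x′ θ θ′} → x′ < x → IsArccos x θ → IsArccos x′ θ′ → θ < θ′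
    arccos-anti-mono {x} {x′} {θ} {θ′} x′<x is@(ub , least) is′@(ub′ , least′) = go (arccos-domain is) (arccos-domain is′)
      where
      go : ∃[ y ] OnUpperSemicircle (x , y) → ∃[ y′ ] OnUpperSemicircle (x′ , y′) → θ < θ′
      go (y , on) (y′ , on′) = extend (distance (x , y) (x′ , y′))
        where
        extend : ∃ (IsDistance (x , y) (x′ , y′)) → θ < θ′
        extend (d , 0≤d , dd≈) = ≤-<-trans (least (θ′ - d) bound) (<-by 0<d (solve 2 (λ t d → t :- (t :- d) := d) refl θ′ d))
          where
          0<d : 0# < d
          0<d = sq-cancel-< 0≤d (<-respˡ-≈ (sym (zeroˡ 0#)) (<-respʳ-≈ (sym dd≈)
            (+-pos-nonneg (sq-pos (λ x′-x≈0 → <⇒≉ x′<x (≈-by x′-x≈0))) (sq-nonneg _))))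
          bound : IsUpperBound (λ l → ∃[ y ] InscribedPath (1# , 0#) (x , y) l) (θ′ - d)
          bound l (z , path) = shorten (path-snoc
            (path-resp-≐ (refl , upper-y-unique refl (path-end path) on) path) (on , on′ , inj₁ x′<x , 0≤d , dd≈))
            where
            shorten : ∃[ l′ ] (l′ ≈ l + d × InscribedPath (1# , 0#) (x′ , y′) l′) → l ≤ θ′ - d
            shorten (l′ , l′≈l+d , path′) = ≤-by (x≤y⇒0≤y-x (≤-respˡ-≈ l′≈l+d (ub′ l′ (y′ , path′))))
              (solve 3 (λ t d l → t :- d :- l := t :- (l :+ d)) refl θ′ d l)

    arccos-injective : ∀ {x x′ θ θ′} → θ ≈ θ′ → IsArccos x θ → IsArccos x′ θ′ → x ≈ x′
    arccos-injective {x} {x′} θ≈θ′ is is′ with compare x x′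
    ... | tri< x<x′ _ _ = ⊥-elim (<⇒≉ (arccos-anti-mono x<x′ is′ is) (sym θ≈θ′))
    ... | tri≈ _ x≈x′ _ = x≈x′
    ... | tri> _ _ x′<x = ⊥-elim (<⇒≉ (arccos-anti-mono x′<x is is′) θ≈θ′)

    arccos-1-nonneg : ∀ {θ} → IsArccos 1# θ → 0# ≤ θ
    arccos-1-nonneg (ub , _) = ub 0# (0# , [ start-on-upper , start-on-upper , ≤-refl , ≤-refl ,
      solve 0 (con (+ 0) :* con (+ 0) := (con (+ 1) :- con (+ 1)) :* (con (+ 1) :- con (+ 1)) :+ (con (+ 0) :- con (+ 0)) :* (con (+ 0) :- con (+ 0))) refl ])

    arccos-pos : ∀ {x θ} → x < 1# → IsArccos x θ → 0# < θ
    arccos-pos {x} {θ} x<1 is = from-zero (arccos-exists (inj₂ (*-identityˡ 1#)))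
      where
      from-zero : ∃ (IsArccos 1#) → 0# < θ
      from-zero (o , is-o) = ≤-<-trans (arccos-1-nonneg is-o) (arccos-anti-mono x<1 is-o is)

    arccos<π : ∀ {x θ} → - 1# < x → IsArccos x θ → ∃[ π ] (Isπ π × θ < π)
    arccos<π {x} {θ} -1<x is = below (arccos-exists (inj₂ (solve 0 (con (ℤ.- (+ 1)) :* con (ℤ.- (+ 1)) := con (+ 1)) refl)))
      where
      below : ∃ (IsArccos (- 1#)) → ∃[ π ] (Isπ π × θ < π)
      below (π , is-π) = π , is-π , arccos-anti-mono -1<x is is-π

  -- Cosines of angles between vectors

  infixr 8 _·_
  _·_ : Carrier → Point → Point
  t · (x , y) = t * x , t * y

  Nonzero : Point → Set
  Nonzero u = ¬ (u ≐ (0# , 0#))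

  -- Records the sign a cosine picks up when a leg is replaced by the opposite ray of its line, as
  -- happens under projection through p.
  signed : Bool → Carrier → Carrier
  signed true  x = x
  signed false x = - x

  -- Positivity of the norms excludes zero legs and makes the cosine unique.
  CosineOf : Point → Point → Carrier → Set
  CosineOf u w x = ∃[ r ] ∃[ s ] (0# < r × 0# < s × r * r ≈ dot u u × s * s ≈ dot w w × x * (r * s) ≈ dot u w)

  opaque
    dot-cong : ∀ {u u′ w w′} → u ≐ u′ → w ≐ w′ → dot u w ≈ dot u′ w′
    dot-cong (p , q) (p′ , q′) = +-cong (*-cong p p′) (*-cong q q′)

    cross-cong : ∀ {u u′ w w′} → u ≐ u′ → w ≐ w′ → cross u w ≈ cross u′ w′
    cross-cong (p , q) (p′ , q′) = +-cong (*-cong p q′) (-‿cong (*-cong q p′))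

    ≐-sym : ∀ {u w} → u ≐ w → w ≐ u
    ≐-sym (p , q) = sym p , sym q

    ≐-trans : ∀ {u v w} → u ≐ v → v ≐ w → u ≐ w
    ≐-trans (p , q) (p′ , q′) = trans p p′ , trans q q′

    ⊖-cong : ∀ {u u′ w w′} → u ≐ u′ → w ≐ w′ → u ⊖ w ≐ u′ ⊖ w′
    ⊖-cong (p , q) (p′ , q′) = +-cong p (-‿cong p′) , +-cong q (-‿cong q′)

    ⊖-nonzero : ∀ {a b} → ¬ (a ≐ b) → Nonzero (a ⊖ b)
    ⊖-nonzero a≢b (p , q) = a≢b (≈-by p , ≈-by q)

    dot-pos : ∀ {u} → Nonzero u → 0# < dot u u
    dot-pos u≉0 = sq+sq-pos u≉0

    norm-pos : ∀ {u r} → Nonzero u → 0# ≤ r → r * r ≈ dot u u → 0# < r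
    norm-pos u≉0 0≤r rr = sq-cancel-< 0≤r (<-respˡ-≈ (sym (zeroˡ 0#)) (<-respʳ-≈ (sym rr) (dot-pos u≉0)))

    norm-exists : ∀ {u} → Nonzero u → ∃[ r ] (0# < r × r * r ≈ dot u u)
    norm-exists {u} u≉0 = positive (sqrt (inj₁ (dot-pos u≉0)))
      where
      positive : ∃[ r ] (0# ≤ r × r * r ≈ dot u u) → ∃[ r ] (0# < r × r * r ≈ dot u u)
      positive (r , 0≤r , rr) = r , norm-pos u≉0 0≤r rr , rr

    cosine-resp-≐ : ∀ {u u′ w w′ x} → u ≐ u′ → w ≐ w′ → CosineOf u w x → CosineOf u′ w′ x
    cosine-resp-≐ u≐u′ w≐w′ (r , s , 0<r , 0<s , rr , ss , x) =
      r , s , 0<r , 0<s , trans rr (dot-cong u≐u′ u≐u′) , trans ss (dot-cong w≐w′ w≐w′) , trans x (dot-cong u≐u′ w≐w′)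

    cosine-unique : ∀ {u w x x′} → CosineOf u w x → CosineOf u w x′ → x ≈ x′
    cosine-unique {x = x} {x′} (r , s , 0<r , 0<s , rr , ss , xrs) (r′ , s′ , 0<r′ , 0<s′ , rr′ , ss′ , x′r′s′) =
      *-cancelˡ-≈ (>⇒≉ (*-pos 0<r 0<s)) (trans (*-comm _ x) (trans xrs (trans (sym x′r′s′) (trans (*-comm x′ _)
        (*-congʳ (*-cong (sq-cancel-≈ (inj₁ 0<r′) (inj₁ 0<r) (trans rr′ (sym rr)))
                         (sq-cancel-≈ (inj₁ 0<s′) (inj₁ 0<s) (trans ss′ (sym ss)))))))))

    cosine-sym : ∀ {u w x} → CosineOf u w x → CosineOf w u x
    cosine-sym {u} {w} (r , s , 0<r , 0<s , rr , ss , xrs) =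
      s , r , 0<s , 0<r , ss , rr , trans (*-congˡ (*-comm s r)) (trans xrs (+-cong (*-comm _ _) (*-comm _ _)))

    cosine-exists : ∀ {u w} → Nonzero u → Nonzero w → ∃ (CosineOf u w)
    cosine-exists {u} {w} u≉0 w≉0 = build (norm-exists u≉0) (norm-exists w≉0)
      where
      build : ∃[ r ] (0# < r × r * r ≈ dot u u) → ∃[ s ] (0# < s × s * s ≈ dot w w) → ∃ (CosineOf u w)
      build (r , 0<r , rr) (s , 0<s , ss) = divide (pos-inverse (*-pos 0<r 0<s))
        where
        divide : ∃[ k ] (0# < k × (r * s) * k ≈ 1#) → ∃ (CosineOf u w)
        divide (k , _ , rsk≈1) = dot u w * k , r , s , 0<r , 0<s , rr , ss ,
          trans (*-assoc _ _ _) (trans (*-congˡ (trans (*-comm k _) rsk≈1)) (*-identityʳ _))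

    cosine-scaleˡ : ∀ {u w x t} → ¬ (t ≈ 0#) → CosineOf u w x → ∃[ σ ] CosineOf (t · u) w (signed σ x)
    cosine-scaleˡ {u₁ , u₂} {w₁ , w₂} {x} {t} t≉0 (r , s , 0<r , 0<s , rr , ss , xrs) = by-sign (≉0⇒pos⊎neg t≉0)
      where
      dot-t : (t * t) * (u₁ * u₁ + u₂ * u₂) ≈ (t * u₁) * (t * u₁) + (t * u₂) * (t * u₂)
      dot-t = solve 3 (λ t a b → (t :* t) :* (a :* a :+ b :* b) := (t :* a) :* (t :* a) :+ (t :* b) :* (t :* b)) refl t u₁ u₂
      dot-tw : t * (u₁ * w₁ + u₂ * w₂) ≈ (t * u₁) * w₁ + (t * u₂) * w₂
      dot-tw = solve 5 (λ t a b c d → t :* (a :* c :+ b :* d) := (t :* a) :* c :+ (t :* b) :* d) refl t u₁ u₂ w₁ w₂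
      by-sign : 0# < t ⊎ t < 0# → ∃[ σ ] CosineOf (t · (u₁ , u₂)) (w₁ , w₂) (signed σ x)
      by-sign (inj₁ 0<t) = true , t * r , s , *-pos 0<t 0<r , 0<s ,
        trans (solve 2 (λ t r → (t :* r) :* (t :* r) := (t :* t) :* (r :* r)) refl t r) (trans (*-congˡ rr) dot-t) , ss ,
        trans (solve 4 (λ t r s x → x :* ((t :* r) :* s) := t :* (x :* (r :* s))) refl t r s x) (trans (*-congˡ xrs) dot-tw)
      by-sign (inj₂ t<0) = false , (- t) * r , s , *-pos (neg-pos t<0) 0<r , 0<s ,
        trans (solve 2 (λ t r → (:- t :* r) :* (:- t :* r) := (t :* t) :* (r :* r)) refl t r) (trans (*-congˡ rr) dot-t) , ss ,
        trans (solve 4 (λ t r s x → (:- x) :* ((:- t :* r) :* s) := t :* (x :* (r :* s))) refl t r s x) (trans (*-congˡ xrs) dot-tw)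

    lagrange : ∀ u w → dot u u * dot w w ≈ dot u w * dot u w + cross u w * cross u w
    lagrange (a , b) (c , d) = solve 4 (λ a b c d → (a :* a :+ b :* b) :* (c :* c :+ d :* d) :=
      (a :* c :+ b :* d) :* (a :* c :+ b :* d) :+ (a :* d :- b :* c) :* (a :* d :- b :* c)) refl a b c d

    -- Lagrange's identity read as sin² = 1 - cos², with k = |u|² |w|². It yields the Cauchy-Schwarz
    -- inequality and its strict form for independent vectors.
    cosine-defect : ∀ {u w x} → CosineOf u w x → ∃[ k ] (0# < k × k * (1# - x * x) ≈ cross u w * cross u w)
    cosine-defect {u} {w} {x} (r , s , 0<r , 0<s , rr , ss , xrs) = (r * s) * (r * s) , *-pos 0<rs 0<rs ,
      trans (solve 3 (λ r s x → (r :* s) :* (r :* s) :* (con (+ 1) :- x :* x) :=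
                                (r :* r) :* (s :* s) :- (x :* (r :* s)) :* (x :* (r :* s))) refl r s x)
      (trans (+-cong (trans (*-cong rr ss) (lagrange u w)) (-‿cong (*-cong xrs xrs)))
             (solve 2 (λ p q → (p :+ q) :- p := q) refl _ _))
      where
      0<rs : 0# < r * s
      0<rs = *-pos 0<r 0<s

    cosine²≤1 : ∀ {u w x} → CosineOf u w x → x * x ≤ 1#
    cosine²≤1 {u} {w} {x} cos = ≮⇒≥ λ 1<xx → from (cosine-defect cos) 1<xx
      where
      from : ∃[ k ] (0# < k × k * (1# - x * x) ≈ cross u w * cross u w) → ¬ (1# < x * x)
      from (k , 0<k , e) 1<xx = ≤⇒≯ (≤-respʳ-≈ (sym e) (sq-nonneg _)) (<-respˡ-≈ (*-comm _ k) (*-neg-pos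
        (<-by (x<y⇒0<y-x 1<xx) (solve 1 (λ y → con (+ 0) :- (con (+ 1) :- y) := y :- con (+ 1)) refl _)) 0<k))

    cosine²<1 : ∀ {u w x} → ¬ (cross u w ≈ 0#) → CosineOf u w x → x * x < 1#
    cosine²<1 {u} {w} {x} cross≉0 cos = from (cosine-defect cos)
      where
      from : ∃[ k ] (0# < k × k * (1# - x * x) ≈ cross u w * cross u w) → x * x < 1#
      from (k , 0<k , e) = <-by (*-cancel-pos 0<k (<-respʳ-≈ (sym e) (sq-pos cross≉0))) refl

    angle⇒cosine : ∀ {a b c θ} → ¬ (a ≐ b) → ¬ (c ≐ b) → IsAngle a b c θ →
                   ∃[ x ] (CosineOf (a ⊖ b) (c ⊖ b) x × IsArccos x θ)
    angle⇒cosine {a} {b} {c} a≢b c≢b (x , r , s , (0≤r , rr) , (0≤s , ss) , xrs , is) =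
      x , (r , s , norm-pos (⊖-nonzero a≢b) 0≤r rr , norm-pos (⊖-nonzero c≢b) 0≤s ss , rr , ss , xrs) , is

    cosine⇒angle : ∀ {a b c x θ} → CosineOf (a ⊖ b) (c ⊖ b) x → IsArccos x θ → IsAngle a b c θ
    cosine⇒angle (r , s , 0<r , 0<s , rr , ss , xrs) is = _ , r , s , (inj₁ 0<r , rr) , (inj₁ 0<s , ss) , xrs , is

    parallel⇒multiple : ∀ {d w} → Nonzero d → cross d w ≈ 0# → ∃[ t ] (w ≐ t · d)
    parallel⇒multiple {p , q} {x , y} d≉0 cross≈0 = from (pos-inverse (dot-pos d≉0))
      where
      from : ∃[ k ] (0# < k × (p * p + q * q) * k ≈ 1#) → ∃[ t ] ((x , y) ≐ t · (p , q))
      -- The factor is the coefficient of the orthogonal projection of w to d.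
      from (k , _ , Dk≈1) = (p * x + q * y) * k ,
        ≈-combine (- x) Dk≈1 (trans (sym (trans (+-congˡ (-‿cong (trans (*-congˡ cross≈0) (zeroʳ _))))
                                          (solve 1 (λ z → z :- con (+ 0) := z) refl _)))
          (solve 5 (λ p q x y k → (x :- (p :* x :+ q :* y) :* k :* p) :- (:- q) :* k :* (p :* y :- q :* x) :=
                                  (:- x) :* ((p :* p :+ q :* q) :* k :- con (+ 1)) ) refl p q x y k)) ,
        ≈-combine (- y) Dk≈1 (trans (sym (trans (+-congˡ (-‿cong (trans (*-congˡ cross≈0) (zeroʳ _))))
                                          (solve 1 (λ z → z :- con (+ 0) := z) refl _)))
          (solve 5 (λ p q x y k → (y :- (p :* x :+ q :* y) :* k :* q) :- p :* k :* (p :* y :- q :* x) :=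
                                  (:- y) :* ((p :* p :+ q :* q) :* k :- con (+ 1)) ) refl p q x y k))

    line-difference : ∀ {a b} ℓ → a ∈ₗ ℓ → b ∈ₗ ℓ → ∃[ t ] (a ⊖ b ≐ t · Line.direction ℓ)
    line-difference {a₁ , a₂} {b₁ , b₂} ℓ a∈ℓ b∈ℓ = parallel⇒multiple (Line.nonzero ℓ)
      (trans (solve 8 (λ p q x y a b c d → p :* (b :- d) :- q :* (a :- c) :=
                         (p :* (b :- y) :- q :* (a :- x)) :- (p :* (d :- y) :- q :* (c :- x)))
                refl _ _ (proj₁ base) (proj₂ base) a₁ a₂ b₁ b₂)
             (x≈y⇒x-y≈0 (trans a∈ℓ (sym b∈ℓ))))
      where open Line ℓ
    multiple-nonzero : ∀ {w t d} → Nonzero w → w ≐ t · d → ¬ (t ≈ 0#)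
    multiple-nonzero w≉0 (p , q) t≈0 = w≉0 (trans p (trans (*-congʳ t≈0) (zeroˡ _)) , trans q (trans (*-congʳ t≈0) (zeroˡ _)))

  -- Counting by codes

  -- A relation rather than a function, so that a code may denote nothing, or something outside S,
  -- and an element may have several codes.
  Covered : (Carrier → Set) → ℕ → Set₁
  Covered S N = Σ (Carrier → Fin N → Set) λ R →
    (∀ x → S x → ∃ (R x)) × (∀ x y c → R x c → R y c → x ≈ y)

  -- Induction on the number of codes: if code zero denotes no element of S it is dropped; otherwise
  -- its element is listed first and removed from S.
  covered⇒cardinality : ∀ {S N} → Covered S N → ∃ (HasCardinality S)
  covered⇒cardinality {S} {zero} (R , code , _) = zero , (λ ()) , (λ ()) , (λ ()) , λ x Sx → absurd (code x Sx)
    where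
    absurd : ∀ {x} → ∃ (R x) → ∃[ i ] (x ≈ _)
    absurd (() , _)
  covered⇒cardinality {S} {suc N} (R , code , determines) with em {∃[ x ] (S x × R x zero)}
  ... | no unused = covered⇒cardinality ((λ x c → R x (suc c)) , recode , λ x y c → determines x y (suc c))
    where
    recode : ∀ x → S x → ∃[ c ] R x (suc c)
    recode x Sx with code x Sx
    ... | zero  , Rx = ⊥-elim (unused (x , Sx , Rx))
    ... | suc c , Rx = c , Rx
  ... | yes (x₀ , Sx₀ , Rx₀) = add (covered⇒cardinality {S′} ((λ x c → R x (suc c)) , recode , λ x y c → determines x y (suc c)))
    where
    S′ : Carrier → Set
    S′ x = S x × ¬ (x ≈ x₀)
    recode : ∀ x → S′ x → ∃[ c ] R x (suc c)
    recode x (Sx , x≉x₀) with code x Sx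
    ... | zero  , Rx = ⊥-elim (x≉x₀ (determines x x₀ zero Rx Rx₀))
    ... | suc c , Rx = c , Rx
    add : ∃ (HasCardinality S′) → ∃ (HasCardinality S)
    add (a , e , e∈ , e-injective , e-covers) = suc a , e⁺ , e⁺∈ , e⁺-injective , e⁺-covers
      where
      e⁺ : Fin (suc a) → Carrier
      e⁺ zero    = x₀
      e⁺ (suc i) = e i
      e⁺∈ : ∀ i → S (e⁺ i)
      e⁺∈ zero    = Sx₀
      e⁺∈ (suc i) = proj₁ (e∈ i)
      e⁺-injective : ∀ i j → e⁺ i ≈ e⁺ j → i ≡ j
      e⁺-injective zero    zero    _ = ≡.refl
      e⁺-injective zero    (suc j) p = ⊥-elim (proj₂ (e∈ j) (sym p))
      e⁺-injective (suc i) zero    p = ⊥-elim (proj₂ (e∈ i) p)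
      e⁺-injective (suc i) (suc j) p = ≡.cong suc (e-injective i j p)
      e⁺-covers : ∀ x → S x → ∃[ i ] (x ≈ e⁺ i)
      e⁺-covers x Sx with em {x ≈ x₀}
      ... | yes x≈x₀ = zero , x≈x₀
      ... | no  x≉x₀ with e-covers x (Sx , x≉x₀)
      ...   | i , x≈ei = suc i , x≈ei

  cardinality≤ : ∀ {S N a} → Covered S N → HasCardinality S a → a ℕ.≤ N
  cardinality≤ (R , code , determines) (e , e∈ , e-injective , _) =
    Fin.injective⇒≤ {f = λ i → proj₁ (code (e i) (e∈ i))} λ {i} {j} eq → e-injective i j
      (determines _ _ _ (proj₂ (code (e i) (e∈ i))) (≡.subst (R (e j)) (≡.sym eq) (proj₂ (code (e j) (e∈ j)))))

  ≤cardinality : ∀ {S a b} (f : Fin b → Carrier) → (∀ i → S (f i)) → (∀ i j → f i ≈ f j → i ≡ j) →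
                 HasCardinality S a → b ℕ.≤ a
  ≤cardinality f f∈ f-injective (e , _ , _ , covers) =
    Fin.injective⇒≤ {f = λ i → proj₁ (covers (f i) (f∈ i))} λ {i} {j} eq → f-injective i j
      (trans (proj₂ (covers (f i) (f∈ i))) (trans (reflexive (≡.cong e eq)) (sym (proj₂ (covers (f j) (f∈ j))))))

  -- Regular polygons

  infixl 7 _⊛_
  -- Complex multiplication. For g ≠ 0, multiplying by g is an orientation-preserving similarity, as
  -- `dot-⊛` and `cross-⊛` express.
  _⊛_ : Point → Point → Point
  (a , b) ⊛ (c , d) = a * c - b * d , a * d + b * c

  infixl 6 _⊕_
  _⊕_ : Point → Point → Point
  (a , b) ⊕ (c , d) = a + c , b + d

  opaque
    ⊕-cong : ∀ {a a′ b b′} → a ≐ a′ → b ≐ b′ → a ⊕ b ≐ a′ ⊕ b′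
    ⊕-cong (p , q) (p′ , q′) = +-cong p p′ , +-cong q q′

    ⊛-cong : ∀ {a a′ b b′} → a ≐ a′ → b ≐ b′ → a ⊛ b ≐ a′ ⊛ b′
    ⊛-cong (p , q) (p′ , q′) = +-cong (*-cong p p′) (-‿cong (*-cong q q′)) , +-cong (*-cong p q′) (*-cong q p′)

    ·-cong : ∀ {t t′ a a′} → t ≈ t′ → a ≐ a′ → t · a ≐ t′ · a′
    ·-cong t≈t′ (p , q) = *-cong t≈t′ p , *-cong t≈t′ q

    ≐-refl : ∀ {a} → a ≐ a
    ≐-refl = refl , refl

    ⊛-assoc : ∀ a b c → (a ⊛ b) ⊛ c ≐ a ⊛ (b ⊛ c)
    ⊛-assoc (a , b) (c , d) (e , f) =
      solve 6 (λ a b c d e f → (a :* c :- b :* d) :* e :- (a :* d :+ b :* c) :* f :=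
                               a :* (c :* e :- d :* f) :- b :* (c :* f :+ d :* e)) refl a b c d e f ,
      solve 6 (λ a b c d e f → (a :* c :- b :* d) :* f :+ (a :* d :+ b :* c) :* e :=
                               a :* (c :* f :+ d :* e) :+ b :* (c :* e :- d :* f)) refl a b c d e f

    ⊛-comm : ∀ a b → a ⊛ b ≐ b ⊛ a
    ⊛-comm (a , b) (c , d) =
      solve 4 (λ a b c d → a :* c :- b :* d := c :* a :- d :* b) refl a b c d ,
      solve 4 (λ a b c d → a :* d :+ b :* c := c :* b :+ d :* a) refl a b c d

    ⊛-· : ∀ t a b → a ⊛ t · b ≐ t · (a ⊛ b)
    ⊛-· t (a , b) (c , d) =
      solve 5 (λ t a b c d → a :* (t :* c) :- b :* (t :* d) := t :* (a :* c :- b :* d)) refl t a b c d ,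
      solve 5 (λ t a b c d → a :* (t :* d) :+ b :* (t :* c) := t :* (a :* d :+ b :* c)) refl t a b c d

    dot-⊛ : ∀ g a b → dot (g ⊛ a) (g ⊛ b) ≈ dot g g * dot a b
    dot-⊛ (g , h) (a , b) (c , d) = solve 6 (λ g h a b c d →
      (g :* a :- h :* b) :* (g :* c :- h :* d) :+ (g :* b :+ h :* a) :* (g :* d :+ h :* c) :=
      (g :* g :+ h :* h) :* (a :* c :+ b :* d)) refl g h a b c d

    cross-⊛ : ∀ g a b → cross (g ⊛ a) (g ⊛ b) ≈ dot g g * cross a b
    cross-⊛ (g , h) (a , b) (c , d) = solve 6 (λ g h a b c d →
      (g :* a :- h :* b) :* (g :* d :+ h :* c) :- (g :* b :+ h :* a) :* (g :* c :- h :* d) :=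
      (g :* g :+ h :* h) :* (a :* d :- b :* c)) refl g h a b c d

    cross-·· : ∀ s t a b → cross (s · a) (t · b) ≈ (s * t) * cross a b
    cross-·· s t (a , b) (c , d) = solve 6 (λ s t a b c d →
      (s :* a) :* (t :* d) :- (s :* b) :* (t :* c) := (s :* t) :* (a :* d :- b :* c)) refl s t a b c d

    dot-·· : ∀ s t a b → dot (s · a) (t · b) ≈ (s * t) * dot a b
    dot-·· s t (a , b) (c , d) = solve 6 (λ s t a b c d →
      (s :* a) :* (t :* c) :+ (s :* b) :* (t :* d) := (s :* t) :* (a :* c :+ b :* d)) refl s t a b c d

    -- The pair on the right is the conjugate of e times w, so this is w = (w / e) e cleared of its
    -- denominator.
    rotate-by : ∀ e w → dot e e · w ≐ (dot e w , cross e w) ⊛ e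
    rotate-by (a , b) (c , d) =
      solve 4 (λ a b c d → (a :* a :+ b :* b) :* c := (a :* c :+ b :* d) :* a :- (a :* d :- b :* c) :* b) refl a b c d ,
      solve 4 (λ a b c d → (a :* a :+ b :* b) :* d := (a :* c :+ b :* d) :* b :+ (a :* d :- b :* c) :* a) refl a b c d

    ·-cancel : ∀ {t a b} → ¬ (t ≈ 0#) → t · a ≐ t · b → a ≐ b
    ·-cancel t≉0 (p , q) = *-cancelˡ-≈ t≉0 p , *-cancelˡ-≈ t≉0 q

  -- The polygon with vertices Im ζⁱ · ζⁱ, where ζ = c + i s is a unit: inscribed in a circle through the vertex 0
  -- tangent there to the first axis, so that ζⁱ is the direction from vertex 0 to vertex i.
  module UnitPowers (c s : Carrier) (unit : c * c + s * s ≈ 1#) where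
    open Powers c s public
    open Unit unit public

    pow vertex : ℕ → Point
    pow i    = Re i , Im i
    vertex i = Im i · pow i

    opaque
      -- Since `vertex i` is (ζ²ⁱ - 1) / 2√-1, the difference is ζ²ⁱ (ζ²ʲ - 1) / 2√-1, that is, ζ²ⁱ
      -- times `vertex j`.
      vertex-difference : ∀ i j → vertex (j ℕ.+ i) ⊖ vertex i ≐ Im j · (pow i ⊛ pow (j ℕ.+ i))
      vertex-difference i j =
        trans (+-congʳ (*-cong (Im-+ j i) (Re-+ j i))) (trans
          (≈-combine (Im i * Re i) (norm j) (solve 4 (λ x y z w →
            ((w :* x :+ z :* y) :* (z :* x :- w :* y) :- y :* x) :- w :* (x :* (z :* x :- w :* y) :- y :* (w :* x :+ z :* y)) :=
            y :* x :* ((z :* z :+ w :* w) :- con (+ 1))) refl (Re i) (Im i) (Re j) (Im j)))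
          (*-congˡ (sym (+-cong (*-congˡ (Re-+ j i)) (-‿cong (*-congˡ (Im-+ j i))))))) ,
        trans (+-congʳ (*-cong (Im-+ j i) (Im-+ j i))) (trans
          (≈-combine (Im i * Im i) (norm j) (solve 4 (λ x y z w →
            ((w :* x :+ z :* y) :* (w :* x :+ z :* y) :- y :* y) :- w :* (x :* (w :* x :+ z :* y) :+ y :* (z :* x :- w :* y)) :=
            y :* y :* ((z :* z :+ w :* w) :- con (+ 1))) refl (Re i) (Im i) (Re j) (Im j)))
          (*-congˡ (sym (+-cong (*-congˡ (Im-+ j i)) (*-congˡ (Re-+ j i))))))

      dot-pow : ∀ i δ → dot (pow i) (pow (δ ℕ.+ i)) ≈ Re δ
      dot-pow i δ = trans (+-cong (*-congˡ (Re-+ δ i)) (*-congˡ (Im-+ δ i)))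
        (≈-combine (Re δ) (norm i) (solve 4 (λ x y z w → (x :* (z :* x :- w :* y) :+ y :* (w :* x :+ z :* y)) :- z :=
          z :* ((x :* x :+ y :* y) :- con (+ 1))) refl (Re i) (Im i) (Re δ) (Im δ)))

      cross-pow : ∀ i δ → cross (pow i) (pow (δ ℕ.+ i)) ≈ Im δ
      cross-pow i δ = trans (+-cong (*-congˡ (Im-+ δ i)) (-‿cong (*-congˡ (Re-+ δ i))))
        (≈-combine (Im δ) (norm i) (solve 4 (λ x y z w → (x :* (w :* x :+ z :* y) :- y :* (z :* x :- w :* y)) :- w :=
          w :* ((x :* x :+ y :* y) :- con (+ 1))) refl (Re i) (Im i) (Re δ) (Im δ)))

      cosine-pow : ∀ g → Nonzero g → ∀ i δ → CosineOf (g ⊛ pow i) (g ⊛ pow (δ ℕ.+ i)) (Re δ)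
      cosine-pow g g≉0 i δ = build (norm-exists g≉0)
        where
        norm-g : ∀ j → dot (g ⊛ pow j) (g ⊛ pow j) ≈ dot g g
        norm-g j = trans (dot-⊛ g (pow j) (pow j)) (trans (*-congˡ (norm j)) (*-identityʳ _))
        build : ∃[ r ] (0# < r × r * r ≈ dot g g) → CosineOf (g ⊛ pow i) (g ⊛ pow (δ ℕ.+ i)) (Re δ)
        build (r , 0<r , rr) = r , r , 0<r , 0<r , trans rr (sym (norm-g i)) , trans rr (sym (norm-g (δ ℕ.+ i))) ,
          trans (trans (*-comm _ _) (*-cong rr (sym (dot-pow i δ)))) (sym (dot-⊛ g (pow i) (pow (δ ℕ.+ i))))

  opaque
    -- Take c = √((1 + x) / 2) and s = √((1 - x) / 2). Then 2cs and y have equal squares, and y > 0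
    -- settles the sign and forces s ≠ 0.
    half-angle : ∀ {x y} → x * x + y * y ≈ 1# → 0# < y →
      ∃[ c ] ∃[ s ] (c * c + s * s ≈ 1# × ¬ (s ≈ 0#) × (x , y) ≐ (c , s) ⊛ (c , s))
    half-angle {x} {y} xx+yy≈1 0<y = build (sqrt {half * (1# + x)} 0≤c²) (sqrt {half * (1# - x)} 0≤s²)
      where
      xx≤1 : x * x ≤ 1# * 1#
      xx≤1 = ≤-by (sq-nonneg y) (≈-combine (- 1#) xx+yy≈1
        (solve 2 (λ x y → (con (+ 1) :* con (+ 1) :- x :* x) :- y :* y := con (ℤ.- (+ 1)) :* (x :* x :+ y :* y :- con (+ 1))) refl x y))
      0≤s² : 0# ≤ half * (1# - x)
      0≤s² = *-nonneg (inj₁ 0<half) (x≤y⇒0≤y-x (sq-cancel-≤ (inj₁ 0<1) xx≤1))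
      0≤c² : 0# ≤ half * (1# + x)
      0≤c² = *-nonneg (inj₁ 0<half) (≤-respʳ-≈ (solve 1 (λ x → con (+ 1) :- :- x := con (+ 1) :+ x) refl x)
        (x≤y⇒0≤y-x (sq-cancel-≤ (inj₁ 0<1) (≤-respˡ-≈ (solve 1 (λ x → x :* x := :- x :* :- x) refl x) xx≤1))))
      build : ∃[ c ] (0# ≤ c × c * c ≈ half * (1# + x)) → ∃[ s ] (0# ≤ s × s * s ≈ half * (1# - x)) →
              ∃[ c ] ∃[ s ] (c * c + s * s ≈ 1# × ¬ (s ≈ 0#) × (x , y) ≐ (c , s) ⊛ (c , s))
      build (c , 0≤c , cc) (s , 0≤s , ss) = c , s ,
        trans (+-cong cc ss) (trans (solve 2 (λ h x → h :* (con (+ 1) :+ x) :+ h :* (con (+ 1) :- x) := con (+ 2) :* h) refl half x) 2*half≈1) ,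
        (λ s≈0 → >⇒≉ 0<y (trans y≈2cs (trans (+-cong (*-congˡ s≈0) (*-congʳ s≈0)) (solve 1 (λ c → c :* con (+ 0) :+ con (+ 0) :* c := con (+ 0)) refl c)))) ,
        sym (trans (+-cong cc (-‿cong ss)) (≈-combine x 2*half≈1
          (solve 2 (λ h x → (h :* (con (+ 1) :+ x) :- h :* (con (+ 1) :- x)) :- x := x :* (con (+ 2) :* h :- con (+ 1))) refl half x))) ,
        y≈2cs
        where
        y≈2cs : y ≈ c * s + s * c
        y≈2cs = sq-cancel-≈ (inj₁ 0<y) (+-nonneg (*-nonneg 0≤c 0≤s) (*-nonneg 0≤s 0≤c)) (sym
          (trans (solve 2 (λ c s → (c :* s :+ s :* c) :* (c :* s :+ s :* c) := con (+ 4) :* ((c :* c) :* (s :* s))) refl c s)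
          (trans (*-congˡ (*-cong cc ss))
          (trans (solve 2 (λ h x → con (+ 4) :* ((h :* (con (+ 1) :+ x)) :* (h :* (con (+ 1) :- x))) :=
                                   ((con (+ 2) :* h) :* (con (+ 2) :* h)) :* (con (+ 1) :- x :* x)) refl half x)
          (trans (*-congʳ (trans (*-cong 2*half≈1 2*half≈1) (*-identityˡ 1#)))
          (≈-combine (- 1#) xx+yy≈1 (solve 2 (λ x y → con (+ 1) :* (con (+ 1) :- x :* x) :- y :* y :=
            con (ℤ.- (+ 1)) :* (x :* x :+ y :* y :- con (+ 1))) refl x y)))))))

  -- A similarity from the standard polygon: `v 0` is its translation part, the complex number `g`
  -- its rotation and scale.
  record PolygonModel (v : ℕ → Point) : Set where
    field
      c s  : Carrier
      unit : c * c + s * s ≈ 1#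
    open UnitPowers c s unit public
    field
      g         : Point
      g-nonzero : Nonzero g
      model     : ∀ i → v i ⊖ v 0 ≐ g ⊛ vertex i

  module RegularPolygon {m : ℕ} {v : ℕ → Point} (regular : IsRegularPolygon m v) where
    open IsRegularPolygon regular

    side : ℕ → Point
    side i = v (1 ℕ.+ i) ⊖ v i

    d α : Carrier
    d = proj₁ equilateral
    α = proj₁ equiangular

    opaque
      side-length : ∀ i → dot (side i) (side i) ≈ d * d
      side-length i = sym (proj₂ (proj₂ equilateral i))

      orient≈cross : ∀ a b c → orient a b c ≈ cross (b ⊖ a) (c ⊖ b)
      orient≈cross (a , a′) (b , b′) (c , c′) = solve 6 (λ a a′ b b′ c c′ →
        (b :- a) :* (c′ :- a′) :- (b′ :- a′) :* (c :- a) := (b :- a) :* (c′ :- b′) :- (b′ :- a′) :* (c :- b)) refl a a′ b b′ c c′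

      turns-left : ∀ i → 0# < cross (side i) (side (1 ℕ.+ i))
      turns-left i = <-respʳ-≈ (orient≈cross _ _ _) (convex i 0 3≤m)

      -- The minus sign appears because the interior angle is formed with the first side reversed.
      -- The cosine is given separately at each vertex; injectivity of the arc cosine identifies
      -- these in `dot-constant`.
      side-dot : ∀ i → ∃[ x ] (dot (side i) (side (1 ℕ.+ i)) ≈ - (x * (d * d)) × IsArccos x α)
      side-dot i = from (proj₂ equiangular i)
        where
        flip-square : ∀ a b → dot (a ⊖ b) (a ⊖ b) ≈ dot (b ⊖ a) (b ⊖ a)
        flip-square (a , a′) (b , b′) = solve 4 (λ a a′ b b′ → (a :- b) :* (a :- b) :+ (a′ :- b′) :* (a′ :- b′) :=
          (b :- a) :* (b :- a) :+ (b′ :- a′) :* (b′ :- a′)) refl a a′ b b′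
        flip-dot : ∀ a b w → dot (b ⊖ a) w ≈ - dot (a ⊖ b) w
        flip-dot (a , a′) (b , b′) (c , c′) = solve 6 (λ a a′ b b′ c c′ → (b :- a) :* c :+ (b′ :- a′) :* c′ :=
          :- ((a :- b) :* c :+ (a′ :- b′) :* c′)) refl a a′ b b′ c c′
        0≤d : 0# ≤ d
        0≤d = proj₁ (proj₂ equilateral 0)
        from : IsAngle (v i) (v (1 ℕ.+ i)) (v (2 ℕ.+ i)) α →
               ∃[ x ] (dot (side i) (side (1 ℕ.+ i)) ≈ - (x * (d * d)) × IsArccos x α)
        from (x , r , s , (0≤r , rr) , (0≤s , ss) , xrs , is) = x ,
          trans (flip-dot (v i) (v (1 ℕ.+ i)) (side (1 ℕ.+ i))) (-‿cong (trans (sym xrs) (*-congˡ (*-cong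
            (sq-cancel-≈ 0≤r 0≤d (trans rr (trans (flip-square (v i) (v (1 ℕ.+ i))) (side-length i))))
            (sq-cancel-≈ 0≤s 0≤d (trans ss (side-length (1 ℕ.+ i)))))))) , is

      dot-constant : ∀ i → dot (side i) (side (1 ℕ.+ i)) ≈ dot (side 0) (side 1)
      dot-constant i = from (side-dot i) (side-dot 0)
        where
        from : ∃[ x ] (dot (side i) (side (1 ℕ.+ i)) ≈ - (x * (d * d)) × IsArccos x α) →
               ∃[ x ] (dot (side 0) (side 1) ≈ - (x * (d * d)) × IsArccos x α) →
               dot (side i) (side (1 ℕ.+ i)) ≈ dot (side 0) (side 1)
        from (x , e , is) (x′ , e′ , is′) = trans e (trans (-‿cong (*-congʳ (arccos-injective refl is is′))) (sym e′))

      -- Lagrange's identity fixes the square, convexity the sign.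
      cross-constant : ∀ i → cross (side i) (side (1 ℕ.+ i)) ≈ cross (side 0) (side 1)
      cross-constant i = sq-cancel-≈ (inj₁ (turns-left i)) (inj₁ (turns-left 0))
        (trans (square i) (trans (+-congˡ (-‿cong (*-cong (dot-constant i) (dot-constant i)))) (sym (square 0))))
        where
        square : ∀ i → cross (side i) (side (1 ℕ.+ i)) * cross (side i) (side (1 ℕ.+ i)) ≈
                 (d * d) * (d * d) - dot (side i) (side (1 ℕ.+ i)) * dot (side i) (side (1 ℕ.+ i))
        square i = trans (solve 2 (λ p q → q := (p :+ q) :- p) refl _ _)
          (+-congʳ (trans (sym (lagrange (side i) (side (1 ℕ.+ i)))) (*-cong (side-length i) (side-length (1 ℕ.+ i)))))

      side-nonzero : Nonzero (side 0)
      side-nonzero (p , q) = >⇒≉ (turns-left 0) (trans (+-cong (*-congʳ p) (-‿cong (*-congʳ q)))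
        (solve 2 (λ a b → con (+ 0) :* a :- con (+ 0) :* b := con (+ 0)) refl _ _))

      0<dd : 0# < d * d
      0<dd = <-respʳ-≈ (side-length 0) (dot-pos side-nonzero)

      -- The quotient of consecutive sides is (dot + √-1 · cross) / d², whose ingredients do not
      -- depend on i.
      rotation : ∃[ ρ ] (proj₁ ρ * proj₁ ρ + proj₂ ρ * proj₂ ρ ≈ 1# × 0# < proj₂ ρ × ∀ i → side (1 ℕ.+ i) ≐ ρ ⊛ side i)
      rotation = from (pos-inverse 0<dd)
        where
        D X : Carrier
        D = dot (side 0) (side 1)
        X = cross (side 0) (side 1)
        DD+XX : D * D + X * X ≈ (d * d) * (d * d)
        DD+XX = trans (sym (lagrange (side 0) (side 1))) (*-cong (side-length 0) (side-length 1))
        from : ∃[ k ] (0# < k × (d * d) * k ≈ 1#) →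
               ∃[ ρ ] (proj₁ ρ * proj₁ ρ + proj₂ ρ * proj₂ ρ ≈ 1# × 0# < proj₂ ρ × ∀ i → side (1 ℕ.+ i) ≐ ρ ⊛ side i)
        from (k , 0<k , ddk≈1) = k · (D , X) ,
          trans (solve 3 (λ k D X → (k :* D) :* (k :* D) :+ (k :* X) :* (k :* X) := (k :* k) :* (D :* D :+ X :* X)) refl k D X)
            (trans (*-congˡ DD+XX) (trans (solve 2 (λ k e → (k :* k) :* (e :* e) := (e :* k) :* (e :* k)) refl k (d * d))
            (trans (*-cong ddk≈1 ddk≈1) (*-identityˡ 1#)))) ,
          *-pos 0<k (turns-left 0) ,
          λ i → ·-cancel (>⇒≉ 0<dd) (≐-trans (·-cong (sym (side-length i)) ≐-refl)
            (≐-trans (rotate-by (side i) (side (1 ℕ.+ i)))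
            (≐-trans (⊛-cong (dot-constant i , cross-constant i) ≐-refl) (unscale (side i)))))
          where
          unscale : ∀ e → (D , X) ⊛ e ≐ (d * d) · ((k · (D , X)) ⊛ e)
          unscale e = ≐-trans (⊛-cong (undo D , undo X) ≐-refl)
            (≐-trans (⊛-comm _ e) (≐-trans (⊛-· (d * d) e _) (·-cong refl (⊛-comm e _))))
            where
            undo : ∀ y → y ≈ (d * d) * (k * y)
            undo y = sym (trans (sym (*-assoc _ _ _)) (trans (*-congʳ ddk≈1) (*-identityˡ y)))

    polygon-model : PolygonModel v
    polygon-model = choose-ζ rotation
      where
      choose-ζ : ∃[ ρ ] (proj₁ ρ * proj₁ ρ + proj₂ ρ * proj₂ ρ ≈ 1# × 0# < proj₂ ρ × ∀ i → side (1 ℕ.+ i) ≐ ρ ⊛ side i) →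
                 PolygonModel v
      choose-ζ (ρ , ρ-unit , 0<ρ₂ , rotate) = choose-g (half-angle ρ-unit 0<ρ₂)
        where
        choose-g : ∃[ c ] ∃[ s ] (c * c + s * s ≈ 1# × ¬ (s ≈ 0#) × ρ ≐ (c , s) ⊛ (c , s)) → PolygonModel v
        choose-g (c , s , unit , s≉0 , ρ≐ζζ) = build (inverse s s≉0)
          where
          open UnitPowers c s unit
          ζ : Point
          ζ = c , s
          first-side : vertex 1 ⊖ vertex 0 ≐ s · ζ
          first-side = ≐-trans (vertex-difference 0 1) (·-cong Im-1 (≐-trans (⊛-cong (≐-refl {pow 0}) (Re-1 , Im-1))
            (solve 2 (λ c s → con (+ 1) :* c :- con (+ 0) :* s := c) refl c s ,
             solve 2 (λ c s → con (+ 1) :* s :+ con (+ 0) :* c := s) refl c s)))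
          interchange : ∀ a b → (ζ ⊛ a) ⊛ (ζ ⊛ b) ≐ (ζ ⊛ ζ) ⊛ (a ⊛ b)
          interchange a b = ≐-trans (⊛-assoc ζ a (ζ ⊛ b)) (≐-trans (⊛-cong (≐-refl {ζ})
            (≐-trans (≐-sym (⊛-assoc a ζ b)) (≐-trans (⊛-cong (⊛-comm a ζ) (≐-refl {b})) (⊛-assoc ζ a b))))
            (≐-sym (⊛-assoc ζ ζ (a ⊛ b))))
          pow-suc : ∀ i → pow (suc i) ≐ ζ ⊛ pow i
          pow-suc i = refl , +-comm _ _
          vertex-step : ∀ i → vertex (2 ℕ.+ i) ⊖ vertex (1 ℕ.+ i) ≐ ρ ⊛ (vertex (1 ℕ.+ i) ⊖ vertex i)
          vertex-step i = ≐-trans (vertex-difference (1 ℕ.+ i) 1) (≐-trans (·-cong refl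
              (≐-trans (⊛-cong (pow-suc i) (pow-suc (1 ℕ.+ i))) (interchange (pow i) (pow (1 ℕ.+ i)))))
            (≐-trans (≐-sym (⊛-· (Im 1) (ζ ⊛ ζ) (pow i ⊛ pow (1 ℕ.+ i))))
              (⊛-cong (≐-sym ρ≐ζζ) (≐-sym (vertex-difference i 1)))))
          build : ∃[ t ] (s * t ≈ 1#) → PolygonModel v
          build (t , st≈1) = record { c = c ; s = s ; unit = unit ; g = g ; g-nonzero = g-nonzero ; model = model }
            where
            g : Point
            -- The first side of the standard polygon is s ζ, so g is `side 0` divided by it: t
            -- inverts s, and the conjugate inverts the unit ζ.
            g = t · ((c , - s) ⊛ side 0)
            recover : ∀ a b → (t · ((c , - s) ⊛ (a , b))) ⊛ (s · ζ) ≐ (a , b)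
            recover a b =
              trans (solve 5 (λ c s t a b → (t :* (c :* a :- :- s :* b)) :* (s :* c) :- (t :* (c :* b :+ :- s :* a)) :* (s :* s) :=
                (s :* t) :* ((c :* c :+ s :* s) :* a)) refl c s t a b) (cancel a) ,
              trans (solve 5 (λ c s t a b → (t :* (c :* a :- :- s :* b)) :* (s :* s) :+ (t :* (c :* b :+ :- s :* a)) :* (s :* c) :=
                (s :* t) :* ((c :* c :+ s :* s) :* b)) refl c s t a b) (cancel b)
              where
              cancel : ∀ y → (s * t) * ((c * c + s * s) * y) ≈ y
              cancel y = trans (*-cong st≈1 (trans (*-congʳ unit) (*-identityˡ y))) (*-identityˡ y)
            -- Each step multiplies the sides of both polygons by ρ = ζ², so agreement of the first
            -- sides propagates.
            side-model : ∀ i → side i ≐ g ⊛ (vertex (1 ℕ.+ i) ⊖ vertex i)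
            side-model zero = ≐-sym (≐-trans (⊛-cong (≐-refl {g}) first-side) (recover _ _))
            side-model (suc i) = ≐-trans (rotate i) (≐-trans (⊛-cong (≐-refl {ρ}) (side-model i))
              (≐-trans (swap ρ g _) (⊛-cong (≐-refl {g}) (≐-sym (vertex-step i)))))
              where
              swap : ∀ a b c → a ⊛ (b ⊛ c) ≐ b ⊛ (a ⊛ c)
              swap a b c = ≐-trans (≐-sym (⊛-assoc a b c)) (≐-trans (⊛-cong (⊛-comm a b) (≐-refl {c})) (⊛-assoc b a c))
            telescope : ∀ a b c → c ⊖ a ≐ (c ⊖ b) ⊕ (b ⊖ a)
            telescope _ _ _ = solve 3 (λ a b c → c :- a := (c :- b) :+ (b :- a)) refl _ _ _ ,
                              solve 3 (λ a b c → c :- a := (c :- b) :+ (b :- a)) refl _ _ _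
            ⊛-telescope : ∀ a b c → a ⊛ (c ⊖ b) ⊕ a ⊛ b ≐ a ⊛ c
            ⊛-telescope (a , a′) (b , b′) (c , c′) =
              solve 6 (λ a a′ b b′ c c′ → (a :* (c :- b) :- a′ :* (c′ :- b′)) :+ (a :* b :- a′ :* b′) := a :* c :- a′ :* c′) refl a a′ b b′ c c′ ,
              solve 6 (λ a a′ b b′ c c′ → (a :* (c′ :- b′) :+ a′ :* (c :- b)) :+ (a :* b′ :+ a′ :* b) := a :* c′ :+ a′ :* c) refl a a′ b b′ c c′
            model : ∀ i → v i ⊖ v 0 ≐ g ⊛ vertex i
            model zero =
              solve 3 (λ x a b → x :- x := a :* (con (+ 0) :* con (+ 1)) :- b :* (con (+ 0) :* con (+ 0))) refl _ (proj₁ g) (proj₂ g) ,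
              solve 3 (λ x a b → x :- x := a :* (con (+ 0) :* con (+ 0)) :+ b :* (con (+ 0) :* con (+ 1))) refl _ (proj₁ g) (proj₂ g)
            model (suc i) = ≐-trans (telescope (v 0) (v i) (v (suc i)))
              (≐-trans (⊕-cong (side-model i) (model i)) (⊛-telescope g (vertex i) (vertex (suc i))))
            g-nonzero : Nonzero g
            g-nonzero g≐0 = side-nonzero (≐-trans (side-model 0) (≐-trans (⊛-cong g≐0 ≐-refl)
              (solve 2 (λ a b → con (+ 0) :* a :- con (+ 0) :* b := con (+ 0)) refl _ _ ,
               solve 2 (λ a b → con (+ 0) :* b :+ con (+ 0) :* a := con (+ 0)) refl _ _)))

  -- Upper bound

  -- This is how the k additional points, which `𝓛` does not name, become indexed by `Fin k`: of the
  -- m + k indices, an injection assigns m to the projected polygon.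
  missed : ∀ m {k} (f : Fin m → Fin (m ℕ.+ k)) → (∀ {a b} → f a ≡ f b → a ≡ b) →
           Σ (Fin k → Fin (m ℕ.+ k)) λ g → ∀ x → (∃[ a ] x ≡ f a) ⊎ (∃[ e ] x ≡ g e)
  missed zero    {k} f f-injective = (λ e → e) , λ x → inj₂ (x , ≡.refl)
  missed (suc m) {k} f f-injective = (λ e → Fin.punchIn (f zero) (proj₁ rest e)) , split
    where
    f0≢ : ∀ a → f zero ≢ f (suc a)
    f0≢ a eq with () ← f-injective eq
    rest : Σ (Fin k → Fin (m ℕ.+ k)) λ g → ∀ x → (∃[ a ] x ≡ Fin.punchOut (f0≢ a)) ⊎ (∃[ e ] x ≡ g e)
    rest = missed m (λ a → Fin.punchOut (f0≢ a)) λ {a} {b} eq →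
      Fin.suc-injective (f-injective (Fin.punchOut-injective (f0≢ a) (f0≢ b) eq))
    split : ∀ x → (∃[ a ] x ≡ f a) ⊎ (∃[ e ] x ≡ Fin.punchIn (f zero) (proj₁ rest e))
    split x with f zero Fin.≟ x
    ... | yes f0≡x = inj₁ (zero , ≡.sym f0≡x)
    ... | no  f0≢x with proj₂ rest (Fin.punchOut f0≢x)
    ...   | inj₁ (a , eq) = inj₁ (suc a , Fin.punchOut-injective f0≢x (f0≢ a) eq)
    ...   | inj₂ (e , eq) = inj₂ (e , ≡.trans (≡.sym (Fin.punchIn-punchOut f0≢x)) (≡.cong (Fin.punchIn (f zero)) eq))

  opaque
    ∈ₗ-resp-≐ : ∀ {a b} ℓ → a ≐ b → a ∈ₗ ℓ → b ∈ₗ ℓ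
    ∈ₗ-resp-≐ ℓ a≐b a∈ℓ = trans (cross-cong ≐-refl (⊖-cong (≐-sym a≐b) ≐-refl)) a∈ℓ

    cosine-resp-≈ : ∀ {u w x y} → x ≈ y → CosineOf u w x → CosineOf u w y
    cosine-resp-≈ x≈y (r , s , 0<r , 0<s , rr , ss , xrs) = r , s , 0<r , 0<s , rr , ss , trans (*-congʳ (sym x≈y)) xrs

    cosine-scale : ∀ {u w x s t} → ¬ (s ≈ 0#) → ¬ (t ≈ 0#) → CosineOf u w x → ∃[ σ ] CosineOf (s · u) (t · w) (signed σ x)
    cosine-scale {u} {w} {x} {s} {t} s≉0 t≉0 cos = left (cosine-scaleˡ s≉0 cos)
      where
      left : ∃[ σ ] CosineOf (s · u) w (signed σ x) → ∃[ σ ] CosineOf (s · u) (t · w) (signed σ x)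
      left (σ , cos′) = right σ (cosine-scaleˡ t≉0 (cosine-sym cos′))
        where
        right : ∀ σ → ∃[ τ ] CosineOf (t · w) (s · u) (signed τ (signed σ x)) → ∃[ σ ] CosineOf (s · u) (t · w) (signed σ x)
        right σ     (true  , cos″) = σ , cosine-sym cos″
        right true  (false , cos″) = false , cosine-sym cos″
        right false (false , cos″) = true , cosine-resp-≈ (solve 1 (λ x → :- :- x := x) refl x) (cosine-sym cos″)

    cosine-self : ∀ {u} → Nonzero u → CosineOf u u 1#
    cosine-self {u} u≉0 = let r , 0<r , rr = norm-exists u≉0 in
      r , r , 0<r , 0<r , rr , rr , trans (*-identityˡ _) rr

    -- 0 when u or w vanishes.
    cosine : Point → Point → Carrier
    cosine u w with em {∃ (CosineOf u w)}
    ... | yes (x , _) = x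
    ... | no  _       = 0#

    cosine-correct : ∀ {u w x} → CosineOf u w x → x ≈ cosine u w
    cosine-correct {u} {w} cos with em {∃ (CosineOf u w)}
    ... | yes (_ , cos′) = cosine-unique cos cos′
    ... | no  ¬cos       = ⊥-elim (¬cos (_ , cos))

  -- The Boolean is the sign of the cosine. Exponent differences stay below m, but are coded in
  -- `Fin n` so that the count depends on n and k alone.
  Code : ℕ → ℕ → Set
  Code n k = Bool × (Fin n ⊎ (Fin n ⊎ ((Fin k × Fin n) ⊎ Fin 1)))

  codes : ℕ → ℕ → ℕ
  codes n k = 2 ℕ.* (n ℕ.+ (n ℕ.+ (k ℕ.* n ℕ.+ 1)))

  code↔ : ∀ {n k} → Fin (codes n k) ↔ Code n k
  code↔ = ↔-trans Fin.*↔× (Fin.2↔Bool ×-↔ ↔-trans Fin.+↔⊎ (↔-refl ⊎-↔ ↔-trans Fin.+↔⊎ (↔-refl ⊎-↔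
            ↔-trans Fin.+↔⊎ (Fin.*↔× ⊎-↔ ↔-refl))))

  -- The angles of a configuration, by the kind of their vertex and legs: at a point of ℓ between p and ℓ itself; at p between
  -- two projected vertices; at p with an additional point on one leg; and the degenerate angles between points of ℓ.
  module UpperBound {k m : ℕ} {P : Fin (m ℕ.+ k) → Point} (P-distinct : Distinct P) (C : ProjectedPolygon m)
                    (contains : ∀ x → x ∈ₚ C → ∃[ j ] (P j ≐ x))
                    (classify : ∀ j → (P j ∈ₚ C) ⊎ (P j ∈ₗ ProjectedPolygon.ℓ C))
                    (polygon-model : PolygonModel (ProjectedPolygon.v C)) where
    open ProjectedPolygon C
    open PolygonModel polygon-model

    n : ℕ
    n = m ℕ.+ k

    p d : Point
    p = v 0
    d = Line.direction ℓ

    pole-or-line : ∀ j → P j ≐ p ⊎ P j ∈ₗ ℓ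
    pole-or-line j with classify j
    ... | inj₁ (inj₁ Pj≐p) = inj₁ Pj≐p
    ... | inj₁ (inj₂ (i , 0<i , i<m , Pj≐image)) = inj₂ (∈ₗ-resp-≐ ℓ (≐-sym Pj≐image) (proj₂ (image-∈ i 0<i i<m)))
    ... | inj₂ Pj∈ℓ = inj₂ Pj∈ℓ

    direction : ℕ → Point
    direction i = g ⊛ pow i

    -- A zero would place vertex i at p, and the line through p and vertex i used for projecting
    -- presupposes that they differ.
    Im≉0 : ∀ i → 0 ℕ.< i → i ℕ.< m → ¬ (Im i ≈ 0#)
    Im≉0 i 0<i i<m Im≈0 = proj₁ (proj₁ (image-∈ i 0<i i<m)) (≐-sym (≈-by (trans (proj₁ vᵢ-p) (proj₁ vanishes)) ,
                                                            ≈-by (trans (proj₂ vᵢ-p) (proj₂ vanishes))))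
      where
      vᵢ-p : v i ⊖ v 0 ≐ g ⊛ vertex i
      vᵢ-p = model i
      vanishes : g ⊛ vertex i ≐ (0# , 0#)
      vanishes = ≐-trans (⊛-· (Im i) g (pow i)) (trans (*-congʳ Im≈0) (zeroˡ _) , trans (*-congʳ Im≈0) (zeroˡ _))

    image-multiple : ∀ i → 0 ℕ.< i → i ℕ.< m → ∃[ μ ] (image i ⊖ p ≐ μ · direction i)
    image-multiple i 0<i i<m = from (parallel⇒multiple (⊖-nonzero (λ vᵢ≐p → p≢vᵢ (≐-sym vᵢ≐p))) collinear)
      where
      p≢vᵢ : ¬ (v 0 ≐ v i)
      p≢vᵢ = proj₁ (proj₁ (image-∈ i 0<i i<m))
      collinear : cross (v i ⊖ p) (image i ⊖ p) ≈ 0#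
      collinear = proj₂ (proj₁ (image-∈ i 0<i i<m))
      from : ∃[ t ] (image i ⊖ p ≐ t · (v i ⊖ p)) → ∃[ μ ] (image i ⊖ p ≐ μ · direction i)
      from (t , e) = t * Im i , ≐-trans e (≐-trans (·-cong refl (≐-trans (model i) (⊛-· (Im i) g (pow i))))
        (sym (*-assoc _ _ _) , sym (*-assoc _ _ _)))

    value : (Fin k → Fin n) → Code n k → Carrier
    value extra (σ , code) = signed σ (base code)
      where
      base : Fin n ⊎ (Fin n ⊎ ((Fin k × Fin n) ⊎ Fin 1)) → Carrier
      base (inj₁ j)                      = cosine (p ⊖ P j) d
      base (inj₂ (inj₁ δ))               = Re (Fin.toℕ δ)
      base (inj₂ (inj₂ (inj₁ (e , j))))  = cosine (P (extra e) ⊖ p) (P j ⊖ p)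
      -- With the sign this covers the cosines 1 and -1 of the angles 0 and π; coding them is
      -- simpler than excluding them.
      base (inj₂ (inj₂ (inj₂ _)))        = 1#

    signed-cong : ∀ σ {x y} → x ≈ y → signed σ x ≈ signed σ y
    signed-cong true  x≈y = x≈y
    signed-cong false x≈y = -‿cong x≈y

    opaque
      cosine-of-scaled : ∀ {u w u′ w′ x y s t} → u ≐ s · u′ → w ≐ t · w′ → ¬ (s ≈ 0#) → ¬ (t ≈ 0#) →
                         CosineOf u w x → CosineOf u′ w′ y → ∃[ σ ] (x ≈ signed σ y)
      cosine-of-scaled u≐ w≐ s≉0 t≉0 cos cos′ = let σ , cos″ = cosine-scale s≉0 t≉0 cos′ in
        σ , cosine-unique (cosine-resp-≐ u≐ w≐ cos) cos″

      -- A leg inside `ℓ` is a multiple of d, so only its sign matters: if the other leg goes to p,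
      -- the vertex j and a sign fix the cosine; if not, the cosine is 1 or -1.
      line-vertex : ∀ extra {i j l x} → i ≢ j → j ≢ l → i ≢ l → P j ∈ₗ ℓ → CosineOf (P i ⊖ P j) (P l ⊖ P j) x →
                    ∃[ c ] (x ≈ value extra c)
      line-vertex extra {i} {j} {l} {x} i≢j j≢l i≢l Pj∈ℓ cos = split (pole-or-line i) (pole-or-line l)
        where
        i-leg : Nonzero (P i ⊖ P j)
        i-leg = ⊖-nonzero (λ e → i≢j (P-distinct i j e))
        l-leg : Nonzero (P l ⊖ P j)
        l-leg = ⊖-nonzero (λ e → j≢l (≡.sym (P-distinct l j e)))
        to-pole : ∀ {w x} → P w ≐ p → Nonzero (P w ⊖ P j) → ∀ {w′} → P w′ ∈ₗ ℓ → Nonzero (P w′ ⊖ P j) →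
                  CosineOf (P w ⊖ P j) (P w′ ⊖ P j) x → ∃[ c ] (x ≈ value extra c)
        to-pole {w} {x} Pw≐p leg {w′} Pw′∈ℓ leg′ cos = from (line-difference ℓ Pw′∈ℓ Pj∈ℓ)
          where
          p-leg : P w ⊖ P j ≐ p ⊖ P j
          p-leg = ⊖-cong Pw≐p ≐-refl
          from : ∃[ t ] (P w′ ⊖ P j ≐ t · d) → ∃[ c ] (x ≈ value extra c)
          from (t , e) = sign (cosine-exists (λ z → leg (≐-trans p-leg z)) (Line.nonzero ℓ))
            where
            sign : ∃ (CosineOf (p ⊖ P j) d) → ∃[ c ] (x ≈ value extra c)
            sign (y , cos′) = let σ , x≈ = cosine-of-scaled (≐-trans p-leg (sym (*-identityˡ _) , sym (*-identityˡ _))) e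
                                             (>⇒≉ 0<1) (multiple-nonzero leg′ e) cos cos′ in
              (σ , inj₁ j) , trans x≈ (signed-cong σ (cosine-correct cos′))
        split : P i ≐ p ⊎ P i ∈ₗ ℓ → P l ≐ p ⊎ P l ∈ₗ ℓ → ∃[ c ] (x ≈ value extra c)
        split (inj₁ Pi≐p) (inj₁ Pl≐p) = ⊥-elim (i≢l (P-distinct i l (≐-trans Pi≐p (≐-sym Pl≐p))))
        split (inj₁ Pi≐p) (inj₂ Pl∈ℓ) = to-pole Pi≐p i-leg Pl∈ℓ l-leg cos
        split (inj₂ Pi∈ℓ) (inj₁ Pl≐p) = to-pole Pl≐p l-leg Pi∈ℓ i-leg (cosine-sym cos)
        split (inj₂ Pi∈ℓ) (inj₂ Pl∈ℓ) =
          let s , i-e = line-difference ℓ Pi∈ℓ Pj∈ℓ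
              t , l-e = line-difference ℓ Pl∈ℓ Pj∈ℓ
              σ , x≈ = cosine-of-scaled i-e l-e (multiple-nonzero i-leg i-e) (multiple-nonzero l-leg l-e) cos
                         (cosine-self (Line.nonzero ℓ))
          in (σ , inj₂ (inj₂ (inj₂ zero))) , x≈

    Coded : (Fin k → Fin n) → Set
    Coded extra = ∀ {i j l x} → i ≢ j → j ≢ l → i ≢ l → CosineOf (P i ⊖ P j) (P l ⊖ P j) x → ∃[ c ] (x ≈ value extra c)

    module PoleOffLine (p∉ℓ : ¬ (p ∈ₗ ℓ)) where

      p≢image : ∀ i → 0 ℕ.< i → i ℕ.< m → ¬ (image i ≐ p)
      p≢image i 0<i i<m image≐p = p∉ℓ (∈ₗ-resp-≐ ℓ image≐p (proj₂ (image-∈ i 0<i i<m)))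

      image-leg : ∀ i → 0 ℕ.< i → i ℕ.< m → ∃[ μ ] (¬ (μ ≈ 0#) × image i ⊖ p ≐ μ · direction i)
      image-leg i 0<i i<m = let μ , e = image-multiple i 0<i i<m in
        μ , multiple-nonzero (⊖-nonzero (p≢image i 0<i i<m)) e , e

      point : ℕ → Point
      point zero    = p
      point (suc i) = image (suc i)

      point-∈ : ∀ i → i ℕ.< m → point i ∈ₚ C
      point-∈ zero    _   = inj₁ ≐-refl
      point-∈ (suc i) i<m = inj₂ (suc i , ℕ.z<s , i<m , ≐-refl)

      opaque
        -- The cross product of the two legs at p is a nonzero multiple of |g|² Im ζᵟ; for equal
        -- images it would vanish.
        image-≢ : ∀ i δ → 0 ℕ.< i → 0 ℕ.< δ → δ ℕ.+ i ℕ.< m → ¬ (image i ≐ image (δ ℕ.+ i))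
        image-≢ i δ 0<i 0<δ δ+i<m same = compare-legs (image-leg i 0<i (ℕ.≤-<-trans (ℕ.m≤n+m i δ) δ+i<m))
                                             (image-leg (δ ℕ.+ i) (ℕ.<-≤-trans 0<i (ℕ.m≤n+m i δ)) δ+i<m)
          where
          cross-self : ∀ w → cross w w ≈ 0#
          cross-self (a , b) = solve 2 (λ a b → a :* b :- b :* a := con (+ 0)) refl a b
          compare-legs : ∃[ μ ] (¬ (μ ≈ 0#) × image i ⊖ p ≐ μ · direction i) →
                         ∃[ μ ] (¬ (μ ≈ 0#) × image (δ ℕ.+ i) ⊖ p ≐ μ · direction (δ ℕ.+ i)) → ⊥
          compare-legs (μ , μ≉0 , e) (ν , ν≉0 , e′) =
            *-≉0 (*-≉0 μ≉0 ν≉0) (*-≉0 (>⇒≉ (dot-pos g-nonzero)) (Im≉0 δ 0<δ (ℕ.≤-<-trans (ℕ.m≤m+n δ i) δ+i<m)))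
              (trans (*-congˡ (trans (*-congˡ (sym (cross-pow i δ))) (sym (cross-⊛ g (pow i) (pow (δ ℕ.+ i))))))
              (trans (sym (cross-·· μ ν (direction i) (direction (δ ℕ.+ i))))
              (trans (sym (cross-cong e (≐-trans (⊖-cong same ≐-refl) e′))) (cross-self (image i ⊖ p)))))

        point-≢ : ∀ i δ → 0 ℕ.< δ → δ ℕ.+ i ℕ.< m → ¬ (point i ≐ point (δ ℕ.+ i))
        point-≢ zero    (suc δ) 0<δ δ+i<m same = p≢image (suc δ ℕ.+ 0) ℕ.z<s δ+i<m (≐-sym same)
        point-≢ (suc i) (suc δ) 0<δ δ+i<m same = image-≢ (suc i) (suc δ) ℕ.z<s 0<δ δ+i<m same

      index : Fin m → Fin n
      index a = proj₁ (contains (point (Fin.toℕ a)) (point-∈ (Fin.toℕ a) (Fin.toℕ<n a)))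

      index-point : ∀ a → P (index a) ≐ point (Fin.toℕ a)
      index-point a = proj₂ (contains (point (Fin.toℕ a)) (point-∈ (Fin.toℕ a) (Fin.toℕ<n a)))

      point-injective : ∀ i j → i ℕ.< m → j ℕ.< m → point i ≐ point j → i ≡ j
      point-injective i j i<m j<m same with ℕ.<-cmp i j
      ... | tri≈ _ i≡j _ = i≡j
      ... | tri< i<j _ _ = ⊥-elim (point-≢ i (j ℕ.∸ i) (ℕ.m<n⇒0<n∸m i<j)
              (≡.subst (ℕ._< m) (≡.sym (ℕ.m∸n+n≡m (ℕ.<⇒≤ i<j))) j<m)
              (≡.subst (λ h → point i ≐ point h) (≡.sym (ℕ.m∸n+n≡m (ℕ.<⇒≤ i<j))) same))
      ... | tri> _ _ j<i = ⊥-elim (point-≢ j (i ℕ.∸ j) (ℕ.m<n⇒0<n∸m j<i)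
              (≡.subst (ℕ._< m) (≡.sym (ℕ.m∸n+n≡m (ℕ.<⇒≤ j<i))) i<m)
              (≡.subst (λ h → point j ≐ point h) (≡.sym (ℕ.m∸n+n≡m (ℕ.<⇒≤ j<i))) (≐-sym same)))

      index-injective : ∀ {a b} → index a ≡ index b → a ≡ b
      index-injective {a} {b} eq = Fin.toℕ-injective (point-injective _ _ (Fin.toℕ<n a) (Fin.toℕ<n b)
        (≐-trans (≐-sym (index-point a)) (≡.subst (λ h → P h ≐ point (Fin.toℕ b)) (≡.sym eq) (index-point b))))

      extra : Fin k → Fin n
      extra = proj₁ (missed m index index-injective)

      image-pair : ∀ i j → 0 ℕ.< i → i ℕ.≤ j → j ℕ.< m → ∀ {x} → CosineOf (image i ⊖ p) (image j ⊖ p) x →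
                   ∃[ c ] (x ≈ value extra c)
      image-pair i j 0<i i≤j j<m {x} cos = from (image-leg i 0<i (ℕ.≤-<-trans i≤j j<m))
                                                (image-leg j (ℕ.<-≤-trans 0<i i≤j) j<m)
        where
        δ : ℕ
        δ = j ℕ.∸ i
        δ<n : δ ℕ.< n
        δ<n = ℕ.<-≤-trans (ℕ.≤-<-trans (ℕ.m∸n≤m j i) j<m) (ℕ.m≤m+n m k)
        from : ∃[ μ ] (¬ (μ ≈ 0#) × image i ⊖ p ≐ μ · direction i) →
               ∃[ μ ] (¬ (μ ≈ 0#) × image j ⊖ p ≐ μ · direction j) → ∃[ c ] (x ≈ value extra c)
        from (μ , μ≉0 , e) (ν , ν≉0 , e′) =
          let σ , x≈ = cosine-of-scaled e e′ μ≉0 ν≉0 cos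
                         (≡.subst (λ h → CosineOf (direction i) (direction h) (Re δ)) (ℕ.m∸n+n≡m i≤j) (cosine-pow g g-nonzero i δ))
          in (σ , inj₂ (inj₁ (Fin.fromℕ< δ<n))) ,
             trans x≈ (signed-cong σ (reflexive (≡.cong Re (≡.sym (Fin.toℕ-fromℕ< δ<n)))))

      pole-vertex : ∀ {i j l x} → i ≢ j → j ≢ l → i ≢ l → P j ≐ p → CosineOf (P i ⊖ P j) (P l ⊖ P j) x →
                    ∃[ c ] (x ≈ value extra c)
      pole-vertex {i} {j} {l} {x} i≢j j≢l i≢l Pj≐p cos =
        split (proj₂ (missed m index index-injective) i) (proj₂ (missed m index index-injective) l)
        where
        cos-p : CosineOf (P i ⊖ p) (P l ⊖ p) x
        cos-p = cosine-resp-≐ (⊖-cong ≐-refl Pj≐p) (⊖-cong ≐-refl Pj≐p) cos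
        off-pole : ∀ {i} h → P i ≐ point h → i ≢ j → 0 ℕ.< h × P i ≐ image h
        off-pole {i} zero    Pi≐p i≢j = ⊥-elim (i≢j (P-distinct i j (≐-trans Pi≐p (≐-sym Pj≐p))))
        off-pole     (suc h) Pi≐  _   = ℕ.z<s , Pi≐
        image-of : ∀ {i} a → i ≡ index a → i ≢ j → 0 ℕ.< Fin.toℕ a × P i ≐ image (Fin.toℕ a)
        image-of a ≡.refl = off-pole (Fin.toℕ a) (index-point a)
        split : (∃[ a ] i ≡ index a) ⊎ (∃[ e ] i ≡ extra e) → (∃[ b ] l ≡ index b) ⊎ (∃[ e ] l ≡ extra e) →
                ∃[ c ] (x ≈ value extra c)
        split (inj₂ (e , ≡.refl)) _ = (true , inj₂ (inj₂ (inj₁ (e , l)))) , cosine-correct cos-p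
        split (inj₁ _) (inj₂ (e , ≡.refl)) = (true , inj₂ (inj₂ (inj₁ (e , i)))) , cosine-correct (cosine-sym cos-p)
        split (inj₁ (a , i≡)) (inj₁ (b , l≡)) =
          let 0<a , Pi≐ = image-of a i≡ i≢j
              0<b , Pl≐ = image-of b l≡ (λ l≡j → j≢l (≡.sym l≡j))
              cos-image = cosine-resp-≐ (⊖-cong Pi≐ ≐-refl) (⊖-cong Pl≐ ≐-refl) cos-p
          in [ (λ a≤b → image-pair _ _ 0<a a≤b (Fin.toℕ<n b) cos-image) ,
               (λ b≤a → image-pair _ _ 0<b b≤a (Fin.toℕ<n a) (cosine-sym cos-image)) ]′ (ℕ.≤-total (Fin.toℕ a) (Fin.toℕ b))

      coded : Coded extra
      coded {i} {j} i≢j j≢l i≢l cos with pole-or-line j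
      ... | inj₁ Pj≐p = pole-vertex i≢j j≢l i≢l Pj≐p cos
      ... | inj₂ Pj∈ℓ = line-vertex extra i≢j j≢l i≢l Pj∈ℓ cos

    coded⇒covered : ∀ {extra} → Coded extra → Covered (DeterminedAngle P) (codes n k)
    coded⇒covered {extra} coded = (λ θ c → IsArccos (value extra (Inverse.to code↔ c)) θ) , code ,
                                   λ _ _ _ is is′ → arccos-unique refl is is′
      where
      code : ∀ θ → DeterminedAngle P θ → ∃[ c ] IsArccos (value extra (Inverse.to code↔ c)) θ
      code θ ((i , j , l , i≢j , j≢l , i≢l , angle) , _) =
        let x , cos , is = angle⇒cosine (λ e → i≢j (P-distinct i j e)) (λ e → j≢l (≡.sym (P-distinct l j e))) angle
            c , x≈ = coded i≢j j≢l i≢l cos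
        in Inverse.from code↔ c ,
           arccos-resp-≈ (trans x≈ (reflexive (≡.cong (value extra) (≡.sym (Inverse.strictlyInverseˡ code↔ c))))) is

    covered : Covered (DeterminedAngle P) (codes n k)
    covered with em {p ∈ₗ ℓ}
    ... | no  p∉ℓ = coded⇒covered (PoleOffLine.coded p∉ℓ)
    -- Here every angle has its vertex on `ℓ`, so `line-vertex` codes them all, whatever function
    -- stands for `extra`.
    ... | yes p∈ℓ = coded⇒covered {m Fin.↑ʳ_} λ {i} {j} i≢j j≢l i≢l cos → line-vertex _ i≢j j≢l i≢l
            ([ (λ Pj≐p → ∈ₗ-resp-≐ ℓ (≐-sym Pj≐p) p∈ℓ) , (λ Pj∈ℓ → Pj∈ℓ) ]′ (pole-or-line j)) cos

  𝓛-covered : ∀ {k n P} → 𝓛 k n P → Covered (DeterminedAngle P) (codes n k)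
  𝓛-covered (P-distinct , m , ≡.refl , C , contains , classify) =
    UpperBound.covered P-distinct C contains classify (RegularPolygon.polygon-model (ProjectedPolygon.regular C))

  -- Lower bound

  opaque
    -- Total, with value 0 at 0, so that `cot` below is a function of the index alone.
    reciprocal : Carrier → Carrier
    reciprocal x with em {x ≈ 0#}
    ... | yes _   = 0#
    ... | no  x≉0 = proj₁ (inverse x x≉0)

    *-reciprocal : ∀ {x} → ¬ (x ≈ 0#) → x * reciprocal x ≈ 1#
    *-reciprocal {x} x≉0 with em {x ≈ 0#}
    ... | yes x≈0  = ⊥-elim (x≉0 x≈0)
    ... | no  x≉0′ = proj₂ (inverse x x≉0′)

    reciprocal-pos : ∀ {x} → 0# < x → 0# < reciprocal x
    reciprocal-pos 0<x = *-cancel-pos 0<x (<-respʳ-≈ (sym (*-reciprocal (>⇒≉ 0<x))) 0<1)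

  parity : ∀ m → (∃[ h ] m ≡ 2 ℕ.* h) ⊎ (∃[ h ] m ≡ 1 ℕ.+ 2 ℕ.* h)
  parity zero = inj₁ (0 , ≡.refl)
  parity (suc m) with parity m
  ... | inj₁ (h , m≡2h)   = inj₂ (h , ≡.cong suc m≡2h)
  ... | inj₂ (h , m≡1+2h) = inj₁ (suc h , ≡.trans (≡.cong suc m≡1+2h) (≡.cong suc (≡.sym (ℕ.+-suc h (h ℕ.+ 0)))))

  -- The standard regular polygon and its projection

  module RootPolygon {m : ℕ} (3≤m : 3 ℕ.≤ m) {c s : Carrier} (root : IsHalfTurnRoot m c s) where
    open IsHalfTurnRoot root
    open UnitPowers c s unit

    opaque
      0<Im : ∀ i → 0 ℕ.< i → i ℕ.< m → 0# < Im i
      0<Im (suc i) _ i<m = Im-pos i i<m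

      0≤Im : ∀ i → i ℕ.≤ m → 0# ≤ Im i
      0≤Im zero    _   = ≤-refl
      0≤Im (suc i) i<m with ℕ.m≤n⇒m<n∨m≡n i<m
      ... | inj₁ 1+i<m  = inj₁ (Im-pos i 1+i<m)
      ... | inj₂ ≡.refl = inj₂ (sym Im-m≈0)

      0<Im₁ : 0# < Im 1
      0<Im₁ = 0<Im 1 ℕ.z<s (ℕ.≤-trans (ℕ.s≤s (ℕ.s≤s ℕ.z≤n)) 3≤m)

      vertex-0 : vertex 0 ≐ (0# , 0#)
      vertex-0 = zeroˡ _ , zeroˡ _

      square-Re-m : Re m * Re m ≈ 1#
      square-Re-m = trans (sym (trans (+-congˡ (trans (*-congˡ Im-m≈0) (zeroʳ _))) (+-identityʳ _))) (norm m)

      -- ζᵐ is real with square 1, and a vertex is quadratic in ζⁱ, so the sign cancels.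
      vertex-periodic : ∀ i → vertex (i ℕ.+ m) ≐ vertex i
      vertex-periodic i =
        trans (*-cong Im-shift Re-shift) (trans (solve 3 (λ x y z → (y :* z) :* (x :* z) := (y :* x) :* (z :* z)) refl (Re i) (Im i) (Re m)) (absorb _)) ,
        trans (*-cong Im-shift Im-shift) (trans (solve 2 (λ y z → (y :* z) :* (y :* z) := (y :* y) :* (z :* z)) refl (Im i) (Re m)) (absorb _))
        where
        absorb : ∀ y → y * (Re m * Re m) ≈ y
        absorb y = trans (*-congˡ square-Re-m) (*-identityʳ y)
        Im-shift : Im (i ℕ.+ m) ≈ Im i * Re m
        Im-shift = trans (Im-+ i m) (trans (+-congˡ (trans (*-congˡ Im-m≈0) (zeroʳ _))) (+-identityʳ _))
        Re-shift : Re (i ℕ.+ m) ≈ Re i * Re m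
        Re-shift = trans (Re-+ i m) (trans (+-congˡ (trans (-‿cong (trans (*-congˡ Im-m≈0) (zeroʳ _))) (solve 0 (:- con (+ 0) := con (+ 0)) refl))) (+-identityʳ _))

      side : ℕ → Point
      side i = pow i ⊛ pow (1 ℕ.+ i)

      side-difference : ∀ i → vertex (1 ℕ.+ i) ⊖ vertex i ≐ Im 1 · side i
      side-difference i = vertex-difference i 1

      side-difference′ : ∀ i → vertex i ⊖ vertex (1 ℕ.+ i) ≐ (- Im 1) · side i
      side-difference′ i = flip (proj₁ (side-difference i)) , flip (proj₂ (side-difference i))
        where
        flip : ∀ {a b t y} → a - b ≈ t * y → b - a ≈ - t * y
        flip {a} {b} {t} {y} e = trans (solve 2 (λ a b → b :- a := :- (a :- b)) refl a b)
          (trans (-‿cong e) (solve 2 (λ t y → :- (t :* y) := :- t :* y) refl t y))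

      dot-side-side : ∀ i → dot (side i) (side i) ≈ 1#
      dot-side-side i = trans (dot-⊛ (pow i) _ _) (trans (*-cong (norm i) (norm (1 ℕ.+ i))) (*-identityˡ 1#))

      dot-side-next : ∀ i → dot (side i) (side (1 ℕ.+ i)) ≈ Re 2
      dot-side-next i = trans (dot-cong (⊛-comm (pow i) (pow (1 ℕ.+ i))) ≐-refl) (trans (dot-⊛ (pow (1 ℕ.+ i)) (pow i) (pow (2 ℕ.+ i)))
        (trans (*-cong (norm (1 ℕ.+ i)) (dot-pow i 2)) (*-identityˡ _)))

      -- sin²(a + φ) − sin² φ = sin a · sin (a + 2φ)
      square-Im : ∀ i → Im (1 ℕ.+ i) * Im (1 ℕ.+ i) - Im 1 * Im 1 ≈ Im i * Im (2 ℕ.+ i)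
      square-Im i = trans (+-congˡ (-‿cong (*-cong Im-1 Im-1))) (≈-combine (s * s) (norm i) (solve 4 (λ c s x y →
        ((s :* x :+ c :* y) :* (s :* x :+ c :* y) :- s :* s) :- y :* (s :* (c :* x :- s :* y) :+ c :* (s :* x :+ c :* y)) :=
        (s :* s) :* ((x :* x :+ y :* y) :- con (+ 1))) refl c s (Re i) (Im i)))

      -- By `square-Im` the excess is a product of two nonnegative imaginary parts, one of which
      -- vanishes at the last vertex (`Im-last`). As Im ζⁱ is the distance of vertex i from vertex
      -- 0, the vertices 1 and m - 1 are the nearest.
      Im₁-least : ∀ i → 0 ℕ.< i → i ℕ.< m → Im 1 * Im 1 ≤ Im i * Im i
      Im₁-least (suc i) _ i<m = ≤-by (*-nonneg (0≤Im i (ℕ.≤-trans (ℕ.n≤1+n i) (ℕ.<⇒≤ i<m))) (0≤Im (2 ℕ.+ i) i<m)) (square-Im i)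

      Im-last : ∀ i → suc i ≡ m → Im i * Im i ≈ Im 1 * Im 1
      Im-last (suc i) ≡.refl = ≈-by (trans (square-Im i) (trans (*-congˡ Im-m≈0) (zeroʳ _)))
      Im-last zero    ≡.refl = ⊥-elim (ℕ.<⇒≱ (ℕ.s≤s (ℕ.s≤s ℕ.z≤n)) 3≤m)

      vertex-distance : ∀ i → dot (vertex i ⊖ vertex 0) (vertex i ⊖ vertex 0) ≈ Im i * Im i
      vertex-distance i = trans (dot-cong step step) (trans (dot-·· (Im i) (Im i) (pow i) (pow i)) (trans (*-congˡ (norm i)) (*-identityʳ _)))
        where
        step : vertex i ⊖ vertex 0 ≐ vertex i
        step = ≐-trans (⊖-cong ≐-refl vertex-0) (solve 1 (λ x → x :- con (+ 0) := x) refl _ , solve 1 (λ x → x :- con (+ 0) := x) refl _)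

      is-regular : IsRegularPolygon m vertex
      is-regular = record
        { 3≤m         = 3≤m
        ; periodic    = vertex-periodic
        ; equilateral = Im 1 , side-distance
        -- Consecutive sides turn by ζ², so the interior angle, their supplement, has cosine -Re ζ².
        ; equiangular = angle , λ i → - Re 2 , Im 1 , Im 1 , reverse-distance i , side-distance (1 ℕ.+ i) , angle-dot i , is-angle
        ; convex      = convex
        }
        where
        side-distance : ∀ i → IsDistance (vertex i) (vertex (1 ℕ.+ i)) (Im 1)
        side-distance i = inj₁ 0<Im₁ , sym (trans (dot-cong (side-difference i) (side-difference i))
          (trans (dot-·· (Im 1) (Im 1) (side i) (side i)) (trans (*-congˡ (dot-side-side i)) (*-identityʳ _))))
        reverse-distance : ∀ i → IsDistance (vertex (1 ℕ.+ i)) (vertex i) (Im 1)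
        reverse-distance i = inj₁ 0<Im₁ , sym (trans (dot-cong (side-difference′ i) (side-difference′ i))
          (trans (dot-·· (- Im 1) (- Im 1) (side i) (side i)) (trans (*-congˡ (dot-side-side i))
            (solve 1 (λ t → (:- t :* :- t) :* con (+ 1) := t :* t) refl (Im 1)))))
        angle-dot : ∀ i → - Re 2 * (Im 1 * Im 1) ≈ dot (vertex i ⊖ vertex (1 ℕ.+ i)) (vertex (2 ℕ.+ i) ⊖ vertex (1 ℕ.+ i))
        angle-dot i = sym (trans (dot-cong (side-difference′ i) (side-difference (1 ℕ.+ i)))
          (trans (dot-·· (- Im 1) (Im 1) (side i) (side (1 ℕ.+ i))) (trans (*-congˡ (dot-side-next i))
            (solve 2 (λ t z → (:- t :* t) :* z := :- z :* (t :* t)) refl (Im 1) (Re 2)))))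
        angle-exists : ∃ (IsArccos (- Re 2))
        angle-exists = arccos-exists (≤-by (sq-nonneg (Im 2)) (≈-combine (- 1#) (norm 2)
          (solve 2 (λ x y → (con (+ 1) :- :- x :* :- x) :- y :* y := con (ℤ.- (+ 1)) :* ((x :* x :+ y :* y) :- con (+ 1))) refl (Re 2) (Im 2))))
        angle : Carrier
        angle = proj₁ angle-exists
        is-angle : IsArccos (- Re 2) angle
        is-angle = proj₂ angle-exists
        convex : ∀ i t → 2 ℕ.+ t ℕ.< m → 0# < orient (vertex i) (vertex (1 ℕ.+ i)) (vertex (2 ℕ.+ t ℕ.+ i))
        convex i t 2+t<m = <-respʳ-≈ (sym area)
          (*-pos (*-pos 0<Im₁ (0<Im (2 ℕ.+ t) ℕ.z<s 2+t<m)) (0<Im (1 ℕ.+ t) ℕ.z<s (ℕ.<-trans ℕ.≤-refl 2+t<m)))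
          where
          -- The circumscribed circle has diameter 1, so twice the area of an inscribed triangle is
          -- the product of its sides.
          area : orient (vertex i) (vertex (1 ℕ.+ i)) (vertex (2 ℕ.+ t ℕ.+ i)) ≈ (Im 1 * Im (2 ℕ.+ t)) * Im (1 ℕ.+ t)
          area = trans (cross-cong (side-difference i) (vertex-difference i (2 ℕ.+ t)))
            (trans (cross-·· (Im 1) (Im (2 ℕ.+ t)) (side i) (pow i ⊛ pow (2 ℕ.+ t ℕ.+ i)))
            (*-congˡ (trans (cross-⊛ (pow i) (pow (1 ℕ.+ i)) (pow (2 ℕ.+ t ℕ.+ i)))
            (trans (*-congʳ (norm i)) (trans (*-identityˡ _)
            (≡.subst (λ j → cross (pow (1 ℕ.+ i)) (pow (suc j)) ≈ Im (1 ℕ.+ t)) (ℕ.+-suc t i) (cross-pow (1 ℕ.+ i) (1 ℕ.+ t))))))))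

    -- The ordinate of the vertices 1 and m - 1. The horizontal line at this height serves both
    -- parities: for odd m it contains the nearest vertices, for even m it is perpendicular to the
    -- diameter through vertex 0.
    H : Carrier
    H = Im 1 * Im 1

    0<H : 0# < H
    0<H = *-pos 0<Im₁ 0<Im₁

    ℓ₀ : Line
    ℓ₀ = record { base = 0# , H ; direction = 1# , 0# ; nonzero = λ { (1≈0 , _) → 0≉1 (sym 1≈0) } }

    on-ℓ₀ : ∀ {x y} → y ≈ H → (x , y) ∈ₗ ℓ₀
    on-ℓ₀ {x} y≈H = trans (+-congʳ (*-congˡ (x≈y⇒x-y≈0 y≈H))) (solve 1 (λ x → con (+ 1) :* con (+ 0) :- con (+ 0) :* (x :- con (+ 0)) := con (+ 0)) refl x)

    opaque
      off-ℓ₀ : ¬ (vertex 0 ∈ₗ ℓ₀)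
      off-ℓ₀ on = >⇒≉ 0<H (≈-combine (- 1#) on
        (solve 1 (λ h → h :- con (+ 0) := con (ℤ.- (+ 1)) :* ((con (+ 1) :* (con (+ 0) :* con (+ 0) :- h) :- con (+ 0) :* (con (+ 0) :* con (+ 1) :- con (+ 0))) :- con (+ 0))) refl H))

      projection-line : IsProjectionLine m vertex ℓ₀
      projection-line = by-parity (parity m)
        where
        1<m : 1 ℕ.< m
        1<m = ℕ.≤-trans (ℕ.s≤s (ℕ.s≤s ℕ.z≤n)) 3≤m
        by-parity : (∃[ h ] m ≡ 2 ℕ.* h) ⊎ (∃[ h ] m ≡ 1 ℕ.+ 2 ℕ.* h) → IsProjectionLine m vertex ℓ₀
        by-parity (inj₁ (h , m≡2h)) = even h m≡2h perpendicular off-ℓ₀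
          where
          -- Twice the abscissa of vertex h is Im ζ²ʰ = Im ζᵐ, which vanishes.
          double : (1# + 1#) * (Im h * Re h) ≈ 0#
          double = trans (solve 2 (λ x y → con (+ 2) :* (y :* x) := y :* x :+ x :* y) refl (Re h) (Im h))
            (trans (sym (Im-+ h h)) (trans (reflexive (≡.cong Im (≡.trans (≡.cong (h ℕ.+_) (≡.sym (ℕ.+-identityʳ h))) (≡.sym m≡2h)))) Im-m≈0))
          perpendicular : Perpendicular ℓ₀ (vertex 0) (vertex h)
          perpendicular = trans (solve 2 (λ x y → con (+ 1) :* (y :* x :- con (+ 0) :* con (+ 1)) :+ con (+ 0) :* (y :* y :- con (+ 0) :* con (+ 0)) := y :* x)
            refl (Re h) (Im h)) (*-cancel-≈0 (>⇒≉ 0<2) double)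
        by-parity (inj₂ (h , m≡1+2h)) = odd h m≡1+2h 1 last (ℕ.<⇒≢ 1<last)
          (ℕ.z<s , 1<m , λ j 0<j j<m → ≤-respˡ-≈ (sym (vertex-distance 1)) (≤-respʳ-≈ (sym (vertex-distance j)) (Im₁-least j 0<j j<m)))
          (ℕ.<-trans ℕ.z<s 1<last , last<m , λ j 0<j j<m → ≤-respˡ-≈ (sym (trans (vertex-distance last) Im-last²))
             (≤-respʳ-≈ (sym (vertex-distance j)) (Im₁-least j 0<j j<m)))
          (on-ℓ₀ refl) (on-ℓ₀ Im-last²)
          where
          last : ℕ
          last = 2 ℕ.* h
          last<m : last ℕ.< m
          last<m = ≡.subst (last ℕ.<_) (≡.sym m≡1+2h) ℕ.≤-refl
          1<last : 1 ℕ.< last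
          1<last = ℕ.s≤s⁻¹ (≡.subst (3 ℕ.≤_) m≡1+2h 3≤m)
          Im-last² : Im last * Im last ≈ Im 1 * Im 1
          Im-last² = Im-last last (≡.sym m≡1+2h)

    -- The abscissa at which the line through the origin with direction ζⁱ reaches height H: H cot
    -- (iπ / m).
    cot : ℕ → Carrier
    cot i = (H * Re i) * reciprocal (Im i)

    opaque
      -- With φ = π / m, the difference is H sin φ / (sin iφ · sin (i + 1)φ), by the subtraction
      -- formula for the sine.
      cot-decreasing : ∀ i → 0 ℕ.< i → suc i ℕ.< m → cot (suc i) < cot i
      cot-decreasing i 0<i 1+i<m = <-by
        (*-pos (*-pos (*-pos 0<H (reciprocal-pos 0<Imᵢ)) (reciprocal-pos 0<Im₁₊ᵢ)) 0<s)
        (trans (+-cong (expand (*-reciprocal (>⇒≉ 0<Im₁₊ᵢ))) (-‿cong (expand (*-reciprocal (>⇒≉ 0<Imᵢ)))))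
        (trans (solve 7 (λ h x y x′ y′ a b → (y′ :* b) :* ((h :* x) :* a) :- (y :* a) :* ((h :* x′) :* b) :=
                                             ((h :* a) :* b) :* (y′ :* x :- y :* x′)) refl
                  H (Re i) (Im i) (Re (suc i)) (Im (suc i)) (reciprocal (Im i)) (reciprocal (Im (suc i))))
        (*-congˡ sine)))
        where
        0<Imᵢ : 0# < Im i
        0<Imᵢ = 0<Im i 0<i (ℕ.<-trans ℕ.≤-refl 1+i<m)
        0<Im₁₊ᵢ : 0# < Im (suc i)
        0<Im₁₊ᵢ = 0<Im (suc i) ℕ.z<s 1+i<m
        0<s : 0# < s
        0<s = <-respʳ-≈ Im-1 0<Im₁
        expand : ∀ {y z} → z ≈ 1# → y ≈ z * y
        expand {y} z≈1 = sym (trans (*-congʳ z≈1) (*-identityˡ y))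
        sine : Im (suc i) * Re i - Im i * Re (suc i) ≈ s
        sine = ≈-combine s (norm i) (solve 4 (λ c s x y → ((s :* x :+ c :* y) :* x :- y :* (c :* x :- s :* y)) :- s :=
          s :* ((x :* x :+ y :* y) :- con (+ 1))) refl c s (Re i) (Im i))

      vertex≢pole : ∀ i → 0 ℕ.< i → i ℕ.< m → ¬ (vertex 0 ≐ vertex i)
      vertex≢pole i 0<i i<m (_ , y) = >⇒≉ (*-pos (0<Im i 0<i i<m) (0<Im i 0<i i<m)) (trans (sym y) (zeroˡ _))

      image-on-ray : ∀ i → 0 ℕ.< i → i ℕ.< m → OnLineThrough (vertex 0) (vertex i) (cot i , H)
      image-on-ray i 0<i i<m = vertex≢pole i 0<i i<m ,
        ≈-combine (- (H * (Im i * Re i))) (*-reciprocal (>⇒≉ (0<Im i 0<i i<m))) (solve 4 (λ h x y r →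
          ((y :* x :- con (+ 0) :* con (+ 1)) :* (h :- con (+ 0) :* con (+ 0)) :- (y :* y :- con (+ 0) :* con (+ 0)) :* ((h :* x) :* r :- con (+ 0) :* con (+ 1))) :- con (+ 0) :=
          (:- (h :* (y :* x))) :* (y :* r :- con (+ 1))) refl H (Re i) (Im i) (reciprocal (Im i)))

    projected : ProjectedPolygon m
    projected = record
      { v        = vertex
      ; regular  = is-regular
      ; ℓ        = ℓ₀
      ; ℓ-choice = projection-line
      ; image    = λ i → cot i , H
      ; image-∈  = λ i 0<i i<m → image-on-ray i 0<i i<m , on-ℓ₀ refl
      }

  fromℕ : ℕ → Carrier
  fromℕ zero    = 0#
  fromℕ (suc n) = 1# + fromℕ n

  module _ (f : ℕ → Carrier) (step : ∀ i → f (suc i) < f i) where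
    decreasing : ∀ {i j} → i ℕ.< j → f j < f i
    decreasing {i} {suc j} i<1+j with ℕ.m<1+n⇒m<n∨m≡n i<1+j
    ... | inj₁ i<j    = <-trans (step j) (decreasing i<j)
    ... | inj₂ ≡.refl = step i

    decreasing⇒injective : ∀ {i j} → f i ≈ f j → i ≡ j
    decreasing⇒injective {i} {j} fi≈fj with ℕ.<-cmp i j
    ... | tri< i<j _ _ = ⊥-elim (>⇒≉ (decreasing i<j) fi≈fj)
    ... | tri≈ _ i≡j _ = i≡j
    ... | tri> _ _ j<i = ⊥-elim (<⇒≉ (decreasing j<i) fi≈fj)

  -- Many angles from one point off a line

  module PoleAndLine (H : Carrier) (0<H : 0# < H) (x : ℕ → Carrier) (x-step : ∀ i → x (suc i) < x i) where

    configuration : ∀ {N} → Fin (suc N) → Point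
    configuration zero    = 0# , 0#
    configuration (suc a) = x (Fin.toℕ a) , H

    configuration-distinct : ∀ {N} → Distinct (configuration {N})
    configuration-distinct zero    zero    _       = ≡.refl
    configuration-distinct zero    (suc b) (_ , e) = ⊥-elim (<⇒≉ 0<H e)
    configuration-distinct (suc a) zero    (_ , e) = ⊥-elim (>⇒≉ 0<H e)
    configuration-distinct (suc a) (suc b) (e , _) = ≡.cong suc (Fin.toℕ-injective (decreasing⇒injective x x-step e))

    opaque
      -- All second legs point left along the line, so the cosine is x / r, where r is the distance
      -- of the point from the pole. As H is fixed, it determines r and then x.
      cosine-injective : ∀ {a b L y} → x L < x a → x L < x b →
                         CosineOf ((0# , 0#) ⊖ (x a , H)) ((x L , H) ⊖ (x a , H)) y →
                         CosineOf ((0# , 0#) ⊖ (x b , H)) ((x L , H) ⊖ (x b , H)) y → x a ≈ x b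
      cosine-injective {a} {b} {L} {y} L<a L<b cos cos′ = compare-roots (abscissa L<a cos) (abscissa L<b cos′)
        where
        abscissa : ∀ {a} → x L < x a → CosineOf ((0# , 0#) ⊖ (x a , H)) ((x L , H) ⊖ (x a , H)) y →
                   ∃[ r ] (0# < r × r * r ≈ x a * x a + H * H × y * r ≈ x a)
        abscissa {a} L<a (r , s , 0<r , 0<s , rr , ss , yrs) = r , 0<r ,
          trans rr (solve 2 (λ x h → (con (+ 0) :- x) :* (con (+ 0) :- x) :+ (con (+ 0) :- h) :* (con (+ 0) :- h) := x :* x :+ h :* h) refl (x a) H) ,
          *-cancelˡ-≈ (>⇒≉ 0<s) (trans (solve 3 (λ y r s → s :* (y :* r) := y :* (r :* s)) refl y r s) (trans yrs
            (trans (solve 3 (λ x z h → (con (+ 0) :- x) :* (z :- x) :+ (con (+ 0) :- h) :* (h :- h) := (x :- z) :* x) refl (x a) (x L) H)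
                   (*-congʳ (sym s≈)))))
          where
          s≈ : s ≈ x a - x L
          s≈ = sq-cancel-≈ (inj₁ 0<s) (x≤y⇒0≤y-x (inj₁ L<a)) (trans ss
            (solve 3 (λ x z h → (z :- x) :* (z :- x) :+ (h :- h) :* (h :- h) := (x :- z) :* (x :- z)) refl (x a) (x L) H))
        compare-roots : ∃[ r ] (0# < r × r * r ≈ x a * x a + H * H × y * r ≈ x a) →
                        ∃[ r ] (0# < r × r * r ≈ x b * x b + H * H × y * r ≈ x b) → x a ≈ x b
        compare-roots (r , 0<r , rr , yr) (r′ , 0<r′ , rr′ , yr′) = trans (sym yr) (trans (*-congˡ r≈r′) yr′)
          where
          -- (1 − y²) r² = H², since y r = x.
          HH : ∀ {r z} → r * r ≈ z * z + H * H → y * r ≈ z → (1# - y * y) * (r * r) ≈ H * H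
          HH {r} {z} rr yr = trans (solve 2 (λ y r → (con (+ 1) :- y :* y) :* (r :* r) := r :* r :- (y :* r) :* (y :* r)) refl y r)
            (trans (+-cong rr (-‿cong (*-cong yr yr))) (solve 2 (λ z h → (z :* z :+ h :* h) :- z :* z := h :* h) refl z H))
          1-yy≉0 : ¬ (1# - y * y ≈ 0#)
          1-yy≉0 e = >⇒≉ (*-pos 0<H 0<H) (trans (sym (HH rr yr)) (trans (*-congʳ e) (zeroˡ _)))
          r≈r′ : r ≈ r′
          r≈r′ = sq-cancel-≈ (inj₁ 0<r) (inj₁ 0<r′) (*-cancelˡ-≈ 1-yy≉0 (trans (HH rr yr) (sym (HH rr′ yr′))))

      determined : ∀ {N} (a : Fin N) →
        ∃[ θ ] (DeterminedAngle (configuration {suc N}) θ ×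
                ∃[ y ] (CosineOf ((0# , 0#) ⊖ (x (Fin.toℕ a) , H)) ((x N , H) ⊖ (x (Fin.toℕ a) , H)) y × IsArccos y θ))
      determined {N} a = from (cosine-exists {o ⊖ q} {z ⊖ q} pole-leg last-leg)
        where
        o q z : Point
        o = 0# , 0#
        q = x (Fin.toℕ a) , H
        z = x N , H
        z<q : x N < x (Fin.toℕ a)
        z<q = decreasing x x-step (Fin.toℕ<n a)
        pole-leg : Nonzero (o ⊖ q)
        pole-leg (_ , e) = <⇒≉ 0<H (≈-by e)
        last-leg : Nonzero (z ⊖ q)
        last-leg (e , _) = <⇒≉ z<q (≈-by e)
        turns : ¬ (cross (o ⊖ q) (z ⊖ q) ≈ 0#)
        turns e = *-≉0 (>⇒≉ 0<H) (<⇒≉ (<-by (x<y⇒0<y-x z<q) (solve 2 (λ x z → con (+ 0) :- (z :- x) := x :- z) refl _ _)))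
          (trans (sym (solve 3 (λ x z h → (con (+ 0) :- x) :* (h :- h) :- (con (+ 0) :- h) :* (z :- x) := h :* (z :- x)) refl _ _ H)) e)
        -- Index 0 is the pole, so abscissa j sits at index 1 + j; abscissa N is the common end of
        -- all second legs.
        vertex last : Fin (suc (suc N))
        vertex = suc (Fin.inject₁ a)
        last = suc (Fin.fromℕ N)
        from : ∃ (CosineOf (o ⊖ q) (z ⊖ q)) → ∃[ θ ] (DeterminedAngle (configuration {suc N}) θ × ∃[ y ] (CosineOf (o ⊖ q) (z ⊖ q) y × IsArccos y θ))
        from (y , cos) = measure (arccos-exists (cosine²≤1 cos))
          where
          yy<1 : y * y < 1# * 1#
          yy<1 = <-respʳ-≈ (sym (*-identityˡ 1#)) (cosine²<1 turns cos)
          y<1 : y < 1#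
          y<1 = sq-cancel-< (inj₁ 0<1) yy<1
          -1<y : - 1# < y
          -1<y = <-by (x<y⇒0<y-x (sq-cancel-< { - y} (inj₁ 0<1) (<-respˡ-≈ (solve 1 (λ y → y :* y := :- y :* :- y) refl y) yy<1)))
            (solve 1 (λ y → y :- :- con (+ 1) := con (+ 1) :- :- y) refl y)
          measure : ∃ (IsArccos y) → ∃[ θ ] (DeterminedAngle (configuration {suc N}) θ × ∃[ y ] (CosineOf (o ⊖ q) (z ⊖ q) y × IsArccos y θ))
          measure (θ , is) = θ , ((zero , vertex , last , (λ ()) , vertex≢last , (λ ()) , angle) , arccos-pos y<1 is , arccos<π -1<y is) , y , cos , is
            where
            vertex≢last : vertex ≢ last
            vertex≢last e = ℕ.<⇒≢ (Fin.toℕ<n a) (≡.trans (≡.sym (Fin.toℕ-inject₁ a))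
              (≡.trans (≡.cong Fin.toℕ (Fin.suc-injective e)) (Fin.toℕ-fromℕ N)))
            angle : IsAngle o (configuration vertex) (configuration last) θ
            angle = ≡.subst₂ (λ i j → IsAngle o (x i , H) (x j , H) θ) (≡.sym (Fin.toℕ-inject₁ a)) (≡.sym (Fin.toℕ-fromℕ N))
                      (cosine⇒angle {o} {q} {z} cos is)

    many-angles : ∀ {N c} → A[ configuration {suc N} ]= c → N ℕ.≤ c
    many-angles {N} = ≤cardinality (λ a → proj₁ (determined a)) (λ a → proj₁ (proj₂ (determined a))) λ a b e →
      Fin.toℕ-injective (decreasing⇒injective x x-step (same e (proj₂ (proj₂ (determined a))) (proj₂ (proj₂ (determined b)))
        (decreasing x x-step (Fin.toℕ<n a)) (decreasing x x-step (Fin.toℕ<n b))))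
      where
      same : ∀ {i j θ θ′} → θ ≈ θ′ →
             ∃[ y ] (CosineOf ((0# , 0#) ⊖ (x i , H)) ((x N , H) ⊖ (x i , H)) y × IsArccos y θ) →
             ∃[ y ] (CosineOf ((0# , 0#) ⊖ (x j , H)) ((x N , H) ⊖ (x j , H)) y × IsArccos y θ′) →
             x N < x i → x N < x j → x i ≈ x j
      same θ≈θ′ (y , cos , is) (y′ , cos′ , is′) N<i N<j =
        cosine-injective N<i N<j cos (cosine-resp-≈ (sym (arccos-injective θ≈θ′ is is′)) cos′)

  -- A configuration for the lower bound

  module Witness (k : ℕ) {q : ℕ} (0<q : 0 ℕ.< q) {c s : Carrier} (root : IsHalfTurnRoot (2 ℕ.+ q) c s) where
    3≤m : 3 ℕ.≤ 2 ℕ.+ q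
    3≤m = ℕ.s≤s (ℕ.s≤s 0<q)

    open RootPolygon 3≤m root

    -- The projected vertices, ordered from right to left, followed by the additional points at unit distances.
    x : ℕ → Carrier
    x i = cot (suc (i ℕ.⊓ q)) - fromℕ (i ℕ.∸ q)

    x-projected : ∀ {i} → i ℕ.≤ q → x i ≈ cot (suc i)
    x-projected {i} i≤q = trans
      (reflexive (≡.cong₂ (λ a b → cot (suc a) - fromℕ b) (ℕ.m≤n⇒m⊓n≡m i≤q) (ℕ.m≤n⇒m∸n≡0 i≤q)))
      (solve 1 (λ y → y :- con (+ 0) := y) refl _)

    x-step : ∀ i → x (suc i) < x i
    x-step i with ℕ.<-≤-connex i q
    ... | inj₁ i<q = <-respˡ-≈ (sym (x-projected i<q)) (<-respʳ-≈ (sym (x-projected (ℕ.<⇒≤ i<q)))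
          (cot-decreasing (suc i) ℕ.z<s (ℕ.s<s (ℕ.s<s i<q))))
    ... | inj₂ q≤i = <-by 0<1 (trans
          (+-congˡ (-‿cong (reflexive (≡.cong₂ (λ a b → cot (suc a) - fromℕ b)
            (≡.trans (ℕ.m≥n⇒m⊓n≡n (ℕ.m≤n⇒m≤1+n q≤i)) (≡.sym (ℕ.m≥n⇒m⊓n≡n q≤i))) (ℕ.+-∸-assoc 1 q≤i)))))
          (solve 2 (λ y n → (y :- n) :- (y :- (con (+ 1) :+ n)) := con (+ 1)) refl _ _))

    open PoleAndLine H 0<H x x-step public

    contains : ∀ z → z ∈ₚ projected → ∃[ j ] (configuration {suc (q ℕ.+ k)} j ≐ z)
    contains z (inj₁ z≐v₀) = zero , ≐-sym (≐-trans z≐v₀ vertex-0)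
    contains z (inj₂ (suc i , _ , i<m , z≐image)) = suc (Fin.fromℕ< i<N) , ≐-trans
      (trans (reflexive (≡.cong x (Fin.toℕ-fromℕ< i<N))) (x-projected (ℕ.s≤s⁻¹ (ℕ.s<s⁻¹ i<m))) , refl) (≐-sym z≐image)
      where
      i<N : i ℕ.< suc (q ℕ.+ k)
      i<N = ℕ.<-≤-trans (ℕ.s<s⁻¹ i<m) (ℕ.s≤s (ℕ.m≤m+n q k))

    classify : ∀ j → (configuration {suc (q ℕ.+ k)} j ∈ₚ projected) ⊎ (configuration j ∈ₗ ℓ₀)
    classify zero    = inj₁ (inj₁ (≐-sym vertex-0))
    classify (suc a) = inj₂ (on-ℓ₀ refl)

    configuration∈𝓛 : 𝓛 k (2 ℕ.+ (q ℕ.+ k)) configuration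
    configuration∈𝓛 = configuration-distinct , 2 ℕ.+ q , ≡.refl , projected , contains , classify

  -- The maximum and its order of growth

  angle-count : ∀ k q → 0 ℕ.< q → ∃[ c ] (AngleCounts k (2 ℕ.+ (q ℕ.+ k)) c × q ℕ.+ k ℕ.≤ c)
  angle-count k q 0<q = let c , s , root = half-turn-root (2 ℕ.+ q) (ℕ.s≤s (ℕ.s≤s ℕ.z≤n))
                            open Witness k 0<q root
                            a , A≡a = covered⇒cardinality (𝓛-covered configuration∈𝓛)
                        in a , (configuration , configuration∈𝓛 , A≡a) , many-angles A≡a

  angle-counts-bounded : ∀ k n {a} → AngleCounts k n a → a ℕ.≤ codes n k
  angle-counts-bounded k n (P , P∈𝓛 , A≡a) = cardinality≤ (𝓛-covered P∈𝓛) A≡a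

  bounded⇒maximum : (S : ℕ → Set) → ∃ S → ∀ B → (∀ b → S b → b ℕ.≤ B) → ∃ (IsMaximum S)
  bounded⇒maximum S (a , Sa) zero    bound = a , Sa , λ b Sb → ≡.subst (b ℕ.≤_) (≡.sym (ℕ.n≤0⇒n≡0 (bound a Sa))) (bound b Sb)
  bounded⇒maximum S ∃S (suc B) bound with em {S (suc B)}
  ... | yes S[1+B] = suc B , S[1+B] , bound
  ... | no ¬S[1+B] = bounded⇒maximum S ∃S B λ b Sb → ℕ.s≤s⁻¹ (ℕ.≤∧≢⇒< (bound b Sb) λ { ≡.refl → ¬S[1+B] Sb })

  large-decomposition : ∀ {k n} → 3 ℕ.+ k ℕ.≤ n → ∃[ q ] (0 ℕ.< q × 2 ℕ.+ (q ℕ.+ k) ≡ n)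
  large-decomposition {k} {n} 3+k≤n = n ℕ.∸ (2 ℕ.+ k) , ℕ.m<n⇒0<n∸m 3+k≤n ,
    ≡.trans (≡.trans (≡.cong (2 ℕ.+_) (ℕ.+-comm _ k)) ≡.refl) (ℕ.m+[n∸m]≡n (ℕ.<⇒≤ 3+k≤n))

  module _ (k : ℕ) where
    maximum : ∀ {n} → 3 ℕ.+ k ℕ.≤ n → ∃ (IsMaximum (AngleCounts k n))
    maximum {n} 3+k≤n = let q , 0<q , n≡ = large-decomposition 3+k≤n
                            a , count , _ = angle-count k q 0<q
                        in bounded⇒maximum (AngleCounts k n) (a , ≡.subst (λ n → AngleCounts k n a) n≡ count)
                             (codes n k) (λ b → angle-counts-bounded k n)

    maxA : ℕ → ℕ
    maxA n with 3 ℕ.+ k ℕ.≤? n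
    ... | yes 3+k≤n = proj₁ (maximum 3+k≤n)
    -- For n < 3 + k the collection is empty, since m = n - k would be below 3; the value is a
    -- default.
    ... | no _      = 0

    maxA-maximum : ∀ n → 3 ℕ.+ k ℕ.≤ n → IsMaximum (AngleCounts k n) (maxA n)
    maxA-maximum n 3+k≤n with 3 ℕ.+ k ℕ.≤? n
    ... | yes 3+k≤n′ = proj₂ (maximum 3+k≤n′)
    ... | no  3+k≰n  = ⊥-elim (3+k≰n 3+k≤n)

    -- Replacing the single degenerate code by n of them gives 2 (3 + k) n, whence the constant 2k +
    -- 6.
    codes-linear : ∀ n → 1 ℕ.≤ n → codes n k ℕ.≤ (2 ℕ.* k ℕ.+ 6) ℕ.* (n ℕ.* (k ℕ.⊔ 1))
    codes-linear n 1≤n = begin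
      2 ℕ.* (n ℕ.+ (n ℕ.+ (k ℕ.* n ℕ.+ 1)))    ≤⟨ ℕ.*-monoʳ-≤ 2 (ℕ.+-monoʳ-≤ n (ℕ.+-monoʳ-≤ n (ℕ.+-monoʳ-≤ (k ℕ.* n) 1≤n))) ⟩
      2 ℕ.* (n ℕ.+ (n ℕ.+ (k ℕ.* n ℕ.+ n)))    ≡⟨ ℕ-solve 2 (λ k n → ℕ-con 2 ℕ:* (n ℕ:+ (n ℕ:+ (k ℕ:* n ℕ:+ n))) ℕ:= (ℕ-con 2 ℕ:* k ℕ:+ ℕ-con 6) ℕ:* (n ℕ:* ℕ-con 1)) ≡.refl k n ⟩
      (2 ℕ.* k ℕ.+ 6) ℕ.* (n ℕ.* 1)            ≤⟨ ℕ.*-monoʳ-≤ (2 ℕ.* k ℕ.+ 6) (ℕ.*-monoʳ-≤ n (ℕ.m≤n⊔m k 1)) ⟩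
      (2 ℕ.* k ℕ.+ 6) ℕ.* (n ℕ.* (k ℕ.⊔ 1))    ∎
      where
      open ℕ.≤-Reasoning
      open +-*-Solver using () renaming (solve to ℕ-solve; con to ℕ-con; _:+_ to _ℕ:+_; _:*_ to _ℕ:*_; _:=_ to _ℕ:=_)

    maxA-upper : maxA =O λ n → n ℕ.* (k ℕ.⊔ 1)
    maxA-upper = 2 ℕ.* k ℕ.+ 6 , 3 ℕ.+ k , λ n 3+k≤n →
      ℕ.≤-trans (angle-counts-bounded k n (proj₁ (maxA-maximum n 3+k≤n))) (codes-linear n (ℕ.≤-trans (ℕ.s≤s ℕ.z≤n) 3+k≤n))

    linear≤ : ∀ q → 0 ℕ.< q → 2 ℕ.+ (q ℕ.+ k) ℕ.≤ 3 ℕ.* (q ℕ.+ k)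
    linear≤ (suc q) _ = begin
      3 ℕ.+ (q ℕ.+ k)              ≤⟨ ℕ.+-monoʳ-≤ 3 (ℕ.m≤n*m (q ℕ.+ k) 3) ⟩
      3 ℕ.+ 3 ℕ.* (q ℕ.+ k)        ≡⟨ ℕ.*-suc 3 (q ℕ.+ k) ⟨
      3 ℕ.* (suc q ℕ.+ k)          ∎
      where open ℕ.≤-Reasoning

    maxA-lower : maxA =Ω λ n → n ℕ.* (k ℕ.⊔ 1)
    -- The factor 3 comes from n ≤ 3 (n - 2), where n - 2 bounds the maximum from below; the factor
    -- `k ⊔ 1` absorbs that of the target and is constant in n.
    maxA-lower = 3 ℕ.* (k ℕ.⊔ 1) , 3 ℕ.+ k , λ n 3+k≤n → bound n 3+k≤n (large-decomposition 3+k≤n)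
      where
      open ℕ.≤-Reasoning
      bound : ∀ n → 3 ℕ.+ k ℕ.≤ n → ∃[ q ] (0 ℕ.< q × 2 ℕ.+ (q ℕ.+ k) ≡ n) →
              n ℕ.* (k ℕ.⊔ 1) ℕ.≤ 3 ℕ.* (k ℕ.⊔ 1) ℕ.* maxA n
      bound n 3+k≤n (q , 0<q , ≡.refl) = let a , count , q+k≤a = angle-count k q 0<q in begin
        n ℕ.* (k ℕ.⊔ 1)                   ≤⟨ ℕ.*-monoˡ-≤ (k ℕ.⊔ 1) (linear≤ q 0<q) ⟩
        3 ℕ.* (q ℕ.+ k) ℕ.* (k ℕ.⊔ 1)     ≤⟨ ℕ.*-monoˡ-≤ (k ℕ.⊔ 1) (ℕ.*-monoʳ-≤ 3 (ℕ.≤-trans q+k≤a (proj₂ (maxA-maximum n 3+k≤n) a count))) ⟩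
        3 ℕ.* maxA n ℕ.* (k ℕ.⊔ 1)        ≡⟨ ℕ.*-assoc 3 (maxA n) (k ℕ.⊔ 1) ⟩
        3 ℕ.* (maxA n ℕ.* (k ℕ.⊔ 1))      ≡⟨ ≡.cong (3 ℕ.*_) (ℕ.*-comm (maxA n) (k ℕ.⊔ 1)) ⟩
        3 ℕ.* ((k ℕ.⊔ 1) ℕ.* maxA n)      ≡⟨ ℕ.*-assoc 3 (k ℕ.⊔ 1) (maxA n) ⟨
        3 ℕ.* (k ℕ.⊔ 1) ℕ.* maxA n        ∎

open import Data.Nat using (_+_; _*_; _≤_; _⊔_)

proposition3p4 : ExcludedMiddle 0ℓ →
    (ℝ : RealNumbers) →
    (k : ℕ) →
    Σ (ℕ → ℕ) λ maxA →
    (∀ n → 3 + k ≤ n → IsMaximum (Plane.AngleCounts ℝ k n) (maxA n)) ×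
    (maxA =Θ λ n → n * (k ⊔ 1))
proposition3p4 em ℝ k = maxA k , maxA-maximum k , maxA-upper k , maxA-lower k
  where open Development em ℝ
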